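{- There is an algorithm (in the word-RAM model) that, given a Parikh vector $P = (P_1,\dots,P_\sigma)$ with $\sum_i P_i = n$ and a word $w \in \Sigma^{*|_P}$, after $O(n \log n)$ preprocessing time outputs, one at a time, the sequence of 2-swaps $(i,j)$ corresponding to the consecutive edges of a Hamiltonian path of $G(P)$ starting at $w$, with a delay of at most $O(\sigma \log n)$ time between consecutive outputs.
   Context: Alphabet $\Sigma = [\sigma]$. For $P \in \mathbb{N}^\sigma$, $n := \sum_a P[a]$ and $\Sigma^{*|_P}$ is the set of words of length $n$ in which each symbol $a$ occurs exactly $P[a]$ times. For a word $w$ and $i\neq j$ with $w[i]\neq w[j]$, the 2-swap $w\circ(i,j)$ exchanges the symbols at positions $i$ and $j$. The configuration graph $G(P)$ has vertex set $\Sigma^{*|_P}$ and an edge $\{w,u\}$ whenever $u = w\circ(i,j)$ for some 2-swap. A Hamiltonian path starting at $w$ visits every vertex exactly once, beginning at $w$; it is output as the sequence of swaps $(i,j)$ transforming each visited word into the next. -}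

module Defs where

open import Data.Bool using (Bool; if_then_else_; _∧_; _∨_; _xor_)
open import Data.Fin using (Fin; toℕ)
import Data.Fin as Fin
open import Data.List using (List; []; _∷_; _++_; map)
open import Data.List.Membership.Propositional using (_∈_)
open import Data.List.Relation.Unary.All using (All)
open import Data.List.Relation.Unary.Linked using (Linked)
open import Data.List.Relation.Unary.Unique.Propositional using (Unique)
open import Data.Maybe using (Maybe; just; nothing)
open import Data.Nat using (ℕ; zero; suc; _+_; _*_; _∸_; _^_; _/_; _%_; _≤_; _≡ᵇ_; _<ᵇ_; ⌊_/2⌋)
open import Data.Nat.Properties using (m^n≢0)
open import Data.Product using (_×_; _,_; ∃-syntax)
open import Data.Vec using (Vec; lookup; toList; count; _[_]≔_)
open import Relation.Binary.PropositionalEquality using (_≡_; _≢_)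

------------------------------------------------------------------------
-- Words, 2-swaps and the configuration graph G(P)

-- The alphabet [σ] and the positions 1..n are represented, shifted by
-- one, by Fin σ and Fin n.

Word : ℕ → ℕ → Set
Word σ n = Vec (Fin σ) n

HasParikh : ∀ {σ n} → Vec ℕ σ → Word σ n → Set
HasParikh {σ} P w = (a : Fin σ) → count (Fin._≟ a) w ≡ lookup P a

Swap : ℕ → Set
Swap n = Fin n × Fin n

_∘_ : ∀ {σ n} → Word σ n → Swap n → Word σ n
w ∘ (i , j) = (w [ i ]≔ lookup w j) [ j ]≔ lookup w i

IsSwap : ∀ {σ n} → Word σ n → Swap n → Set
IsSwap w (i , j) = i ≢ j × lookup w i ≢ lookup w j

Edge : ∀ {σ n} → Word σ n → Word σ n → Set
Edge {n = n} w u = ∃[ s ] (IsSwap {n = n} w s × u ≡ w ∘ s)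

record IsHamiltonianPath {σ n} (P : Vec ℕ σ) (path : List (Word σ n)) : Set where
  field
    vertices   : All (HasParikh P) path
    edges      : Linked Edge path
    noRepeats  : Unique path
    exhaustive : ∀ u → HasParikh P u → u ∈ path

data SwapsOf {σ n} : List (Word σ n) → List (Swap n) → Set where
  [-] : ∀ {w} → SwapsOf (w ∷ []) []
  _∷_ : ∀ {w u path s ss} → IsSwap w s × u ≡ w ∘ s →
        SwapsOf (u ∷ path) ss → SwapsOf (w ∷ u ∷ path) (s ∷ ss)

------------------------------------------------------------------------
-- Word RAM

-- Registers are named by ℕ, but a program is a finite list and so only
-- ever mentions a constant number of them.

Reg : Set
Reg = ℕ

data Op : Set where
  add sub mul div mod and or xor shl shr eq lt : Op

data Instr : Set where
  const  : Reg → ℕ → Instr              -- r := k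
  op     : Op → Reg → Reg → Reg → Instr -- r := s ⊕ t
  load   : Reg → Reg → Instr            -- r := mem[s]
  store  : Reg → Reg → Instr            -- mem[r] := s
  jump   : ℕ → Instr
  jumpZ  : Reg → ℕ → Instr              -- jump if r = 0
  output : Reg → Reg → Instr
  halt   : Instr

Program : Set
Program = List Instr

record State : Set where
  constructor state
  field
    pc  : ℕ
    reg : ℕ → ℕ
    mem : ℕ → ℕ

data Outcome : Set where
  halted : Outcome
  silent : State → Outcome
  emits  : ℕ × ℕ → State → Outcome

fetch : Program → ℕ → Maybe Instr
fetch []       _       = nothing
fetch (x ∷ xs) zero    = just x
fetch (x ∷ xs) (suc k) = fetch xs k

update : (ℕ → ℕ) → ℕ → ℕ → ℕ → ℕ
update f k v x = if x ≡ᵇ k then v else f x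

bit : Bool → ℕ
bit b = if b then 1 else 0

bitwise : (Bool → Bool → Bool) → ℕ → ℕ → ℕ → ℕ
bitwise f zero    x y = 0
bitwise f (suc k) x y =
  bit (f (x % 2 ≡ᵇ 1) (y % 2 ≡ᵇ 1)) + 2 * bitwise f k ⌊ x /2⌋ ⌊ y /2⌋

-- W is the number of bits in a word.
module WordRAM (W : ℕ) where

  -- Every value written to a register is truncated to W bits, hence
  -- every address is below 2 ^ W.
  trunc : ℕ → ℕ
  trunc x = _%_ x (2 ^ W) ⦃ m^n≢0 2 W ⦄

  -- Division and remainder by zero yield 0.
  ⟦_⟧ : Op → ℕ → ℕ → ℕ
  ⟦ add ⟧ x y       = x + y
  ⟦ sub ⟧ x y       = (x + 2 ^ W) ∸ y
  ⟦ mul ⟧ x y       = x * y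
  ⟦ div ⟧ x zero    = 0
  ⟦ div ⟧ x (suc y) = x / suc y
  ⟦ mod ⟧ x zero    = 0
  ⟦ mod ⟧ x (suc y) = x % suc y
  ⟦ and ⟧ x y       = bitwise _∧_ W x y
  ⟦ or  ⟧ x y       = bitwise _∨_ W x y
  ⟦ xor ⟧ x y       = bitwise _xor_ W x y
  ⟦ shl ⟧ x y       = x * 2 ^ y
  ⟦ shr ⟧ x y       = _/_ x (2 ^ y) ⦃ m^n≢0 2 y ⦄
  ⟦ eq  ⟧ x y       = bit (x ≡ᵇ y)
  ⟦ lt  ⟧ x y       = bit (x <ᵇ y)

  exec : Maybe Instr → State → Outcome
  exec nothing             _               = halted
  exec (just halt)         _               = halted
  exec (just (const r k))  (state pc ρ μ) = silent (state (suc pc) (update ρ r (trunc k)) μ)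
  exec (just (op o r s t)) (state pc ρ μ) = silent (state (suc pc) (update ρ r (trunc (⟦ o ⟧ (ρ s) (ρ t)))) μ)
  exec (just (load r s))   (state pc ρ μ) = silent (state (suc pc) (update ρ r (trunc (μ (ρ s)))) μ)
  exec (just (store r s))  (state pc ρ μ) = silent (state (suc pc) ρ (update μ (ρ r) (ρ s)))
  exec (just (jump l))     (state pc ρ μ) = silent (state l ρ μ)
  exec (just (jumpZ r l))  (state pc ρ μ) = silent (state (if ρ r ≡ᵇ 0 then l else suc pc) ρ μ)
  exec (just (output r s)) (state pc ρ μ) = emits (ρ r , ρ s) (state (suc pc) ρ μ)

  -- One step is one instruction and costs one unit of time.
  step : Program → State → Outcome
  step prog st = exec (fetch prog (State.pc st)) st

  -- Silent prog s t s′: from s, exactly t steps lead to s′ with no output.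
  data Silent (prog : Program) : State → ℕ → State → Set where
    stop : ∀ {s} → Silent prog s 0 s
    next : ∀ {s s′ s″ t} → step prog s ≡ silent s′ →
           Silent prog s′ t s″ → Silent prog s (suc t) s″

  -- From s, the machine outputs exactly the given pairs and then halts; at
  -- most d steps are spent before the first output, between consecutive
  -- outputs, and between the last output and halting.
  data OutputsWithDelay (prog : Program) (d : ℕ) : State → List (ℕ × ℕ) → Set where
    finish : ∀ {s s′ t} → Silent prog s t s′ → step prog s′ ≡ halted →
             suc t ≤ d → OutputsWithDelay prog d s []
    emit   : ∀ {s s′ s″ t o os} → Silent prog s t s′ → step prog s′ ≡ emits o s″ →
             suc t ≤ d → OutputsWithDelay prog d s″ os →
             OutputsWithDelay prog d s (o ∷ os)

  Enumerates : (prog : Program) (preprocessing delay : ℕ) → State → List (ℕ × ℕ) → Set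
  Enumerates prog p d s os =
    ∃[ t ] ∃[ s′ ] (t ≤ p × Silent prog s t s′ × OutputsWithDelay prog d s′ os)

------------------------------------------------------------------------
-- Input and output conventions

cells : List ℕ → ℕ → ℕ
cells []       _       = 0
cells (x ∷ xs) zero    = x
cells (x ∷ xs) (suc k) = cells xs k

-- The input occupies an initial segment of memory: n, σ, P₁ … P_σ, w₁ … wₙ.
input : ∀ {σ n} → Vec ℕ σ → Word σ n → List ℕ
input {σ} {n} P w = n ∷ σ ∷ toList P ++ map toℕ (toList w)

initial : List ℕ → State
initial xs = state 0 (λ _ → 0) (cells xs)

encode : ∀ {n} → Swap n → ℕ × ℕ
encode (i , j) = toℕ i , toℕ j

{-# OPTIONS --safe #-}
module Submission where

-- Fix the positions ("levels") from left to right.  To enumerate all words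
-- with a given prefix of length k from an arbitrary starting word, enumerate
-- those with the current letter at k, then swap into position k a letter not
-- yet tried there, taken from any later position, and repeat: the remaining
-- letters are the same whatever word the inner enumeration ends in.  So the
-- next swap is always at the deepest level with an untried letter, and the
-- words still to be visited are those whose first difference from the current
-- word is an untried letter at an unfinished level.
--
-- For the delay, the unfinished levels form a stack.  After a swap at level k
-- the levels above k are fresh, and those that are unfinished form an interval
-- ending where the constant suffix begins; the interval is pushed in O(1)
-- because its inner links are the default ones.  For each symbol a tournament
-- tree over the positions keeps its last occurrence, which gives both the swap
-- partner and the end of the interval: O(σ) queries and O(log n) per update.
-- The algorithm is written in a small while language with weakest
-- preconditions, compiled to the word RAM.

open import Defs
open import Algebra.Properties.CommutativeSemigroup using (x∙yz≈y∙xz)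
open import Data.Bool using (true; false; if_then_else_; _∧_; T)
open import Data.Empty using (⊥; ⊥-elim)
open import Data.Fin using (Fin; toℕ; fromℕ<) renaming (zero to fzero; suc to fsuc)
import Data.Fin as Fin
open import Data.Fin.Properties using (toℕ-injective; toℕ-fromℕ<; toℕ<n)
open import Data.List using (List; []; _∷_; _++_; length; map; allFin; cartesianProductWith)
open import Data.List.Membership.Propositional using (_∈_; _∉_)
open import Data.List.Membership.Propositional.Properties using (∈-cartesianProductWith⁺; ∈-allFin)
open import Data.List.Properties using (length-++; length-map; ++-assoc; ++-identityʳ)
open import Data.List.Relation.Unary.All using (All; []; _∷_)
import Data.List.Relation.Unary.All as All
import Data.List.Relation.Unary.AllPairs as AllPairs
open import Data.List.Relation.Unary.Any using (here; there)
open import Data.List.Relation.Unary.Linked using (Linked; [-]; _∷_)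
open import Data.List.Relation.Unary.Unique.Propositional using (Unique)
open import Data.Maybe using (just)
open import Data.Nat
open import Data.Nat.DivMod using (m<n⇒m%n≡m; [m+n]%n≡m%n; m/n≤m; m<n*o⇒m/o<n; m*n/n≡m; +-distrib-/-∣ˡ; m≡m%n+[m/n]*n; m%n<n)
open import Data.Nat.Divisibility using (divides)
open import Data.Nat.Induction using (<-rec)
open import Data.Nat.Logarithm using (⌈log₂_⌉; ⌈log₂⌈n/2⌉⌉≡⌈log₂n⌉∸1; ⌈log₂⌉-mono-≤)
open import Data.Nat.Properties
open import Data.Product using (_×_; _,_; ∃-syntax; proj₁; proj₂)
open import Data.Sum using (_⊎_; inj₁; inj₂)
open import Data.Unit using (⊤; tt)
open import Data.Vec using (Vec; []; _∷_; sum; lookup; toList; count; _[_]≔_)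
open import Data.Vec.Properties using (lookup∘updateAt′; length-toList; count≤n)
open import Relation.Binary.Definitions using (tri<; tri≈; tri>)
open import Relation.Binary.PropositionalEquality
open import Relation.Nullary using (¬_; yes; no; Dec; does)
open import Relation.Nullary.Decidable using (dec-true; dec-false)

-- The delay is a worst-case bound, so one round can afford only a fixed number of scans of the
-- alphabet and of tree updates. This works because every level on the stack still has an untried
-- letter further right. A swap at the top level `k` merely permutes the letters beyond any lower
-- level, so it can exhaust `k` alone: a round pops at most one level and clears at most one row of
-- flags. The cleared row is also what makes `k` fresh again once a swap further left reopens it.
-- Correctness is not proved by recursion over the levels but by an invariant on sets of words:
-- within G(P), the words to be visited before a swap are the new word together with those to be
-- visited after it, and the new word is not among the latter. This yields both exhaustiveness and
-- the absence of repetitions, and termination follows by deleting the new word from a finite list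
-- that contains all remaining ones. For n < 2 the graph has a single vertex and the program halts
-- at once, so the main argument may assume n ≥ 2.

≡ᵇ-refl : ∀ m → (m ≡ᵇ m) ≡ true
≡ᵇ-refl zero    = refl
≡ᵇ-refl (suc m) = ≡ᵇ-refl m

≢⇒≡ᵇ-false : ∀ {m n} → m ≢ n → (m ≡ᵇ n) ≡ false
≢⇒≡ᵇ-false {zero}  {zero}  m≢n = ⊥-elim (m≢n refl)
≢⇒≡ᵇ-false {zero}  {suc n} m≢n = refl
≢⇒≡ᵇ-false {suc m} {zero}  m≢n = refl
≢⇒≡ᵇ-false {suc m} {suc n} m≢n = ≢⇒≡ᵇ-false (λ e → m≢n (cong suc e))

update-≡ : ∀ f k v → update f k v k ≡ v
update-≡ f k v rewrite ≡ᵇ-refl k = refl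

update-≢ : ∀ f {k x} v → x ≢ k → update f k v x ≡ f x
update-≢ f v x≢k rewrite ≢⇒≡ᵇ-false x≢k = refl

-- A while language over variables and a three-dimensional memory

-- inp holds the input in row 0; word and ptr use the diagonal cells (p , p);
-- row b of tree is the tournament tree of symbol b; used is indexed by level
-- and symbol.
data Tag : Set where
  inp word tree used ptr : Tag

code : Tag → ℕ
code inp  = 0
code word = 1
code tree = 2
code used = 3
code ptr  = 4

data Opd : Set where
  #0 #1 #n #σ #h : Opd
  var            : ℕ → Opd

data Rhs : Set where
  mov half             : Opd → Rhs
  plus minus less diff : Opd → Opd → Rhs
  get                  : Tag → Opd → Opd → Rhs

-- Each loop is annotated with a bound on its number of iterations. The bound enters the logic and
-- the time analysis and leaves no trace in the machine code.
data Range : Set where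
  ⟨n⟩ ⟨σ⟩ ⟨log⟩ : Range

infix  5 _≔_
infixr 4 _⨾_

data Cmd : Set where
  _≔_   : ℕ → Rhs → Cmd
  put   : Tag → Opd → Opd → Opd → Cmd
  _⨾_   : Cmd → Cmd → Cmd
  when  : Opd → Cmd → Cmd
  while : Range → Opd → Cmd → Cmd

Vars : Set
Vars = ℕ → ℕ

Mem : Set
Mem = Tag → ℕ → ℕ → ℕ

-- Comparing the codes of the tags lets a write reduce away at every other concrete tag, so frame
-- conditions across tags hold by computation.
write : Mem → Tag → ℕ → ℕ → ℕ → Mem
write G t x y v t′ x′ y′ =
  if (code t′ ≡ᵇ code t) ∧ ((x′ ≡ᵇ x) ∧ (y′ ≡ᵇ y)) then v else G t′ x′ y′

write-≡ : ∀ G t {x y x′ y′} v → x′ ≡ x → y′ ≡ y → write G t x y v t x′ y′ ≡ v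
write-≡ G t {x} {y} v refl refl
  rewrite ≡ᵇ-refl (code t) | ≡ᵇ-refl x | ≡ᵇ-refl y = refl

write-≢ˣ : ∀ G t {x y x′ y′} v → x′ ≢ x → write G t x y v t x′ y′ ≡ G t x′ y′
write-≢ˣ G t v x≢ rewrite ≡ᵇ-refl (code t) | ≢⇒≡ᵇ-false x≢ = refl

write-≢ʸ : ∀ G t {x y x′ y′} v → y′ ≢ y → write G t x y v t x′ y′ ≡ G t x′ y′
write-≢ʸ G t {x} {x′ = x′} v y≢
  rewrite ≡ᵇ-refl (code t) | ≢⇒≡ᵇ-false y≢ with x′ ≡ᵇ x
... | true  = refl
... | false = refl

write-≤ : ∀ {G t x y v m} → (∀ t x y → G t x y ≤ m) → v ≤ m → ∀ t′ x′ y′ → write G t x y v t′ x′ y′ ≤ m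
write-≤ {G} {t} {x} {y} G≤ v≤ t′ x′ y′ with (code t′ ≡ᵇ code t) ∧ ((x′ ≡ᵇ x) ∧ (y′ ≡ᵇ y))
... | true  = v≤
... | false = G≤ t′ x′ y′

-- Machine registers 0 … 4 hold the constants 0, 1, n, σ and σ + 2,
-- register 5 the radix of memory addresses; 6 and 7 are temporaries.

register : Opd → Reg
register #0      = 0
register #1      = 1
register #n      = 2
register #σ      = 3
register #h      = 4
register (var r) = 8 + r

address : Tag → Opd → Opd → Program
address t a b =
  const 6 (code t) ∷ op mul 6 6 5 ∷ op add 6 6 (register a) ∷
  op mul 6 6 5 ∷ op add 6 6 (register b) ∷ []

compileRhs : Reg → Rhs → Program
compileRhs r (mov a)     = op add r (register a) 0 ∷ []
compileRhs r (half a)    = const 6 2 ∷ op div r (register a) 6 ∷ []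
compileRhs r (plus a b)  = op add r (register a) (register b) ∷ []
-- Machine subtraction wraps around; the factor, the bit of b < a, turns it into truncated
-- subtraction.
compileRhs r (minus a b) =
  op sub 6 (register a) (register b) ∷ op lt 7 (register b) (register a) ∷ op mul r 6 7 ∷ []
compileRhs r (less a b)  = op lt r (register a) (register b) ∷ []
compileRhs r (diff a b)  = op eq 6 (register a) (register b) ∷ op eq r 6 0 ∷ []
compileRhs r (get t a b) = address t a b ++ load r 6 ∷ []

compile : Cmd → ℕ → Program
compile (r ≔ e)       pc = compileRhs (8 + r) e
compile (put t a b v) pc = address t a b ++ store 6 (register v) ∷ []
compile (c ⨾ d)       pc = compile c pc ++ compile d (length (compile c pc) + pc)
compile (when a c)    pc =
  jumpZ (register a) (length (compile c (suc pc)) + suc pc) ∷ compile c (suc pc)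
compile (while _ a c) pc =
  jumpZ (register a) (suc (length (compile c (suc pc)) + suc pc)) ∷
  compile c (suc pc) ++ jump pc ∷ []

At : Program → ℕ → Program → Set
At prog pc []       = ⊤
At prog pc (i ∷ is) = fetch prog pc ≡ just i × At prog (suc pc) is

At-++⁻ : ∀ {prog} pc is {js} → At prog pc (is ++ js) → At prog pc is × At prog (length is + pc) js
At-++⁻ pc []       at         = tt , at
At-++⁻ {prog} pc (i ∷ is) {js} (e≡ , at) with At-++⁻ (suc pc) is at
... | at₁ , at₂ = (e≡ , at₁) , subst (λ k → At prog k js) (+-suc (length is) pc) at₂

fetch-++ : ∀ xs ys k → fetch (xs ++ ys) (length xs + k) ≡ fetch ys k
fetch-++ []       ys k = refl
fetch-++ (x ∷ xs) ys k = fetch-++ xs ys k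

At-++⁺ : ∀ xs ys {zs} → At (xs ++ ys ++ zs) (length xs) ys
At-++⁺ xs []       = tt
At-++⁺ xs (y ∷ ys) {zs} =
  trans (cong (fetch (xs ++ y ∷ ys ++ zs)) (sym (+-identityʳ (length xs)))) (fetch-++ xs (y ∷ ys ++ zs) 0) ,
  subst₂ (λ p k → At p k ys) (++-assoc xs (y ∷ []) (ys ++ zs))
    (trans (length-++ xs) (+-comm (length xs) 1)) (At-++⁺ (xs ++ y ∷ []) ys)

timeRhs : Rhs → ℕ
timeRhs (mov a)     = 1
timeRhs (half a)    = 2
timeRhs (plus a b)  = 1
timeRhs (minus a b) = 3
timeRhs (less a b)  = 1
timeRhs (diff a b)  = 2
timeRhs (get t a b) = 6

-- The running time with every range replaced by 1, up to the overhead of the final test. It depends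
-- on neither n nor σ and supplies the constants of the O-bounds through `time-flat`.
steps : Cmd → ℕ
steps (r ≔ e)       = timeRhs e
steps (put t a b v) = 6
steps (c ⨾ d)       = steps c + steps d
steps (when a c)    = suc (steps c)
steps (while l a c) = 3 + steps c

LoopFree : Cmd → Set
LoopFree (r ≔ e)       = ⊤
LoopFree (put t a b v) = ⊤
LoopFree (c ⨾ d)       = LoopFree c × LoopFree d
LoopFree (when a c)    = LoopFree c
LoopFree (while l a c) = ⊥

-- Without nested loops the running time is linear in any common bound on the ranges; `A` says which
-- ranges may occur.
Flat : (Range → Set) → Cmd → Set
Flat A (r ≔ e)       = ⊤
Flat A (put t a b v) = ⊤
Flat A (c ⨾ d)       = Flat A c × Flat A d
Flat A (when a c)    = Flat A c
Flat A (while l a c) = A l × LoopFree c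

module Execution (W : ℕ) (prog : Program) where

  open WordRAM W

  _⟶[_]_ : State → ℕ → State → Set
  s ⟶[ t ] s′ = Silent prog s t s′

  infixr 5 _▷_
  _▷_ : ∀ {s s′ s″ t u} → s ⟶[ t ] s′ → s′ ⟶[ u ] s″ → s ⟶[ t + u ] s″
  stop      ▷ r = r
  next e q ▷ r = next e (q ▷ r)

  step≡ : ∀ {pc i} → fetch prog pc ≡ just i → ∀ reg mem →
          step prog (state pc reg mem) ≡ exec (just i) (state pc reg mem)
  step≡ {pc} e reg mem = cong (λ i → exec i (state pc reg mem)) e

  jumpZ-taken : ∀ {pc reg mem a l} → fetch prog pc ≡ just (jumpZ a l) → reg a ≡ 0 →
    step prog (state pc reg mem) ≡ silent (state l reg mem)
  jumpZ-taken {pc} {reg} {mem} {l = l} at r≡0 = trans (step≡ at reg mem)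
    (cong (λ v → silent (state (if v ≡ᵇ 0 then l else suc pc) reg mem)) r≡0)

  jumpZ-skipped : ∀ {pc reg mem a l} → fetch prog pc ≡ just (jumpZ a l) → reg a ≢ 0 →
    step prog (state pc reg mem) ≡ silent (state (suc pc) reg mem)
  jumpZ-skipped {pc} {reg} {mem} {l = l} at r≢0 = trans (step≡ at reg mem)
    (cong (λ b → silent (state (if b then l else suc pc) reg mem)) (≢⇒≡ᵇ-false r≢0))

-- Weakest preconditions and running times

module Semantics (n σ lg : ℕ) where

  -- `B` bounds all variables and cells: tree nodes have indices below 2n, and the last letter of
  -- the input has address σ + 1 + n. Hence coordinates are digits in radix `M`.
  B M : ℕ
  B = n + n + (σ + 2)
  M = suc B

  ⟦_⟧ᵒ : Opd → Vars → ℕ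
  ⟦ #0    ⟧ᵒ ρ = 0
  ⟦ #1    ⟧ᵒ ρ = 1
  ⟦ #n    ⟧ᵒ ρ = n
  ⟦ #σ    ⟧ᵒ ρ = σ
  ⟦ #h    ⟧ᵒ ρ = σ + 2
  ⟦ var r ⟧ᵒ ρ = ρ r

  ⟦_⟧ʳ : Rhs → Vars → Mem → ℕ
  ⟦ mov a     ⟧ʳ ρ G = ⟦ a ⟧ᵒ ρ
  ⟦ half a    ⟧ʳ ρ G = ⟦ a ⟧ᵒ ρ / 2
  ⟦ plus a b  ⟧ʳ ρ G = ⟦ a ⟧ᵒ ρ + ⟦ b ⟧ᵒ ρ
  ⟦ minus a b ⟧ʳ ρ G = ⟦ a ⟧ᵒ ρ ∸ ⟦ b ⟧ᵒ ρ
  ⟦ less a b  ⟧ʳ ρ G = bit (⟦ a ⟧ᵒ ρ <ᵇ ⟦ b ⟧ᵒ ρ)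
  ⟦ diff a b  ⟧ʳ ρ G = bit (bit (⟦ a ⟧ᵒ ρ ≡ᵇ ⟦ b ⟧ᵒ ρ) ≡ᵇ 0)
  ⟦ get t a b ⟧ʳ ρ G = G t (⟦ a ⟧ᵒ ρ) (⟦ b ⟧ᵒ ρ)

  range : Range → ℕ
  range ⟨n⟩   = n
  range ⟨σ⟩   = σ
  range ⟨log⟩ = lg

  Post : Set₁
  Post = Vars → Mem → Set

  -- When the bound is used up the guard has to be false, so a proof of `wp` also shows that the
  -- loop ends within its range. This is what makes `time` a valid bound.
  wpLoop : ℕ → Opd → (Post → Post) → Post → Post
  wpLoop zero    a body Q ρ G = ⟦ a ⟧ᵒ ρ ≡ 0 × Q ρ G
  wpLoop (suc k) a body Q ρ G =
    (⟦ a ⟧ᵒ ρ ≡ 0 → Q ρ G) × (⟦ a ⟧ᵒ ρ ≢ 0 → body (wpLoop k a body Q) ρ G)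

  -- Addition is the only operation that can lead beyond `B`, so it alone carries a proof
  -- obligation.
  wpAssign : ℕ → Rhs → Post → Post
  wpAssign r (plus a b) Q ρ G =
    ⟦ a ⟧ᵒ ρ + ⟦ b ⟧ᵒ ρ ≤ B × Q (update ρ r (⟦ a ⟧ᵒ ρ + ⟦ b ⟧ᵒ ρ)) G
  wpAssign r e          Q ρ G = Q (update ρ r (⟦ e ⟧ʳ ρ G)) G

  wp : Cmd → Post → Post
  wp (r ≔ e)       Q ρ G = wpAssign r e Q ρ G
  wp (put t a b v) Q ρ G = Q ρ (write G t (⟦ a ⟧ᵒ ρ) (⟦ b ⟧ᵒ ρ) (⟦ v ⟧ᵒ ρ))
  wp (c ⨾ d)       Q ρ G = wp c (wp d Q) ρ G
  wp (when a c)    Q ρ G = (⟦ a ⟧ᵒ ρ ≡ 0 → Q ρ G) × (⟦ a ⟧ᵒ ρ ≢ 0 → wp c Q ρ G)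
  wp (while l a c) Q ρ G = wpLoop (range l) a (wp c) Q ρ G

  -- The index of the invariant counts the iterations still allowed. Stating the step for every
  -- postcondition `R` that the invariant implies builds in the rule of consequence.
  wpLoop-intro : ∀ {a body Q} (I : ℕ → Post) →
    (∀ {k ρ G} → I k ρ G → ⟦ a ⟧ᵒ ρ ≡ 0 → Q ρ G) →
    (∀ {ρ G} → I 0 ρ G → ⟦ a ⟧ᵒ ρ ≡ 0) →
    (∀ {k ρ G R} → I (suc k) ρ G → ⟦ a ⟧ᵒ ρ ≢ 0 → (∀ {ρ′ G′} → I k ρ′ G′ → R ρ′ G′) → body R ρ G) →
    ∀ k {ρ G} → I k ρ G → wpLoop k a body Q ρ G
  wpLoop-intro I done end loop zero    inv = end inv , done inv (end inv)
  wpLoop-intro I done end loop (suc k) inv =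
    done inv , λ a≢0 → loop inv a≢0 (wpLoop-intro I done end loop k)

  time : Cmd → ℕ
  time (r ≔ e)       = timeRhs e
  time (put t a b v) = 6
  time (c ⨾ d)       = time c + time d
  time (when a c)    = suc (time c)
  -- Each iteration adds the test and the jump back; the one further step is the final test.
  time (while l a c) = suc (range l * (2 + time c))

  time-loopFree : ∀ c → LoopFree c → time c ≡ steps c
  time-loopFree (r ≔ e)       _         = refl
  time-loopFree (put t a b v) _         = refl
  time-loopFree (c ⨾ d)       (fc , fd) = cong₂ _+_ (time-loopFree c fc) (time-loopFree d fd)
  time-loopFree (when a c)    fc        = cong suc (time-loopFree c fc)

  time-flat : ∀ {A X} → 1 ≤ X → (∀ l → A l → range l ≤ X) → ∀ c → Flat A c → time c ≤ steps c * X
  time-flat 1≤X r≤ (r ≔ e)       _         = m≤m*n _ _ ⦃ >-nonZero 1≤X ⦄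
  time-flat 1≤X r≤ (put t a b v) _         = m≤m*n 6 _ ⦃ >-nonZero 1≤X ⦄
  time-flat {X = X} 1≤X r≤ (c ⨾ d) (fc , fd) = ≤-trans
    (+-mono-≤ (time-flat 1≤X r≤ c fc) (time-flat 1≤X r≤ d fd))
    (≤-reflexive (sym (*-distribʳ-+ X (steps c) (steps d))))
  time-flat 1≤X r≤ (when a c)    fc        = +-mono-≤ 1≤X (time-flat 1≤X r≤ c fc)
  time-flat {X = X} 1≤X r≤ (while l a c) (al , fc) = +-mono-≤ 1≤X
    (≤-trans (*-mono-≤ (r≤ l al) (≤-reflexive (cong (2 +_) (time-loopFree c fc))))
      (≤-reflexive (*-comm X _)))

  -- The address has the digits `code t`, `x`, `y` in radix `M`. As `inp` has code 0, its row 0 is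
  -- exactly the segment where the machine finds its input.
  locate : Tag → ℕ → ℕ → ℕ
  locate t x y = (code t * M + x) * M + y

  record Represents (ρ : Vars) (G : Mem) (reg mem : ℕ → ℕ) : Set where
    field
      opd   : ∀ a → reg (register a) ≡ ⟦ a ⟧ᵒ ρ
      radix : reg 5 ≡ M
      -- Coordinates beyond `B` are not digits, and their addresses may collide with those of other
      -- cells.
      cell  : ∀ t {x y} → x ≤ B → y ≤ B → mem (locate t x y) ≡ G t x y
      var≤  : ∀ r → ρ r ≤ B
      cell≤ : ∀ t x y → G t x y ≤ B

  open Represents public

  radix-unique : ∀ a {b x y} → x ≤ B → y ≤ B → a * M + x ≡ b * M + y → a ≡ b × x ≡ y
  radix-unique zero    {zero}  x≤ y≤ e≡ = refl , e≡
  radix-unique zero    {suc b} {x} {y} x≤ y≤ e≡ = ⊥-elim (<⇒≱ (s≤s x≤)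
    (subst (M ≤_) (sym e≡) (≤-trans (m≤m+n M (b * M)) (m≤m+n _ y))))
  radix-unique (suc a) {zero}  {x} {y} x≤ y≤ e≡ = ⊥-elim (<⇒≱ (s≤s y≤)
    (subst (M ≤_) e≡ (≤-trans (m≤m+n M (a * M)) (m≤m+n _ x))))
  radix-unique (suc a) {suc b} {x} {y} x≤ y≤ e≡ with radix-unique a {b} x≤ y≤
    (+-cancelˡ-≡ M _ _ (trans (sym (+-assoc M (a * M) x)) (trans e≡ (+-assoc M (b * M) y))))
  ... | refl , refl = refl , refl

  code-injective : ∀ {s t} → code s ≡ code t → s ≡ t
  code-injective {inp}  {inp}  e≡ = refl
  code-injective {word} {word} e≡ = refl
  code-injective {tree} {tree} e≡ = refl
  code-injective {used} {used} e≡ = refl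
  code-injective {ptr}  {ptr}  e≡ = refl

  locate-injective : ∀ {s t x y x′ y′} → x ≤ B → y ≤ B → x′ ≤ B → y′ ≤ B →
    locate s x y ≡ locate t x′ y′ → s ≡ t × x ≡ x′ × y ≡ y′
  locate-injective {s} {t} {x} {x′ = x′} x≤ y≤ x′≤ y′≤ e≡
    with radix-unique (code s * M + x) {code t * M + x′} y≤ y′≤ e≡
  ... | e′ , y≡ with radix-unique (code s) {code t} x≤ x′≤ e′
  ... | s≡ , x≡ = code-injective s≡ , x≡ , y≡

  write-locate : ∀ {G mem t x y v s x′ y′} → x ≤ B → y ≤ B → x′ ≤ B → y′ ≤ B →
    mem (locate s x′ y′) ≡ G s x′ y′ →
    update mem (locate t x y) v (locate s x′ y′) ≡ write G t x y v s x′ y′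
  write-locate {G} {mem} {t} {x} {y} {v} {s} {x′} {y′} x≤ y≤ x′≤ y′≤ e≡
    with locate s x′ y′ ≟ locate t x y
  ... | yes e with locate-injective {s} {t} x′≤ y′≤ x≤ y≤ e
  ... | refl , refl , refl =
    trans (update-≡ mem (locate t x y) v) (sym (write-≡ G t v refl refl))
  write-locate {G} {mem} {t} {x} {y} {v} {s} {x′} {y′} x≤ y≤ x′≤ y′≤ e≡ | no e
    with code s ≟ code t | x′ ≟ x | y′ ≟ y
  ... | yes p | yes refl | yes refl with code-injective {s} {t} p
  ...   | refl = ⊥-elim (e refl)
  write-locate {G} {mem} {v = v} x≤ y≤ x′≤ y′≤ e≡ | no e | no p | _ | _
    rewrite ≢⇒≡ᵇ-false p = trans (update-≢ mem v e) e≡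
  write-locate {G} {mem} {t} {v = v} {s = s} x≤ y≤ x′≤ y′≤ e≡ | no e | yes p | no q | _
    with code-injective {s} {t} p
  ... | refl = trans (update-≢ mem v e) (trans e≡ (sym (write-≢ˣ G t v q)))
  write-locate {G} {mem} {t} {v = v} {s = s} x≤ y≤ x′≤ y′≤ e≡ | no e | yes p | yes _ | no q
    with code-injective {s} {t} p
  ... | refl = trans (update-≢ mem v e) (trans e≡ (sym (write-≢ʸ G t v q)))

  -- Correctness of the compiled code

  module Correctness (W : ℕ) (2≤n : 2 ≤ n) (fits : M * M * M ≤ 2 ^ W) (prog : Program) where

    open WordRAM W

    open Execution W prog

    -- With n ≥ 2 the radix exceeds every tag code, so the leading part of an address is a digit as
    -- well.
    6≤M : 6 ≤ M
    6≤M = s≤s (+-mono-≤ (+-mono-≤ 2≤n 2≤n) (≤-trans (s≤s z≤n) (m≤n+m 2 σ)))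

    M≤M³ : M ≤ M * M * M
    M≤M³ = m≤n*m M (M * M)

    trunc-< : ∀ {x} → x < M * M * M → trunc x ≡ x
    trunc-< x< = m<n⇒m%n≡m {n = 2 ^ W} ⦃ m^n≢0 2 W ⦄ (<-≤-trans x< fits)

    trunc-≤ : ∀ {x} → x ≤ B → trunc x ≡ x
    trunc-≤ x≤ = trunc-< (<-≤-trans (s≤s x≤) M≤M³)

    trunc-6 : ∀ {x} → x < 6 → trunc x ≡ x
    trunc-6 x<6 = trunc-< (<-≤-trans x<6 (≤-trans 6≤M M≤M³))

    locate-< : ∀ t {x y} → x ≤ B → y ≤ B → locate t x y < M * M * M
    locate-< t {x} {y} x≤ y≤ = radix-< (radix-< (code-<M t) x≤) y≤
      where
      code-<6 : ∀ t → code t < 6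
      code-<6 inp  = s≤s z≤n
      code-<6 word = s≤s (s≤s z≤n)
      code-<6 tree = s≤s (s≤s (s≤s z≤n))
      code-<6 used = s≤s (s≤s (s≤s (s≤s z≤n)))
      code-<6 ptr  = s≤s (s≤s (s≤s (s≤s (s≤s z≤n))))
      code-<M : ∀ t → code t < M
      code-<M t = <-≤-trans (code-<6 t) 6≤M
      radix-< : ∀ {a b x} → a < b → x ≤ B → a * M + x < b * M
      radix-< {a} {b} {x} a<b x≤ = ≤-trans
        (≤-trans (≤-reflexive (sym (+-suc (a * M) x))) (+-monoʳ-≤ (a * M) (s≤s x≤)))
        (≤-trans (≤-reflexive (+-comm (a * M) M)) (*-monoˡ-≤ M a<b))

    opd≤ : ∀ {ρ G reg mem} → Represents ρ G reg mem → ∀ a → ⟦ a ⟧ᵒ ρ ≤ B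
    opd≤ R #0      = z≤n
    opd≤ R #1      = ≤-trans (s≤s z≤n) (≤-trans (m≤n+m 2 σ) (m≤n+m _ (n + n)))
    opd≤ R #n      = ≤-trans (m≤m+n n n) (m≤m+n _ _)
    opd≤ R #σ      = ≤-trans (m≤m+n σ 2) (m≤n+m _ (n + n))
    opd≤ R #h      = m≤n+m _ (n + n)
    opd≤ R (var r) = var≤ R r

    tmp₆ : ∀ {ρ G reg mem v} → Represents ρ G reg mem → Represents ρ G (update reg 6 v) mem
    tmp₆ {ρ} {reg = reg} {v = v} R = record
      { opd = go ; radix = radix R ; cell = cell R ; var≤ = var≤ R ; cell≤ = cell≤ R }
      where
      go : ∀ a → update reg 6 v (register a) ≡ ⟦ a ⟧ᵒ ρ
      go #0      = opd R #0
      go #1      = opd R #1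
      go #n      = opd R #n
      go #σ      = opd R #σ
      go #h      = opd R #h
      go (var r) = opd R (var r)

    tmp₇ : ∀ {ρ G reg mem v} → Represents ρ G reg mem → Represents ρ G (update reg 7 v) mem
    tmp₇ {ρ} {reg = reg} {v = v} R = record
      { opd = go ; radix = radix R ; cell = cell R ; var≤ = var≤ R ; cell≤ = cell≤ R }
      where
      go : ∀ a → update reg 7 v (register a) ≡ ⟦ a ⟧ᵒ ρ
      go #0      = opd R #0
      go #1      = opd R #1
      go #n      = opd R #n
      go #σ      = opd R #σ
      go #h      = opd R #h
      go (var r) = opd R (var r)

    assign : ∀ {ρ G reg mem r v v′} → Represents ρ G reg mem → v ≤ B → v′ ≡ v →
             Represents (update ρ r v) G (update reg (8 + r) v′) mem
    assign {ρ} {reg = reg} {r = r} {v = v} R v≤ refl = record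
      { opd = go ; radix = radix R ; cell = cell R ; var≤ = bnd ; cell≤ = cell≤ R }
      where
      go : ∀ a → update reg (8 + r) v (register a) ≡ ⟦ a ⟧ᵒ (update ρ r v)
      go #0      = opd R #0
      go #1      = opd R #1
      go #n      = opd R #n
      go #σ      = opd R #σ
      go #h      = opd R #h
      go (var s) with s ≡ᵇ r
      ... | true  = refl
      ... | false = opd R (var s)
      bnd : ∀ s → update ρ r v s ≤ B
      bnd s with s ≡ᵇ r
      ... | true  = v≤
      ... | false = var≤ R s

    address-run : ∀ {ρ G reg mem pc} t a b → Represents ρ G reg mem → At prog pc (address t a b) →
      ∃[ v ] v ≡ locate t (⟦ a ⟧ᵒ ρ) (⟦ b ⟧ᵒ ρ) × ∃[ reg′ ] reg′ 6 ≡ v ×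
        Represents ρ G reg′ mem × state pc reg mem ⟶[ 5 ] state (5 + pc) reg′ mem
    address-run {ρ} {G} {reg} {mem} {pc} t a b R (e₁ , e₂ , e₃ , e₄ , e₅ , _) =
      _ , refl , _ , v₅ , tmp₆ (tmp₆ (tmp₆ (tmp₆ (tmp₆ R)))) ,
      (next (step≡ e₁ _ mem) (next (step≡ e₂ _ mem) (next (step≡ e₃ _ mem)
        (next (step≡ e₄ _ mem) (next (step≡ e₅ _ mem) stop)))))
      where
      x y : ℕ
      x = ⟦ a ⟧ᵒ ρ
      y = ⟦ b ⟧ᵒ ρ
      -- Every intermediate value of the Horner scheme is at most the final address, so this one
      -- bound rules out all truncations.
      l₅ : locate t x y < M * M * M
      l₅ = locate-< t (opd≤ R a) (opd≤ R b)
      l₄ : (code t * M + x) * M < M * M * M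
      l₄ = ≤-<-trans (m≤m+n _ y) l₅
      l₃ : code t * M + x < M * M * M
      l₃ = ≤-<-trans (m≤m*n _ M) l₄
      l₂ : code t * M < M * M * M
      l₂ = ≤-<-trans (m≤m+n _ x) l₃
      l₁ : code t < M * M * M
      l₁ = ≤-<-trans (m≤m*n _ M) l₂
      r₁ r₂ r₃ r₄ : ℕ → ℕ
      r₁ = update reg 6 (trunc (code t))
      r₂ = update r₁ 6 (trunc (r₁ 6 * r₁ 5))
      r₃ = update r₂ 6 (trunc (r₂ 6 + r₂ (register a)))
      r₄ = update r₃ 6 (trunc (r₃ 6 * r₃ 5))
      v₂ : r₂ 6 ≡ code t * M
      v₂ = trans (cong trunc (cong₂ _*_ (trunc-< l₁) (radix R))) (trunc-< l₂)
      v₃ : r₃ 6 ≡ code t * M + x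
      v₃ = trans (cong trunc (cong₂ _+_ v₂ (opd (tmp₆ (tmp₆ R)) a))) (trunc-< l₃)
      v₄ : r₄ 6 ≡ (code t * M + x) * M
      v₄ = trans (cong trunc (cong₂ _*_ v₃ (radix R))) (trunc-< l₄)
      v₅ : trunc (r₄ 6 + r₄ (register b)) ≡ locate t x y
      v₅ = trans (cong trunc (cong₂ _+_ v₄ (opd (tmp₆ (tmp₆ (tmp₆ (tmp₆ R)))) b))) (trunc-< l₅)

    bit≤B : ∀ b → bit b ≤ B
    bit≤B true  = ≤-trans (s≤s z≤n) (≤-trans (m≤n+m 2 σ) (m≤n+m _ (n + n)))
    bit≤B false = z≤n

    Reaches : (time pc pc′ : ℕ) → Post → (reg mem : ℕ → ℕ) → Set
    Reaches T pc pc′ Q reg mem =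
      ∃[ t ] ∃[ reg′ ] ∃[ mem′ ] ∃[ ρ′ ] ∃[ G′ ]
        t ≤ T × (state pc reg mem ⟶[ t ] state pc′ reg′ mem′) × Represents ρ′ G′ reg′ mem′ × Q ρ′ G′

    rhs-run : ∀ {ρ G reg mem pc} r e {v} → v ≡ ⟦ e ⟧ʳ ρ G → v ≤ B → Represents ρ G reg mem →
      At prog pc (compileRhs (8 + r) e) →
      ∃[ reg′ ] (state pc reg mem ⟶[ timeRhs e ] state (length (compileRhs (8 + r) e) + pc) reg′ mem) ×
        Represents (update ρ r v) G reg′ mem
    rhs-run {mem = mem} r (mov a) refl v≤ R (e₁ , _) = _ , next (step≡ e₁ _ mem) stop ,
      assign R v≤ (trans (cong trunc (trans (cong₂ _+_ (opd R a) (opd R #0)) (+-identityʳ _))) (trunc-≤ v≤))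
    rhs-run {ρ} {mem = mem} r (half a) refl v≤ R (e₁ , e₂ , _) =
      _ , next (step≡ e₁ _ mem) (next (step≡ e₂ _ mem) stop) , assign (tmp₆ R) v≤
        (trans (cong trunc (cong₂ ⟦ div ⟧ (opd (tmp₆ R) a) (trunc-6 (s≤s (s≤s (s≤s z≤n)))))) (trunc-≤ v≤))
    rhs-run {mem = mem} r (plus a b) refl v≤ R (e₁ , _) = _ , next (step≡ e₁ _ mem) stop ,
      assign R v≤ (trans (cong trunc (cong₂ _+_ (opd R a) (opd R b))) (trunc-≤ v≤))
    rhs-run {ρ} {reg = reg} {mem} r (minus a b) refl v≤ R (e₁ , e₂ , e₃ , _) =
      _ , next (step≡ e₁ _ mem) (next (step≡ e₂ _ mem) (next (step≡ e₃ _ mem) stop)) ,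
      assign (tmp₇ (tmp₆ R)) v≤ (trans (cong trunc
        (cong₂ _*_ (cong trunc (cong₂ ⟦ sub ⟧ (opd R a) (opd R b)))
                   (cong trunc (cong₂ ⟦ lt ⟧ (opd
                     (tmp₆ {v = trunc (⟦ sub ⟧ (reg (register a)) (reg (register b)))} R) b)
                     (opd (tmp₆ R) a)))))
        (value _ _ (opd≤ R a)))
      where
      value : ∀ x y → x ≤ B → trunc (trunc ((x + 2 ^ W) ∸ y) * trunc (bit (y <ᵇ x))) ≡ x ∸ y
      value x y x≤ with y <ᵇ x in e≡
      ... | true  = trans (cong trunc (trans (cong (trunc ((x + 2 ^ W) ∸ y) *_) (trunc-6 (s≤s (s≤s z≤n))))
        (*-identityʳ _)))
            (trans (cong trunc lemma) (trunc-≤ (≤-trans (m∸n≤m x y) x≤)))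
        where
        y≤x : y ≤ x
        y≤x = <⇒≤ (<ᵇ⇒< y x (subst T (sym e≡) tt))
        lemma : trunc ((x + 2 ^ W) ∸ y) ≡ x ∸ y
        lemma = trans (cong trunc (+-∸-comm (2 ^ W) y≤x))
                (trans ([m+n]%n≡m%n (x ∸ y) (2 ^ W) ⦃ m^n≢0 2 W ⦄) (trunc-≤ (≤-trans (m∸n≤m x y) x≤)))
      ... | false = trans (cong trunc (trans (cong (trunc ((x + 2 ^ W) ∸ y) *_) (trunc-6 (s≤s z≤n)))
        (*-zeroʳ (trunc ((x + 2 ^ W) ∸ y)))))
            (trans (trunc-6 (s≤s z≤n)) (sym (m≤n⇒m∸n≡0 {x} {y} (≮⇒≥ λ y<x → subst T e≡ (<⇒<ᵇ y<x)))))
    rhs-run {mem = mem} r (less a b) refl v≤ R (e₁ , _) = _ , next (step≡ e₁ _ mem) stop ,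
      assign R v≤ (trans (cong trunc (cong₂ ⟦ lt ⟧ (opd R a) (opd R b))) (trunc-≤ v≤))
    rhs-run {mem = mem} r (diff a b) refl v≤ R (e₁ , e₂ , _) =
      _ , next (step≡ e₁ _ mem) (next (step≡ e₂ _ mem) stop) , assign (tmp₆ R) v≤
        (trans (cong trunc (cong₂ ⟦ eq ⟧
          (trans (cong trunc (cong₂ ⟦ eq ⟧ (opd R a) (opd R b))) (trunc-≤ (bit≤B _))) (opd R #0)))
         (trunc-≤ v≤))
    rhs-run {mem = mem} {pc} r (get t a b) refl v≤ R at with At-++⁻ {prog} pc (address t a b) at
    ... | at₁ , e₂ , _ with address-run t a b R at₁
    ... | _ , refl , reg₁ , v₁ , R₁ , run =
      _ , (run ▷ next (step≡ e₂ _ mem) stop) ,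
      assign R₁ v≤ (trans (cong trunc (trans (cong mem v₁) (cell R t (opd≤ R a) (opd≤ R b)))) (trunc-≤ v≤))

    assign-ok : ∀ r e {Q ρ G reg mem} → Represents ρ G reg mem → wpAssign r e Q ρ G →
      ⟦ e ⟧ʳ ρ G ≤ B × Q (update ρ r (⟦ e ⟧ʳ ρ G)) G
    assign-ok r (mov a)     R w = opd≤ R a , w
    assign-ok r (half a)    R w = ≤-trans (m/n≤m _ 2) (opd≤ R a) , w
    assign-ok r (plus a b)  R w = w
    assign-ok r (minus a b) {ρ = ρ} R w = ≤-trans (m∸n≤m _ (⟦ b ⟧ᵒ ρ)) (opd≤ R a) , w
    assign-ok r (less a b)  R w = bit≤B _ , w
    assign-ok r (diff a b)  R w = bit≤B _ , w
    assign-ok r (get t a b) R w = cell≤ R t _ _ , w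

    Runs : Cmd → Set₁
    Runs c = ∀ {Q ρ G reg mem} pc → At prog pc (compile c pc) → Represents ρ G reg mem → wp c Q ρ G →
             Reaches (time c) pc (length (compile c pc) + pc) Q reg mem

    loop-run : ∀ {c} l a → Runs c → ∀ k {Q ρ G reg mem} pc → At prog pc (compile (while l a c) pc) →
      Represents ρ G reg mem → wpLoop k a (wp c) Q ρ G →
      Reaches (suc (k * (2 + time c))) pc (length (compile (while l a c) pc) + pc) Q reg mem
    loop-run {c} l a run k {Q} {ρ} {G} {reg} {mem} pc (e , at) R w
      with At-++⁻ (suc pc) (compile c (suc pc)) at | ⟦ a ⟧ᵒ ρ ≟ 0
    ... | at₁ , _ | yes a≡0 = 1 , reg , mem , ρ , G , s≤s z≤n ,
      subst (λ l′ → state pc reg mem ⟶[ 1 ] state l′ reg mem) (sym exit)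
        (next (jumpZ-taken e (trans (opd R a) a≡0)) stop) , R , exhausted k w
      where
      exit : length (compile (while l a c) pc) + pc ≡ suc (length (compile c (suc pc)) + suc pc)
      exit = cong suc (trans (cong (_+ pc) (length-++ (compile c (suc pc))))
        (+-assoc (length (compile c (suc pc))) 1 pc))
      exhausted : ∀ k → wpLoop k a (wp c) Q ρ G → Q ρ G
      exhausted zero    (_ , q) = q
      exhausted (suc _) (q , _) = q a≡0
    loop-run l a run zero    pc (e , at) R (a≡0 , _) | at₁ , _ | no a≢0 = ⊥-elim (a≢0 a≡0)
    loop-run {c} l a run (suc k) {mem = mem} pc (e , at) R (_ , w)   | at₁ , e₂ , _ | no a≢0
      with run (suc pc) at₁ R (w a≢0)
    ... | t₁ , reg₁ , mem₁ , ρ₁ , G₁ , t₁≤ , run₁ , R₁ , w₁ with loop-run {c} l a run k pc (e , at) R₁ w₁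
    ... | t₂ , reg₂ , mem₂ , ρ₂ , G₂ , t₂≤ , run₂ , R₂ , q =
      suc (t₁ + suc t₂) , reg₂ , mem₂ , ρ₂ , G₂ , bound ,
      next (jumpZ-skipped e (λ r≡0 → a≢0 (trans (sym (opd R a)) r≡0)))
        (run₁ ▷ next (step≡ e₂ reg₁ mem₁) run₂) , R₂ , q
      where
      bound : suc (t₁ + suc t₂) ≤ suc (2 + time c + k * (2 + time c))
      bound = s≤s (≤-trans (+-mono-≤ t₁≤ (s≤s t₂≤)) (≤-reflexive
        (trans (+-suc (time c) _) (cong suc (+-suc (time c) _)))))

    run : ∀ c → Runs c
    run (r ≔ e) pc at R w with assign-ok r e R w
    ... | v≤ , q with rhs-run r e refl v≤ R at
    ... | reg′ , run₁ , R′ = _ , _ , _ , _ , _ , ≤-refl , run₁ , R′ , q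
    run (put t a b v) {G = G} {mem = mem} pc at R q with At-++⁻ {prog} pc (address t a b) at
    ... | at₁ , e₂ , _ with address-run t a b R at₁
    ... | _ , refl , reg₁ , v₁ , R₁ , run₁ =
      6 , _ , _ , _ , _ , ≤-refl , (run₁ ▷ next (step≡ e₂ _ mem) stop) , record
        { opd = opd R₁ ; radix = radix R₁ ; var≤ = var≤ R₁
        ; cell = λ s x≤ y≤ → trans (cong (λ u → update mem u (reg₁ (register v)) _) v₁)
            (trans (cong (λ u → update mem _ u _) (opd R₁ v))
              (write-locate {G} {mem} {t} {s = s} (opd≤ R a) (opd≤ R b) x≤ y≤ (cell R s x≤ y≤)))
        ; cell≤ = write-≤ (cell≤ R) (opd≤ R v) } , q
    run (c ⨾ d) {Q = Q} {reg = reg} {mem} pc at R w with At-++⁻ pc (compile c pc) at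
    ... | at₁ , at₂ with run c pc at₁ R w
    ... | t₁ , reg₁ , mem₁ , ρ₁ , G₁ , t₁≤ , run₁ , R₁ , w₁
      with run d (length (compile c pc) + pc) at₂ R₁ w₁
    ... | t₂ , reg₂ , mem₂ , ρ₂ , G₂ , t₂≤ , run₂ , R₂ , q =
      t₁ + t₂ , reg₂ , mem₂ , ρ₂ , G₂ , +-mono-≤ t₁≤ t₂≤ ,
      subst (λ l → state pc reg mem ⟶[ t₁ + t₂ ] state l reg₂ mem₂) exit (run₁ ▷ run₂) , R₂ , q
      where
      p : ℕ
      p = length (compile c pc)
      exit : length (compile d (p + pc)) + (p + pc) ≡ length (compile (c ⨾ d) pc) + pc
      exit = trans (sym (+-assoc (length (compile d (p + pc))) p pc))
        (cong (_+ pc) (trans (+-comm (length (compile d (p + pc))) p) (sym (length-++ (compile c pc)))))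
    run (when a c) {Q} {ρ} {G} {reg} {mem} pc (e , at) R (w₀ , w₁) with ⟦ a ⟧ᵒ ρ ≟ 0
    ... | yes a≡0 = 1 , reg , mem , ρ , G , s≤s z≤n ,
      next (trans (jumpZ-taken e (trans (opd R a) a≡0))
        (cong (λ l → silent (state l reg mem)) (+-suc _ pc))) stop ,
      R , w₀ a≡0
    ... | no a≢0 with run c (suc pc) at R (w₁ a≢0)
    ... | t , reg′ , mem′ , ρ′ , G′ , t≤ , run₁ , R′ , q =
      suc t , reg′ , mem′ , ρ′ , G′ , s≤s t≤ ,
      next (jumpZ-skipped e (λ r≡0 → a≢0 (trans (sym (opd R a)) r≡0)))
        (subst (λ l → state (suc pc) reg mem ⟶[ t ] state l reg′ mem′) (+-suc _ pc) run₁) , R′ , q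
    run (while l a c) pc at R w = loop-run {c} l a (run c) (range l) pc at R w

    runTo : ∀ c {Q ρ G reg mem pc pc′} → At prog pc (compile c pc) → length (compile c pc) + pc ≡ pc′ →
            Represents ρ G reg mem → wp c Q ρ G → Reaches (time c) pc pc′ Q reg mem
    runTo c {pc = pc} at refl = run c pc at

-- Words and swaps

-- Positions and letters as plain numbers, the way the program handles them; the value beyond the
-- end is 0.
letter : ∀ {σ n} → Word σ n → ℕ → ℕ
letter w = cells (map toℕ (toList w))

letter-lookup : ∀ {σ n} (w : Word σ n) i → letter w (toℕ i) ≡ toℕ (lookup w i)
letter-lookup (x ∷ w) fzero    = refl
letter-lookup (x ∷ w) (fsuc i) = letter-lookup w i

letter-fromℕ< : ∀ {σ n} (w : Word σ n) {p} (p<n : p < n) → toℕ (lookup w (fromℕ< p<n)) ≡ letter w p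
letter-fromℕ< w p<n = trans (sym (letter-lookup w _)) (cong (letter w) (toℕ-fromℕ< p<n))

letter-< : ∀ {σ n} (w : Word σ n) {p} → p < n → letter w p < σ
letter-< w p<n = subst (_< _) (letter-fromℕ< w p<n) (toℕ<n _)

letter-update : ∀ {σ n} (w : Word σ n) i x q →
                letter (w [ i ]≔ x) q ≡ update (letter w) (toℕ i) (toℕ x) q
letter-update (y ∷ w) fzero    x zero    = refl
letter-update (y ∷ w) fzero    x (suc q) = refl
letter-update (y ∷ w) (fsuc i) x zero    = refl
letter-update (y ∷ w) (fsuc i) x (suc q) = letter-update w i x q

swapped : (ℕ → ℕ) → ℕ → ℕ → ℕ → ℕ
swapped f k j = update (update f k (f j)) j (f k)

letter-swap : ∀ {σ n} (w : Word σ n) {k j} (k<n : k < n) (j<n : j < n) q →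
              letter (w ∘ (fromℕ< k<n , fromℕ< j<n)) q ≡ swapped (letter w) k j q
letter-swap w {k} {j} k<n j<n q = begin
  letter (w′ [ fromℕ< j<n ]≔ a) q
    ≡⟨ letter-update w′ (fromℕ< j<n) a q ⟩
  update (letter w′) (toℕ (fromℕ< j<n)) (toℕ a) q
    ≡⟨ cong₂ (λ y z → update (letter w′) y z q) (toℕ-fromℕ< j<n) (letter-fromℕ< w k<n) ⟩
  update (letter w′) j (letter w k) q
    ≡⟨ cong (λ y → if q ≡ᵇ j then letter w k else y) (trans (letter-update w (fromℕ< k<n) b q)
         (cong₂ (λ y z → update (letter w) y z q) (toℕ-fromℕ< k<n) (letter-fromℕ< w j<n))) ⟩
  swapped (letter w) k j q ∎
  where
  open ≡-Reasoning
  a = lookup w (fromℕ< k<n)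
  b = lookup w (fromℕ< j<n)
  w′ = w [ fromℕ< k<n ]≔ b

swapped-left : ∀ f {k j} → k ≢ j → swapped f k j k ≡ f j
swapped-left f {k} {j} k≢j = trans (update-≢ (update f k (f j)) (f k) k≢j) (update-≡ f k (f j))

swapped-right : ∀ f k j → swapped f k j j ≡ f k
swapped-right f k j = update-≡ (update f k (f j)) j (f k)

swapped-other : ∀ f {k j q} → q ≢ k → q ≢ j → swapped f k j q ≡ f q
swapped-other f {k} {j} q≢k q≢j = trans (update-≢ (update f k (f j)) (f k) q≢j) (update-≢ f (f j) q≢k)

AgreeBelow : ∀ {σ n} → ℕ → Word σ n → Word σ n → Set
AgreeBelow k u w = ∀ p → p < k → letter u p ≡ letter w p

firstDifference : ∀ {σ n} (u w : Word σ n) →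
  u ≡ w ⊎ ∃[ k ] (k < n × AgreeBelow k u w × letter u k ≢ letter w k)
firstDifference [] [] = inj₁ refl
firstDifference (x ∷ u) (y ∷ w) with x Fin.≟ y
... | no x≢y = inj₂ (0 , s≤s z≤n , (λ _ ()) , λ e → x≢y (toℕ-injective e))
... | yes refl with firstDifference u w
...   | inj₁ refl = inj₁ refl
...   | inj₂ (k , k<n , agree , differ) = inj₂ (suc k , s≤s k<n , agree′ , differ)
  where
  agree′ : AgreeBelow (suc k) (x ∷ u) (x ∷ w)
  agree′ zero    _         = refl
  agree′ (suc p) (s≤s p<k) = agree p p<k

count-∷ : ∀ {σ n} (a x : Fin σ) (w : Word σ n) →
          count (Fin._≟ a) (x ∷ w) ≡ bit (does (x Fin.≟ a)) + count (Fin._≟ a) w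
count-∷ a x w with does (x Fin.≟ a)
... | true  = refl
... | false = refl

-- One occurrence of the old letter is traded for one of `x`; the additive form avoids subtraction,
-- and applying it to both updates of a swap makes the contributions cancel.
count-update : ∀ {σ n} (a x : Fin σ) (w : Word σ n) i →
  bit (does (lookup w i Fin.≟ a)) + count (Fin._≟ a) (w [ i ]≔ x) ≡ bit
    (does (x Fin.≟ a)) + count (Fin._≟ a) w
count-update a x (y ∷ w) fzero    rewrite count-∷ a x w | count-∷ a y w =
  x∙yz≈y∙xz +-commutativeSemigroup (bit (does (y Fin.≟ a))) (bit (does (x Fin.≟ a))) (count (Fin._≟ a) w)
count-update a x (y ∷ w) (fsuc i) rewrite count-∷ a y (w [ i ]≔ x) | count-∷ a y w = begin
  p + (q + count (Fin._≟ a) (w [ i ]≔ x)) ≡⟨ x∙yz≈y∙xz +-commutativeSemigroup p q _ ⟩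
  q + (p + count (Fin._≟ a) (w [ i ]≔ x)) ≡⟨ cong (q +_) (count-update a x w i) ⟩
  q + (r + count (Fin._≟ a) w)            ≡⟨ x∙yz≈y∙xz +-commutativeSemigroup q r _ ⟩
  r + (q + count (Fin._≟ a) w)            ∎
  where
  open ≡-Reasoning
  p q r : ℕ
  p = bit (does (lookup w i Fin.≟ a))
  q = bit (does (y Fin.≟ a))
  r = bit (does (x Fin.≟ a))

swap-parikh : ∀ {σ n} P (w : Word σ n) → HasParikh P w → ∀ {i j} → i ≢ j → HasParikh P (w ∘ (i , j))
swap-parikh P w parikh {i} {j} i≢j a = trans (+-cancelˡ-≡ p _ _ (+-cancelˡ-≡ q _ _ both)) (parikh a)
  where
  w₁ = w [ i ]≔ lookup w j
  p q : ℕ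
  p = bit (does (lookup w i Fin.≟ a))
  q = bit (does (lookup w j Fin.≟ a))
  first : p + count (Fin._≟ a) w₁ ≡ q + count (Fin._≟ a) w
  first = count-update a (lookup w j) w i
  second : q + count (Fin._≟ a) (w ∘ (i , j)) ≡ p + count (Fin._≟ a) w₁
  second = subst (λ x → bit (does (x Fin.≟ a)) + count (Fin._≟ a) (w ∘ (i , j)) ≡ p + count (Fin._≟ a) w₁)
    (lookup∘updateAt′ j i (λ e → i≢j (sym e)) w) (count-update a (lookup w i) w₁ j)
  both : q + (p + count (Fin._≟ a) (w ∘ (i , j))) ≡ q + (p + count (Fin._≟ a) w)
  both = trans (x∙yz≈y∙xz +-commutativeSemigroup q p _)
    (trans (cong (p +_) (trans second first)) (x∙yz≈y∙xz +-commutativeSemigroup p q _))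

occurs : ∀ {σ n} (a : Fin σ) (w : Word σ n) → 0 < count (Fin._≟ a) w → ∃[ q ] (q < n × letter w q ≡ toℕ a)
occurs a (x ∷ w) pos with x Fin.≟ a
... | yes refl = 0 , s≤s z≤n , refl
... | no  _    with occurs a w pos
...   | q , q<n , e = suc q , s≤s q<n , e

-- Beyond a common prefix the two words have the same number of each symbol.
laterOccurrence : ∀ {σ n} (u w : Word σ n) → (∀ a → count (Fin._≟ a) u ≡ count (Fin._≟ a) w) →
  ∀ {k} → k < n → AgreeBelow k u w → letter u k ≢ letter w k →
  ∃[ q ] (k < q × q < n × letter w q ≡ letter u k)
laterOccurrence (x ∷ u) (y ∷ w) same {zero} k<n agree differ
  with occurs x w (subst (0 <_) (trans (same x) drop) pos)
  where
  drop : count (Fin._≟ x) (y ∷ w) ≡ count (Fin._≟ x) w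
  drop = trans (count-∷ x y w)
    (cong (λ b → bit b + count (Fin._≟ x) w) (dec-false (y Fin.≟ x) (λ y≡x → differ (cong toℕ (sym y≡x)))))
  pos : 0 < count (Fin._≟ x) (x ∷ u)
  pos = subst (0 <_) (sym (trans (count-∷ x x u)
    (cong (λ b → bit b + count (Fin._≟ x) u) (dec-true (x Fin.≟ x) refl)))) (s≤s z≤n)
... | q , q<n , e = suc q , s≤s z≤n , s≤s q<n , e
laterOccurrence (x ∷ u) (y ∷ w) same {suc k} (s≤s k<n) agree differ
  with toℕ-injective (agree 0 (s≤s z≤n))
... | refl with laterOccurrence u w same′ k<n (λ p p<k → agree (suc p) (s≤s p<k)) differ
  where
  same′ : ∀ a → count (Fin._≟ a) u ≡ count (Fin._≟ a) w
  same′ a = +-cancelˡ-≡ (bit (does (x Fin.≟ a))) _ _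
    (trans (sym (count-∷ a x u)) (trans (same a) (count-∷ a x w)))
... | q , k<q , q<n , e = suc q , s≤s k<q , s≤s q<n , e

parikh-later : ∀ {σ n} P (u w : Word σ n) → HasParikh P u → HasParikh P w →
  ∀ {k} → k < n → AgreeBelow k u w → letter u k ≢ letter w k →
  ∃[ q ] (k < q × q < n × letter w q ≡ letter u k)
parikh-later P u w pu pw = laterOccurrence u w (λ a → trans (pu a) (sym (pw a)))

-- A finite list of all words, as fuel for the enumeration

words : ∀ σ n → List (Word σ n)
words σ zero    = [] ∷ []
words σ (suc n) = cartesianProductWith _∷_ (allFin σ) (words σ n)

∈-words : ∀ {σ n} (w : Word σ n) → w ∈ words σ n
∈-words []      = here refl
∈-words (x ∷ w) = ∈-cartesianProductWith⁺ _∷_ (∈-allFin x) (∈-words w)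

-- Takes out one occurrence only, so the length drops by exactly one, while elements other than `x`
-- survive.
remove : ∀ {A : Set} {x : A} {xs} → x ∈ xs →
  ∃[ ys ] (length xs ≡ suc (length ys) × (∀ {y} → y ∈ xs → y ≢ x → y ∈ ys))
remove {xs = x ∷ xs} (here refl) = xs , refl , λ where
  (here e)  y≢x → ⊥-elim (y≢x e)
  (there i) y≢x → i
remove {xs = z ∷ xs} (there x∈) with remove x∈
... | ys , len , keep = z ∷ ys , cong suc len , λ where
  (here e)  y≢x → here e
  (there i) y≢x → there (keep i y≢x)

-- Tournament trees and the search for the last admissible letter

bit-<-yes : ∀ {m n} → bit (m <ᵇ n) ≢ 0 → m < n
bit-<-yes {m} {n} b with m <ᵇ n in e
... | true  = <ᵇ⇒< m n (subst T (sym e) tt)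
... | false = ⊥-elim (b refl)

bit-<-no : ∀ {m n} → bit (m <ᵇ n) ≡ 0 → n ≤ m
bit-<-no {m} {n} b with m <ᵇ n in e
... | false = ≮⇒≥ λ m<n → subst T e (<⇒<ᵇ m<n)

bit-range : ∀ {b m} → m ≤ b → bit (b <ᵇ m) ≡ 0
bit-range {b} {m} m≤b with b <ᵇ m in e
... | true  = ⊥-elim (<⇒≱ (<ᵇ⇒< b m (subst T (sym e) tt)) m≤b)
... | false = refl

bit-≢-yes : ∀ {m n} → bit (bit (m ≡ᵇ n) ≡ᵇ 0) ≢ 0 → m ≢ n
bit-≢-yes {m} b refl rewrite ≡ᵇ-refl m = b refl

bit-≢-no : ∀ {m n} → bit (bit (m ≡ᵇ n) ≡ᵇ 0) ≡ 0 → m ≡ n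
bit-≢-no {m} {n} b with m ≡ᵇ n in e
... | true = ≡ᵇ⇒≡ m n (subst T (sym e) tt)

double/2 : ∀ i → (i + i) / 2 ≡ i
double/2 i = trans (cong (_/ 2) (trans (cong (i +_) (sym (+-identityʳ i))) (*-comm 2 i))) (m*n/n≡m i 2)

double+1/2 : ∀ i → (i + i + 1) / 2 ≡ i
double+1/2 i = trans (+-distrib-/-∣ˡ {i + i} 1
  (divides i (trans (cong (i +_) (sym (+-identityʳ i))) (*-comm 2 i))))
  (trans (+-identityʳ _) (double/2 i))

even-or-odd : ∀ h → h ≡ h / 2 + h / 2 ⊎ h ≡ h / 2 + h / 2 + 1
even-or-odd h with h % 2 | m≡m%n+[m/n]*n h 2 | m%n<n h 2
... | 0 | e | _ = inj₁ (trans e (trans (*-comm (h / 2) 2) (cong (h / 2 +_) (+-identityʳ _))))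
... | 1 | e | _ = inj₂ (trans e
  (trans (+-comm 1 _) (cong (_+ 1) (trans (*-comm (h / 2) 2) (cong (h / 2 +_) (+-identityʳ _))))))
... | suc (suc _) | _ | s≤s (s≤s ())

-- topᵛ and botᵛ point into the stack of unfinished levels, the latter before
-- the fresh levels limᵛ, limᵛ + 1, … are pushed.
iᵛ lᵛ xᵛ yᵛ bᵛ mᵛ pᵛ vᵛ kᵛ cᵛ jᵛ sᵛ topᵛ botᵛ limᵛ : ℕ
iᵛ = 0
lᵛ = 1
xᵛ = 2
yᵛ = 3
bᵛ = 4
mᵛ = 5
pᵛ = 6
vᵛ = 7
kᵛ = 8
cᵛ = 9
jᵛ = 10
sᵛ = 11
topᵛ = 12
botᵛ = 13
limᵛ = 14

recompute : Cmd
recompute =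
  lᵛ ≔ plus (var iᵛ) (var iᵛ) ⨾
  xᵛ ≔ get tree (var bᵛ) (var lᵛ) ⨾
  lᵛ ≔ plus (var lᵛ) #1 ⨾
  yᵛ ≔ get tree (var bᵛ) (var lᵛ) ⨾
  lᵛ ≔ less (var xᵛ) (var yᵛ) ⨾
  when (var lᵛ) (xᵛ ≔ mov (var yᵛ)) ⨾
  put tree (var bᵛ) (var iᵛ) (var xᵛ) ⨾
  iᵛ ≔ half (var iᵛ)

-- The parameters are passed in `bᵛ` (symbol), `pᵛ` (position) and `vᵛ` (new leaf value). After the
-- root, node 1, halving gives 0 and ends the climb.
setLeaf : Cmd
setLeaf =
  iᵛ ≔ plus #n (var pᵛ) ⨾
  put tree (var bᵛ) (var iᵛ) (var vᵛ) ⨾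
  iᵛ ≔ half (var iᵛ) ⨾
  while ⟨log⟩ (var iᵛ) recompute

nextSymbol : Cmd
nextSymbol =
  bᵛ ≔ plus (var bᵛ) #1 ⨾
  yᵛ ≔ less (var bᵛ) #σ

forSymbols : Cmd → Cmd
forSymbols c =
  bᵛ ≔ mov #0 ⨾
  yᵛ ≔ less (var bᵛ) #σ ⨾
  while ⟨σ⟩ (var yᵛ) (c ⨾ nextSymbol)

consider : Cmd
consider =
  yᵛ ≔ diff (var bᵛ) (var cᵛ) ⨾
  when (var yᵛ)
    (xᵛ ≔ get used (var kᵛ) (var bᵛ) ⨾
     yᵛ ≔ less (var xᵛ) #1 ⨾
     when (var yᵛ)
       (xᵛ ≔ get tree (var bᵛ) #1 ⨾
        yᵛ ≔ less (var mᵛ) (var xᵛ) ⨾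
        when (var yᵛ) (mᵛ ≔ mov (var xᵛ))))

-- Leaves in `mᵛ` one plus the last position whose letter differs from `cᵛ` and has no flag in row
-- `kᵛ`, or 0. Finding a swap partner, testing a level for exhaustion and finding the constant
-- suffix are all instances, differing only in the row and the excluded letter.
search : Cmd
search = mᵛ ≔ mov #0 ⨾ forSymbols consider

unflag : Cmd
unflag = put used (var kᵛ) (var bᵛ) #0

clear : Cmd
clear = forSymbols unflag

-- Verification of the tree updates and the search

module Verification (n σ lg : ℕ) (2≤n : 2 ≤ n) (n≤2^lg : n ≤ 2 ^ lg) where

  open Semantics n σ lg

  double≤B : ∀ {i} → i < n → i + i + 1 ≤ B
  double≤B {i} i<n = ≤-trans (≤-trans (≤-reflexive (+-comm (i + i) 1)) (+-mono-≤ i<n (<⇒≤ i<n))) (m≤m+n _ _)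

  n+p≤B : ∀ {p} → p < n → n + p ≤ B
  n+p≤B p<n = ≤-trans (+-monoʳ-≤ n (<⇒≤ p<n)) (m≤m+n _ _)

  b+1≤B : ∀ {b} → b < σ → b + 1 ≤ B
  b+1≤B {b} b<σ = ≤-trans (≤-reflexive (+-comm b 1)) (≤-trans b<σ (≤-trans (m≤m+n σ 2) (m≤n+m _ (n + n))))

  p+1≤B : ∀ {p} → p ≤ n → p + 1 ≤ B
  p+1≤B {p} p≤n = +-mono-≤ (≤-trans p≤n (m≤m+n n n)) (≤-trans (s≤s z≤n) (m≤n+m 2 σ))

  -- Node i has children 2i and 2i + 1 and the leaves are n … 2n - 1, for every n ≥ 1.

  Node : (ℕ → ℕ) → ℕ → Set
  Node T i = T i ≡ T (i + i) ⊔ T (i + i + 1)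

  -- During an update node `i` may be wrong. No inner node has index 0, so `i` = 0 stands for an
  -- intact tree, and this is also the value with which the climb ends.
  record TreeExcept (i : ℕ) (T f : ℕ → ℕ) : Set where
    field
      leaf : ∀ {p} → p < n → T (n + p) ≡ f p
      node : ∀ {h} → 1 ≤ h → h < n → h ≢ i → Node T h

  open TreeExcept public

  Tree : (ℕ → ℕ) → (ℕ → ℕ) → Set
  Tree = TreeExcept 0

  tree-cong : ∀ {T T′ f f′} → (∀ y → T′ y ≡ T y) → (∀ {p} → p < n → f p ≡ f′ p) → Tree T f → Tree T′ f′
  tree-cong T≗ f≗ t = record
    { leaf = λ p<n → trans (T≗ _) (trans (leaf t p<n) (f≗ p<n))
    ; node = λ 1≤h h<n h≢0 → trans (T≗ _) (trans (node t 1≤h h<n h≢0) (sym (cong₂ _⊔_ (T≗ _) (T≗ _)))) }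

  set-leaf : ∀ {T T′ f p v} → p < n → Tree T f → T′ (n + p) ≡ v → (∀ {y} → y ≢ n + p → T′ y ≡ T y) →
             TreeExcept ((n + p) / 2) T′ (update f p v)
  set-leaf {T} {T′} {f} {p} {v} p<n t new old = record { leaf = leaf′ ; node = node′ }
    where
    leaf′ : ∀ {q} → q < n → T′ (n + q) ≡ update f p v q
    leaf′ {q} q<n with q ≟ p
    ... | yes refl = trans new (sym (update-≡ f p v))
    ... | no q≢p   = trans (old (λ e → q≢p (+-cancelˡ-≡ n q p e)))
      (trans (leaf t q<n) (sym (update-≢ f v q≢p)))
    node′ : ∀ {h} → 1 ≤ h → h < n → h ≢ (n + p) / 2 → Node T′ h
    node′ {h} 1≤h h<n h≢ = trans (old (λ e → <⇒≱ h<n (subst (n ≤_) (sym e) (m≤m+n n p))))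
      (trans (node t 1≤h h<n (λ { refl → <⇒≱ 1≤h z≤n }))
        (sym (cong₂ _⊔_ (old (λ e → h≢ (trans (sym (double/2 h)) (cong (_/ 2) e))))
                        (old (λ e → h≢ (trans (sym (double+1/2 h)) (cong (_/ 2) e)))))))

  -- Repairing `i` moves the defect to its parent: halving shows that any node with child `i` is
  -- `i / 2`, and the children of `i` itself are untouched because i < 2i.
  fix-node : ∀ {T T′ f i} → 1 ≤ i → i < n → TreeExcept i T f →
             T′ i ≡ T (i + i) ⊔ T (i + i + 1) → (∀ {y} → y ≢ i → T′ y ≡ T y) → TreeExcept (i / 2) T′ f
  fix-node {T} {T′} {f} {i} 1≤i i<n t new old = record { leaf = leaf′ ; node = node′ }
    where
    leaf′ : ∀ {q} → q < n → T′ (n + q) ≡ f q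
    leaf′ {q} q<n = trans (old (λ e → <⇒≱ i<n (subst (n ≤_) e (m≤m+n n q)))) (leaf t q<n)
    i<2i : i < i + i
    i<2i = +-monoˡ-≤ i 1≤i
    node′ : ∀ {h} → 1 ≤ h → h < n → h ≢ i / 2 → Node T′ h
    node′ {h} 1≤h h<n h≢ with h ≟ i
    ... | yes refl = trans new (sym (cong₂ _⊔_ (old (λ e → <⇒≢ i<2i (sym e)))
                                              (old (λ e → <⇒≢ (<-≤-trans i<2i (m≤m+n (i + i) 1)) (sym e)))))
    ... | no h≢i   = trans (old h≢i) (trans (node t 1≤h h<n h≢i)
        (sym (cong₂ _⊔_ (old (λ e → h≢ (trans (sym (double/2 h)) (cong (_/ 2) e))))
                        (old (λ e → h≢ (trans (sym (double+1/2 h)) (cong (_/ 2) e)))))))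

  module _ {T f : ℕ → ℕ} (t : Tree T f) where

    private
      node₊ : ∀ {h} → 1 ≤ h → h < n → Node T h
      node₊ 1≤h h<n = node t 1≤h h<n λ { refl → <⇒≱ 1≤h z≤n }

    -- Induction along the path from `h` to its parent `h / 2` and on to the root; `k` is fuel
    -- bounding `h`.
    root-≥ : ∀ k {h} → h ≤ k → 1 ≤ h → h < n + n → T h ≤ T 1
    root-≥ zero    h≤k 1≤h _ = ⊥-elim (<⇒≱ 1≤h h≤k)
    root-≥ (suc k) {1} h≤k 1≤h h< = ≤-refl
    root-≥ (suc k) {h@(suc (suc h′))} h≤k 1≤h h< = ≤-trans step
      (root-≥ k g≤k 1≤g (<-≤-trans g<n (m≤m+n n n)))
      where
      g : ℕ
      g = h / 2
      g<n : g < n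
      g<n = m<n*o⇒m/o<n (subst (h <_) (trans (cong (n +_) (sym (+-identityʳ n))) (*-comm 2 n)) h<)
      1≤g : 1 ≤ g
      1≤g with g in e
      ... | suc _ = s≤s z≤n
      ... | zero with even-or-odd h
      ...   | inj₁ q rewrite e = ⊥-elim (1+n≢0 q)
      ...   | inj₂ q rewrite e = ⊥-elim (1+n≢0 (suc-injective q))
      g<h : g < h
      g<h with even-or-odd h
      ... | inj₁ q = subst (g <_) (sym q) (+-monoˡ-≤ g 1≤g)
      ... | inj₂ q = subst (g <_) (sym q) (<-≤-trans (+-monoˡ-≤ g 1≤g) (m≤m+n _ 1))
      g≤k : g ≤ k
      g≤k = ≤-pred (<-≤-trans g<h h≤k)
      step : T h ≤ T g
      step with even-or-odd h
      ... | inj₁ q = subst₂ _≤_ (cong T (sym q)) (sym (node₊ 1≤g g<n)) (m≤m⊔n _ _)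
      ... | inj₂ q = subst₂ _≤_ (cong T (sym q)) (sym (node₊ 1≤g g<n)) (m≤n⊔m (T (g + g)) _)

    -- Descends to a child that attains the maximum until a leaf is reached. The index grows by at
    -- least one each time, so 2n - h is enough fuel.
    attained : ∀ k {h} → n + n ≤ h + k → 1 ≤ h → h < n + n → ∃[ p ] (p < n × T h ≡ f p)
    attained zero    {h} le 1≤h h< = ⊥-elim (<⇒≱ h< (subst (n + n ≤_) (+-identityʳ h) le))
    attained (suc k) {h} le 1≤h h< with h <? n
    ... | no h≮n = h ∸ n , +-cancelˡ-< n _ _ (subst (_< n + n) (sym (m+[n∸m]≡n n≤h)) h<) ,
                   trans (cong T (sym (m+[n∸m]≡n n≤h)))
                     (leaf t (+-cancelˡ-< n _ _ (subst (_< n + n) (sym (m+[n∸m]≡n n≤h)) h<)))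
      where
      n≤h : n ≤ h
      n≤h = ≮⇒≥ h≮n
    ... | yes h<n with ⊔-sel (T (h + h)) (T (h + h + 1))
    ...   | inj₁ e with attained k {h + h}
                          (≤-trans le (≤-trans (≤-reflexive (+-suc h k)) (+-monoˡ-≤ k (+-monoˡ-≤ h 1≤h))))
                          (≤-trans 1≤h (m≤m+n h h)) (+-mono-< h<n h<n)
    ...     | p , p<n , q = p , p<n , trans (node₊ 1≤h h<n) (trans e q)
    attained (suc k) {h} le 1≤h h< | yes h<n | inj₂ e with attained k {h + h + 1}
                          (≤-trans le (≤-trans (≤-reflexive (+-suc h k))
                            (+-monoˡ-≤ k (≤-trans (+-monoˡ-≤ h 1≤h) (m≤m+n (h + h) 1)))))
                          (≤-trans 1≤h (≤-trans (m≤m+n h h) (m≤m+n _ 1)))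
                          (≤-trans (≤-reflexive (cong suc (+-comm (h + h) 1)))
                            (subst (_≤ n + n) (+-suc (suc h) h) (+-mono-≤ h<n h<n)))
    ...     | p , p<n , q = p , p<n , trans (node₊ 1≤h h<n) (trans e q)

    root-upper : ∀ {p} → p < n → f p ≤ T 1
    root-upper {p} p<n = subst (_≤ T 1) (leaf t p<n)
      (root-≥ (n + p) ≤-refl (≤-trans (≤-trans (s≤s z≤n) 2≤n) (m≤m+n n p)) (+-monoʳ-< n p<n))

    root-attained : ∃[ p ] (p < n × T 1 ≡ f p)
    root-attained = attained (n + n) (n≤1+n _) ≤-refl (≤-trans 2≤n (m≤m+n n n))

  -- What an update of the tree of `b` leaves alone. The variables are numbered so that the scratch
  -- ones come first: here 0 to 3, hence the offset 4. The offsets 5 and 6 in later frame conditions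
  -- also exempt `bᵛ` and then `mᵛ`.
  record TreeFrame (b : ℕ) (ρ₀ : Vars) (G₀ : Mem) (ρ : Vars) (G : Mem) : Set where
    field
      vars   : ∀ r → ρ (4 + r) ≡ ρ₀ (4 + r)
      others : ∀ t → t ≢ tree → ∀ x y → G t x y ≡ G₀ t x y
      rows   : ∀ {x} → x ≢ b → ∀ y → G tree x y ≡ G₀ tree x y

  open TreeFrame public

  write-frame : ∀ {b ρ₀ G₀ ρ G ρ′ y v} b′ → b′ ≡ b →
    TreeFrame b ρ₀ G₀ ρ G → (∀ r → ρ′ (4 + r) ≡ ρ (4 + r)) →
                TreeFrame b ρ₀ G₀ ρ′ (write G tree b′ y v)
  write-frame {G = G} {v = v} _ refl F eqs = record
    { vars = λ r → trans (eqs r) (vars F r) ; others = oth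
      ; rows = λ x≢ y → trans (write-≢ˣ G tree v x≢) (rows F x≢ y) }
    where
    oth : ∀ t → t ≢ tree → ∀ x y → write G tree _ _ v t x y ≡ _
    oth inp  t≢ = others F inp t≢
    oth word t≢ = others F word t≢
    oth tree t≢ = ⊥-elim (t≢ refl)
    oth used t≢ = others F used t≢
    oth ptr  t≢ = others F ptr t≢

  half-< : ∀ {i k} → i < 2 ^ suc k → i / 2 < 2 ^ k
  half-< {i} {k} i< = m<n*o⇒m/o<n (subst (i <_) (*-comm 2 (2 ^ k)) i<)

  half-≤ : ∀ {i} → i < n → i / 2 < n
  half-≤ {i} i<n = m<n*o⇒m/o<n (<-≤-trans i<n (m≤m*n n 2))

  setLeaf-wp : ∀ {Q ρ G f} b p v → ρ bᵛ ≡ b → ρ pᵛ ≡ p → ρ vᵛ ≡ v → p < n → Tree (G tree b) f →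
    (∀ {ρ′ G′} → TreeFrame b ρ G ρ′ G′ → Tree (G′ tree b) (update f p v) → Q ρ′ G′) →
    wp setLeaf Q ρ G
  setLeaf-wp {Q} {ρ} {G} {f} b p v refl refl refl p<n t post = n+p≤B p<n ,
    wpLoop-intro {Q = Q} Inv
      (λ {k} {ρ′} {G′} (_ , _ , F , t′) e → post F (subst (λ i → TreeExcept i (G′ tree b) f′) e t′))
      (λ (i<1 , _) → n<1⇒n≡0 i<1) (λ {k} {ρ′} {G′} → body {k} {ρ′} {G′}) lg
      (<-≤-trans half<n n≤2^lg , half<n ,
       write-frame {ρ = ρ} {ρ′ = ρ₁} b refl (record { vars = λ _ → refl ; others = λ _ _ _ _ → refl
         ; rows = λ _ _ → refl }) (λ _ → refl) ,
       set-leaf p<n t (write-≡ G tree v refl refl) (λ y≢ → write-≢ʸ G tree v y≢))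
    where
    ρ₁ : Vars
    ρ₁ = update (update ρ iᵛ (n + p)) iᵛ ((n + p) / 2)
    f′ : ℕ → ℕ
    f′ = update f p v
    half<n : (n + p) / 2 < n
    half<n = m<n*o⇒m/o<n (subst (n + p <_) (trans (cong (n +_) (sym (+-identityʳ n))) (*-comm 2 n))
      (+-monoʳ-< n p<n))
    -- Below 2 ^ k, at most k halvings lead to 0; initially n ≤ 2 ^ lg provides the range.
    Inv : ℕ → Post
    Inv k ρ′ G′ = ρ′ iᵛ < 2 ^ k × ρ′ iᵛ < n × TreeFrame b ρ G ρ′ G′ × TreeExcept (ρ′ iᵛ) (G′ tree b) f′
    body : ∀ {k ρ′ G′ R} → Inv (suc k) ρ′ G′ → ρ′ iᵛ ≢ 0 → (∀ {ρ″ G″} → Inv k ρ″ G″ → R ρ″ G″) →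
      wp recompute R ρ′ G′
    body {k} {ρ′} {G′} {R} (i<2^ , i<n , F , t′) i≢0 cont =
      ≤-trans (m≤m+n _ 1) (double≤B i<n) , double≤B i<n ,
      (λ no → cont (inv (λ r → refl) (sym (m≥n⇒m⊔n≡m (bit-<-no {G′ tree (ρ′ bᵛ) (i + i)} no))))) ,
      (λ yes → cont (inv (λ r → refl) (sym (m≤n⇒m⊔n≡n (<⇒≤ (bit-<-yes {G′ tree (ρ′ bᵛ) (i + i)} yes))))))
      where
      i : ℕ
      i = ρ′ iᵛ
      b≡ : ρ′ bᵛ ≡ b
      b≡ = vars F 0
      inv : ∀ {ρ″ x} → (∀ r → ρ″ (4 + r) ≡ ρ′ (4 + r)) →
        x ≡ G′ tree (ρ′ bᵛ) (i + i) ⊔ G′ tree (ρ′ bᵛ) (i + i + 1) →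
            Inv k (update ρ″ iᵛ (i / 2)) (write G′ tree (ρ′ bᵛ) i x)
      inv {ρ″} {x} same x≡ = half-< {i} {k} i<2^ , half-≤ i<n ,
        write-frame {ρ′ = update ρ″ iᵛ (i / 2)} (ρ′ bᵛ) b≡ F same ,
        fix-node (n≢0⇒n>0 i≢0) i<n t′
          (trans (write-≡ G′ tree x (sym b≡) refl) (trans x≡
            (cong (λ c → G′ tree c (i + i) ⊔ G′ tree c (i + i + 1)) b≡)))
          (λ y≢ → write-≢ʸ G′ tree x y≢)

  -- The leaves of the tree of `b`: their maximum is one plus the last occurrence of `b`, or 0 if
  -- there is none.
  mark : (ℕ → ℕ) → ℕ → ℕ → ℕ
  mark f b p = if f p ≡ᵇ b then suc p else 0

  mark-≡ : ∀ {f b p} → f p ≡ b → mark f b p ≡ suc p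
  mark-≡ {f} {p = p} refl rewrite ≡ᵇ-refl (f p) = refl

  mark-≢ : ∀ {f b p} → f p ≢ b → mark f b p ≡ 0
  mark-≢ f≢ rewrite ≢⇒≡ᵇ-false f≢ = refl

  record Stored (f : ℕ → ℕ) (G : Mem) : Set where
    field
      small   : ∀ {p} → p < n → f p < σ
      letters : ∀ {p} → p < n → G word p p ≡ f p
      trees   : ∀ {b} → b < σ → Tree (G tree b) (mark f b)

  open Stored public

  -- Positions are shifted by one, so that m = 0 means that there is none.
  record Last (f row : ℕ → ℕ) (c m : ℕ) : Set where
    field
      upper : ∀ {q} → q < n → f q ≢ c → row (f q) ≡ 0 → q < m
      found : m ≡ 0 ⊎ ∃[ j ] (m ≡ suc j × j < n × f j ≢ c × row (f j) ≡ 0)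

  open Last public

  -- The body has to preserve `bᵛ`, and the invariant after it is demanded for all environments that
  -- agree from variable 5 on, because `nextSymbol` still overwrites `bᵛ` and `yᵛ`.
  forSymbols-wp : ∀ {Q ρ G} c (I : ℕ → Post) →
    (∀ {b R ρ G} → b < σ → ρ bᵛ ≡ b → I b ρ G →
      (∀ {ρ′ G′} → ρ′ bᵛ ≡ b → (∀ {ρ″} → (∀ r → ρ″ (5 + r) ≡ ρ′ (5 + r)) → I (suc b) ρ″ G′) → R ρ′ G′) →
        wp c R ρ G) →
    (∀ {ρ′} → (∀ r → ρ′ (5 + r) ≡ ρ (5 + r)) → I 0 ρ′ G) →
    (∀ {ρ G} → I σ ρ G → Q ρ G) → wp (forSymbols c) Q ρ G
  forSymbols-wp {Q} {ρ} {G} c I loop init post =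
    wpLoop-intro {Q = Q} Inv done (λ {ρ′} {G′} → end {ρ′} {G′}) (λ {k} {ρ′} {G′} → body {k} {ρ′} {G′}) σ
      (0 , refl , refl , refl , init (λ _ → refl))
    where
    Inv : ℕ → Post
    Inv k ρ′ G′ = ∃[ b ] (ρ′ bᵛ ≡ b × ρ′ yᵛ ≡ bit (b <ᵇ σ) × b + k ≡ σ × I b ρ′ G′)
    end : ∀ {ρ′ G′} → Inv 0 ρ′ G′ → ρ′ yᵛ ≡ 0
    end (b , _ , y≡ , e , _) = trans y≡ (bit-range (≤-reflexive (trans (sym e) (+-identityʳ b))))
    done : ∀ {k ρ′ G′} → Inv k ρ′ G′ → ρ′ yᵛ ≡ 0 → Q ρ′ G′
    done {k} {ρ′} {G′} (b , _ , y≡ , e , inv) y≡0 = post (subst (λ b → I b ρ′ G′)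
      (≤-antisym (≤-trans (m≤m+n b k) (≤-reflexive e)) (bit-<-no (trans (sym y≡) y≡0))) inv)
    body : ∀ {k ρ′ G′ R} → Inv (suc k) ρ′ G′ → ρ′ yᵛ ≢ 0 → (∀ {ρ″ G″} → Inv k ρ″ G″ → R ρ″ G″) →
           wp (c ⨾ nextSymbol) R ρ′ G′
    body {k} {ρ′} {G′} {R} (b , b≡ , y≡ , e , inv) y≢0 cont = loop b<σ b≡ inv advance
      where
      b<σ : b < σ
      b<σ = bit-<-yes (λ z → y≢0 (trans y≡ z))
      advance : ∀ {ρ′ G′} → ρ′ bᵛ ≡ b → (∀ {ρ″} → (∀ r → ρ″ (5 + r) ≡ ρ′ (5 + r)) → I (suc b) ρ″ G′) →
                wp nextSymbol R ρ′ G′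
      advance refl inv′ = b+1≤B b<σ , cont (suc b , +-comm b 1 , cong (λ b → bit (b <ᵇ σ)) (+-comm b 1) ,
        trans (sym (+-suc b k)) e , inv′ (λ _ → refl))

  search-wp : ∀ {Q ρ G f} k c → ρ kᵛ ≡ k → ρ cᵛ ≡ c → Stored f G →
    (∀ {ρ′} → (∀ r → ρ′ (6 + r) ≡ ρ (6 + r)) → Last f (G used k) c (ρ′ mᵛ) → Q ρ′ G) →
    wp search Q ρ G
  search-wp {Q} {ρ} {G} {f} k c refl refl S post = forSymbols-wp {Q} {update ρ mᵛ 0} consider Inv body
    (λ same → refl , (λ r → same (suc r)) , (λ ()) , inj₁ (same 0))
    (λ {ρ′} (e , same , up , att) → subst (Q ρ′) (sym e) (post same (last up att)))
    where
    row root : ℕ → ℕ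
    row  = G used k
    root = λ b → G tree b 1
    Upper Attained : ℕ → ℕ → Set
    Upper b₀ m = ∀ {b} → b < b₀ → b ≢ c → row b ≡ 0 → root b ≤ m
    Attained b₀ m = m ≡ 0 ⊎ ∃[ b ] (b < b₀ × b ≢ c × row b ≡ 0 × m ≡ root b)
    Inv : ℕ → Post
    Inv b ρ′ G′ = G′ ≡ G × (∀ r → ρ′ (6 + r) ≡ ρ (6 + r)) × Upper b (ρ′ mᵛ) × Attained b (ρ′ mᵛ)
    last : ∀ {m} → Upper σ m → Attained σ m → Last f row c m
    last {m} up att = record { upper = upper′ ; found = found′ att }
      where
      upper′ : ∀ {q} → q < n → f q ≢ c → row (f q) ≡ 0 → q < m
      upper′ {q} q<n q≢c free = ≤-trans
        (subst (_≤ root (f q)) (mark-≡ {f} refl) (root-upper (trees S (small S q<n)) q<n))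
        (up (small S q<n) q≢c free)
      found′ : Attained σ m → m ≡ 0 ⊎ ∃[ j ] (m ≡ suc j × j < n × f j ≢ c × row (f j) ≡ 0)
      found′ (inj₁ m≡0) = inj₁ m≡0
      found′ (inj₂ (b , b<σ , b≢c , free , m≡)) with root-attained (trees S b<σ)
      ... | p , p<n , r≡ with f p ≟ b
      ...   | yes refl = inj₂ (p , trans m≡ (trans r≡ (mark-≡ {f} refl)) , p<n , b≢c , free)
      -- The root is attained at an unmarked leaf, so it is 0 and the symbol does not occur.
      ...   | no  f≢b  = inj₁ (trans m≡ (trans r≡ (mark-≢ {f} f≢b)))
    extend : ∀ {b₀ m₀ m} → Upper b₀ m₀ → m₀ ≤ m → (b₀ ≢ c → row b₀ ≡ 0 → root b₀ ≤ m) → Upper (suc b₀) m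
    extend up m₀≤ new {b} b< b≢c free with m≤n⇒m<n∨m≡n (≤-pred b<)
    ... | inj₁ b<b₀ = ≤-trans (up b<b₀ b≢c free) m₀≤
    ... | inj₂ refl = new b≢c free
    weaken : ∀ {b₀ m} → Attained b₀ m → Attained (suc b₀) m
    weaken (inj₁ e)                = inj₁ e
    weaken (inj₂ (b , b< , rest)) = inj₂ (b , m≤n⇒m≤1+n b< , rest)
    body : ∀ {b} {R : Post} {ρ′ G′} → b < σ → ρ′ bᵛ ≡ b → Inv b ρ′ G′ →
      (∀ {ρ″ G″} → ρ″ bᵛ ≡ b → (∀ {ρ‴} → (∀ r → ρ‴ (5 + r) ≡ ρ″ (5 + r)) → Inv (suc b) ρ‴ G″) → R ρ″ G″) →
      wp consider R ρ′ G′
    body {R = R} {ρ′} b<σ refl (refl , same , up , att) cont =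
      (λ b≡c → keep refl (λ _ → refl) (λ b≢c _ → ⊥-elim (b≢c (trans (bit-≢-no {b₀} b≡c) (same 3))))) ,
      (λ b≢c →
        (λ busy → keep refl (λ _ → refl) (λ _ free → ⊥-elim
          (<⇒≢ (bit-<-no {row₀} {1} busy) (sym (trans row≡ free))))) ,
        (λ free →
          (λ least → keep refl (λ _ → refl) (λ _ _ → bit-<-no {m₀} least)) ,
          (λ large → cont refl (λ same‴ → refl , (λ r → trans (same‴ (suc r)) (same r)) ,
            subst (Upper (suc b₀)) (sym (same‴ 0))
              (extend up (<⇒≤ (bit-<-yes {m₀} large)) (λ _ _ → ≤-refl)) ,
            inj₂ (b₀ , ≤-refl , (λ q → bit-≢-yes {b₀} b≢c (trans q (sym (same 3)))) ,
                  trans (sym row≡) (n<1⇒n≡0 (bit-<-yes {row₀} free)) , same‴ 0)))))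
      where
      b₀ m₀ row₀ : ℕ
      b₀ = ρ′ bᵛ
      m₀ = ρ′ mᵛ
      row₀ = G used (ρ′ kᵛ) b₀
      row≡ : row₀ ≡ row b₀
      row≡ = cong (λ x → G used x b₀) (same 2)
      keep : ∀ {ρ″} → ρ″ bᵛ ≡ b₀ → (∀ r → ρ″ (5 + r) ≡ ρ′ (5 + r)) →
             (b₀ ≢ c → row b₀ ≡ 0 → root b₀ ≤ m₀) → R ρ″ G
      keep b≡ same″ new = cont b≡ (λ same‴ →
        let same⁗ = λ r → trans (same‴ r) (same″ r) in
        refl , (λ r → trans (same⁗ (suc r)) (same r)) ,
        subst (Upper (suc b₀)) (sym (same⁗ 0)) (extend up ≤-refl new) ,
        subst (Attained (suc b₀)) (sym (same⁗ 0)) (weaken att))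

  clear-wp : ∀ {Q ρ G} k → ρ kᵛ ≡ k →
    (∀ {ρ′ G′} → (∀ r → ρ′ (5 + r) ≡ ρ (5 + r)) → (∀ t → t ≢ used → ∀ x y → G′ t x y ≡ G t x y) →
      (∀ {x} → x ≢ k → ∀ y → G′ used x y ≡ G used x y) → (∀ {b} → b < σ → G′ used k b ≡ 0) → Q ρ′ G′) →
    wp clear Q ρ G
  clear-wp {Q} {ρ} {G} k refl post = forSymbols-wp {Q} unflag Inv (λ {b} {R} → body {b} {R})
    (λ same → same , (λ _ _ _ _ → refl) , (λ _ _ → refl) , (λ ()))
    (λ (same , oth , rws , zeros) → post same oth rws zeros)
    where
    Inv : ℕ → Post
    Inv b ρ′ G′ = (∀ r → ρ′ (5 + r) ≡ ρ (5 + r)) × (∀ t → t ≢ used → ∀ x y → G′ t x y ≡ G t x y) ×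
      (∀ {x} → x ≢ k → ∀ y → G′ used x y ≡ G used x y) × (∀ {b′} → b′ < b → G′ used k b′ ≡ 0)
    body : ∀ {b} {R : Post} {ρ′ G′} → b < σ → ρ′ bᵛ ≡ b → Inv b ρ′ G′ →
      (∀ {ρ″ G″} → ρ″ bᵛ ≡ b → (∀ {ρ‴} → (∀ r → ρ‴ (5 + r) ≡ ρ″ (5 + r)) → Inv (suc b) ρ‴ G″) → R ρ″ G″) →
      wp unflag R ρ′ G′
    body {ρ′ = ρ′} {G′} b<σ refl (same , oth , rws , zeros) cont = cont refl (λ same″ →
      (λ r → trans (same″ r) (same r)) , oth′ ,
      (λ x≢k y → trans (write-≢ˣ G′ used 0 (λ q → x≢k (trans q k≡))) (rws x≢k y)) , zeros′)
      where
      b₀ : ℕ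
      b₀ = ρ′ bᵛ
      k≡ : ρ′ kᵛ ≡ k
      k≡ = same 3
      oth′ : ∀ t → t ≢ used → ∀ x y → write G′ used (ρ′ kᵛ) b₀ 0 t x y ≡ G t x y
      oth′ inp  t≢ = oth inp t≢
      oth′ word t≢ = oth word t≢
      oth′ tree t≢ = oth tree t≢
      oth′ used t≢ = ⊥-elim (t≢ refl)
      oth′ ptr  t≢ = oth ptr t≢
      zeros′ : ∀ {b} → b < suc b₀ → write G′ used (ρ′ kᵛ) b₀ 0 used k b ≡ 0
      zeros′ {b} b< with b ≟ b₀
      ... | yes refl = write-≡ G′ used 0 (sym k≡) refl
      ... | no b≢    = trans (write-≢ʸ G′ used 0 b≢) (zeros (≤∧≢⇒< (≤-pred b<) b≢))

-- The enumeration

push select exchange pop retire move loadLetter loadWord : Cmd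

-- Row n of used belongs to no level and stays zero, so here the search yields
-- the last position whose letter differs from the last letter.
push =
  kᵛ ≔ mov #n ⨾
  pᵛ ≔ minus #n #1 ⨾
  cᵛ ≔ get word (var pᵛ) (var pᵛ) ⨾
  search ⨾
  topᵛ ≔ mov (var botᵛ) ⨾
  yᵛ ≔ less (var limᵛ) (var mᵛ) ⨾
  when (var yᵛ)
    (vᵛ ≔ plus (var botᵛ) #1 ⨾
     put ptr (var limᵛ) (var limᵛ) (var vᵛ) ⨾
     topᵛ ≔ mov (var mᵛ))

select =
  kᵛ ≔ minus (var topᵛ) #1 ⨾
  cᵛ ≔ get word (var kᵛ) (var kᵛ) ⨾
  search ⨾
  jᵛ ≔ minus (var mᵛ) #1

-- Flagged at level k is the letter that leaves; the one that arrives counts as tried by being the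
-- current letter. `topᵛ` and `mᵛ` hold k + 1 and j + 1, which are precisely the leaf values for the
-- new positions.
exchange =
  sᵛ ≔ get word (var jᵛ) (var jᵛ) ⨾
  put word (var kᵛ) (var kᵛ) (var sᵛ) ⨾
  put word (var jᵛ) (var jᵛ) (var cᵛ) ⨾
  put used (var kᵛ) (var cᵛ) #1 ⨾
  bᵛ ≔ mov (var sᵛ) ⨾
  pᵛ ≔ mov (var jᵛ) ⨾
  vᵛ ≔ mov #0 ⨾
  setLeaf ⨾
  pᵛ ≔ mov (var kᵛ) ⨾
  vᵛ ≔ mov (var topᵛ) ⨾
  setLeaf ⨾
  bᵛ ≔ mov (var cᵛ) ⨾
  vᵛ ≔ mov #0 ⨾
  setLeaf ⨾
  pᵛ ≔ mov (var jᵛ) ⨾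
  vᵛ ≔ mov (var mᵛ) ⨾
  setLeaf

-- Flags and link return to zero, the state in which a level is expected when it is pushed again.
pop =
  clear ⨾
  botᵛ ≔ mov (var kᵛ) ⨾
  xᵛ ≔ get ptr (var kᵛ) (var kᵛ) ⨾
  when (var xᵛ) (botᵛ ≔ minus (var xᵛ) #1) ⨾
  put ptr (var kᵛ) (var kᵛ) #0

retire =
  cᵛ ≔ mov (var sᵛ) ⨾
  search ⨾
  botᵛ ≔ mov (var topᵛ) ⨾
  limᵛ ≔ mov (var topᵛ) ⨾
  -- With `topᵛ` = k + 1 and `mᵛ` = j + 1 this asks for k < j, that is, whether level k still has an
  -- untried letter further right; the next line negates the answer.
  yᵛ ≔ less (var topᵛ) (var mᵛ) ⨾
  yᵛ ≔ less (var yᵛ) #1 ⨾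
  when (var yᵛ) pop

move = exchange ⨾ retire

loadLetter =
  -- The word starts at address σ + 2, after n, σ and the Parikh vector.
  iᵛ ≔ plus #h (var pᵛ) ⨾
  bᵛ ≔ get inp #0 (var iᵛ) ⨾
  put word (var pᵛ) (var pᵛ) (var bᵛ) ⨾
  vᵛ ≔ plus (var pᵛ) #1 ⨾
  setLeaf ⨾
  pᵛ ≔ plus (var pᵛ) #1 ⨾
  yᵛ ≔ less (var pᵛ) #n

loadWord =
  yᵛ ≔ less (var pᵛ) #n ⨾
  while ⟨n⟩ (var yᵛ) loadLetter

-- A pointer k + 1 denotes level k and 0 the empty stack; an unset entry of ptr
-- stands for the level just below.
follow : ℕ → ℕ → ℕ
follow zero    k = k
follow (suc d) k = d

-- From the top down the levels strictly decrease and stay below `lim`, so links at or above `lim`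
-- can be rewritten without affecting the stack.
data Stack (G : Mem) : (lim ptr : ℕ) → List ℕ → Set where
  nil  : ∀ {lim} → Stack G lim 0 []
  cons : ∀ {lim k L} → k < lim → Stack G k (follow (G ptr k k) k) L → Stack G lim (suc k) (k ∷ L)

stack-≤ : ∀ {G lim lim′ p L} → lim ≤ lim′ → Stack G lim p L → Stack G lim′ p L
stack-≤ le nil         = nil
stack-≤ le (cons l< s) = cons (<-≤-trans l< le) s

stack-cong : ∀ {G G′ lim p L} → (∀ {k} → k < lim → G′ ptr k k ≡ G ptr k k) → Stack G lim p L →
  Stack G′ lim p L
stack-cong same nil = nil
stack-cong {G} {G′} same (cons {k = k} {L} l< s) = cons l<
  (subst (λ d → Stack G′ k (follow d k) L) (sym (same l<)) (stack-cong (λ lt′ → same (<-trans lt′ l<)) s))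

stack-∈ : ∀ {G lim p L k} → Stack G lim p L → k ∈ L → k < lim
stack-∈ (cons l< s) (here refl) = l<
stack-∈ (cons l< s) (there i)   = <-trans (stack-∈ s i) l<

stack-ptr : ∀ {G lim p L} → Stack G lim p L → p ≤ lim
stack-ptr nil         = z≤n
stack-ptr (cons l< _) = l<

levels : ℕ → ℕ → List ℕ → List ℕ
levels zero    lim L = L
levels (suc d) lim L = (d + lim) ∷ levels d lim L

∈-levels⁺ : ∀ d {lim L k} → k ∈ L ⊎ (lim ≤ k × k < d + lim) → k ∈ levels d lim L
∈-levels⁺ zero    (inj₁ i)          = i
∈-levels⁺ zero    (inj₂ (le , l<))  = ⊥-elim (<⇒≱ l< le)
∈-levels⁺ (suc d) (inj₁ i)          = there (∈-levels⁺ d (inj₁ i))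
∈-levels⁺ (suc d) (inj₂ (le , l<)) with m≤n⇒m<n∨m≡n (≤-pred l<)
... | inj₁ lt′  = there (∈-levels⁺ d (inj₂ (le , lt′)))
... | inj₂ refl = here refl

∈-levels⁻ : ∀ d {lim L k} → k ∈ levels d lim L → k ∈ L ⊎ (lim ≤ k × k < d + lim)
∈-levels⁻ zero    i           = inj₁ i
∈-levels⁻ (suc d) (here refl) = inj₂ (m≤n+m _ d , ≤-refl)
∈-levels⁻ (suc d) (there i) with ∈-levels⁻ d i
... | inj₁ i′        = inj₁ i′
... | inj₂ (le , l<) = inj₂ (le , m≤n⇒m≤1+n l<)

stack-levels : ∀ {G lim p L} d → Stack G lim p L →
  G ptr lim lim ≡ suc p → (∀ {k} → lim < k → G ptr k k ≡ 0) →
               Stack G (suc d + lim) (suc d + lim) (levels (suc d) lim L)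
stack-levels {G} {lim} {L = L} zero s e _ =
  cons ≤-refl (subst (λ d → Stack G lim (follow d lim) L) (sym e) s)
stack-levels {G} {lim} {L = L} (suc d) s e z = cons ≤-refl
  (subst (λ x → Stack G (suc d + lim) (follow x (suc d + lim)) (levels (suc d) lim L))
    (sym (z (s≤s (m≤n+m lim d)))) (stack-levels d s e z))

-- Verification of the commands of a round

module Enumeration (n σ lg : ℕ) (2≤n : 2 ≤ n) (n≤2^lg : n ≤ 2 ^ lg) where

  open Semantics n σ lg
  open Verification n σ lg 2≤n n≤2^lg

  Viable : (f : ℕ → ℕ) (U : ℕ → ℕ → ℕ) → ℕ → Set
  Viable f U k = ∃[ q ] (k < q × q < n × f q ≢ f k × U k (f q) ≡ 0)

  record Chosen (f : ℕ → ℕ) (k j : ℕ) (ρ : Vars) (G : Mem) : Set where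
    field
      k≡   : ρ kᵛ ≡ k
      c≡   : ρ cᵛ ≡ f k
      j≡   : ρ jᵛ ≡ j
      m≡   : ρ mᵛ ≡ suc j
      top≡ : ρ topᵛ ≡ suc k
      k<j  : k < j
      j<n  : j < n
      new  : f j ≢ f k
      free : G used k (f j) ≡ 0

  -- The search covers the whole word, yet its result lies beyond `k`: viability provides one
  -- admissible position beyond `k`, and the last admissible position is no earlier.
  select-wp : ∀ {Q ρ G f} k → ρ topᵛ ≡ suc k → k < n → Stored f G → Viable f (G used) k →
    (∀ {ρ′ j} → Chosen f k j ρ′ G → Q ρ′ G) → wp select Q ρ G
  select-wp {Q} {ρ} {G} {f} k e k<n S (q , k<q , q<n , q≢ , free) post =
    search-wp k (f k) k≡ c≡ S finish
    where
    k≡ : ρ topᵛ ∸ 1 ≡ k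
    k≡ = cong (_∸ 1) e
    c≡ : G word (ρ topᵛ ∸ 1) (ρ topᵛ ∸ 1) ≡ f k
    c≡ = trans (cong (λ x → G word x x) k≡) (letters S k<n)
    ρ₁ : Vars
    ρ₁ = update (update ρ kᵛ (ρ topᵛ ∸ 1)) cᵛ (G word (ρ topᵛ ∸ 1) (ρ topᵛ ∸ 1))
    finish : ∀ {ρ′} → (∀ r → ρ′ (6 + r) ≡ ρ₁ (6 + r)) → Last f (G used k) (f k) (ρ′ mᵛ) →
             wp (jᵛ ≔ minus (var mᵛ) #1) Q ρ′ G
    finish {ρ′} same last with found last
    ... | inj₁ m≡0 = ⊥-elim (<⇒≱ (upper last q<n q≢ free) (subst (_≤ q) (sym m≡0) z≤n))
    ... | inj₂ (j , m≡ , j<n , j≢ , free′) = post record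
      { k≡ = trans (same 2) k≡ ; c≡ = trans (same 3) c≡ ; j≡ = cong (_∸ 1) m≡ ; m≡ = m≡
      ; top≡ = trans (same 6) e ; k<j = <-≤-trans k<q (≤-pred (subst (q <_) m≡ (upper last q<n q≢ free)))
      ; j<n = j<n ; new = j≢ ; free = free′ }

  record Exchanged (f : ℕ → ℕ) (k j : ℕ) (G : Mem) (ρ′ : Vars) (G′ : Mem) : Set where
    field
      k≡      : ρ′ kᵛ ≡ k
      s≡      : ρ′ sᵛ ≡ f j
      top≡    : ρ′ topᵛ ≡ suc k
      stored  : Stored (swapped f k j) G′
      flagged : ∀ x y → G′ used x y ≡ write G used k (f k) 1 used x y
      ptrs    : ∀ x y → G′ ptr x y ≡ G ptr x y

  exchange-wp : ∀ {Q ρ G f k j} → Stored f G → Chosen f k j ρ G →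
    (∀ {ρ′ G′} → Exchanged f k j G ρ′ G′ → Q ρ′ G′) → wp exchange Q ρ G
  exchange-wp {Q} {ρ} {G} {f} S
    record { k≡ = refl ; c≡ = c≡ ; j≡ = refl ; m≡ = m≡ ; top≡ = top≡ ; k<j = k<j ; j<n = j<n ; new = new
      ; free = free } post =
    setLeaf-wp {ρ = ρ₁} {G₁} s j 0 refl refl refl j<n (trees S s<σ) λ {ρ₂} {G₂} F₁ t₁ →
    setLeaf-wp {ρ = update (update ρ₂ pᵛ (ρ₂ kᵛ)) vᵛ (ρ₂ topᵛ)} {G₂} s k (suc k) (vars F₁ 0) (vars F₁ 4)
      (trans (vars F₁ 8) top≡) k<n t₁ λ {ρ₃} {G₃} F₂ t₂ →
    setLeaf-wp {ρ = update (update ρ₃ bᵛ (ρ₃ cᵛ)) vᵛ 0} {G₃} c k 0 (trans (vars F₂ 5) (vars F₁ 5))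
      (trans (vars F₂ 2) (vars F₁ 4)) refl k<n
      (tree-cong (λ y → trans (rows F₂ c≢s y) (rows F₁ c≢s y))
        (λ _ → refl) (trees S c<σ)) λ {ρ₄} {G₄} F₃ t₃ →
    setLeaf-wp {ρ = update (update ρ₄ pᵛ (ρ₄ jᵛ)) vᵛ (ρ₄ mᵛ)} {G₄} c j (suc j)
      (trans (vars F₃ 0) (trans (vars F₂ 5) (vars F₁ 5)))
      (trans (vars F₃ 6) (trans (vars F₂ 6) (vars F₁ 6)))
      (trans (vars F₃ 1) (trans (vars F₂ 1) (trans (vars F₁ 1) m≡))) j<n t₃ λ {ρ₅} {G₅} F₄ t₄ →
    post record
      { k≡ = vars₄ F₁ F₂ F₃ F₄ 0 ; s≡ = trans (vars₄ F₁ F₂ F₃ F₄ 3) s≡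
        ; top≡ = trans (vars₄ F₁ F₂ F₃ F₄ 4) top≡
      ; stored = record
        { small   = λ p<n → small′ p<n
        ; letters = λ p<n → trans (others₄ F₁ F₂ F₃ F₄ word (λ ()) _ _) (letters′ p<n)
        ; trees   = λ {b} b<σ → trees′ F₁ F₂ F₃ F₄ t₂ t₄ b<σ (b ≟ s) (b ≟ c) }
      ; flagged = λ x y → trans (others₄ F₁ F₂ F₃ F₄ used (λ ()) x y)
        (cong (λ z → write G used k z 1 used x y) c≡)
      ; ptrs = others₄ F₁ F₂ F₃ F₄ ptr (λ ()) }
    where
    k j s c : ℕ
    k = ρ kᵛ
    j = ρ jᵛ
    s = G word j j
    c = ρ cᵛ
    k<n : k < n
    k<n = <-trans k<j j<n
    s≡ : s ≡ f j
    s≡ = letters S j<n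
    s<σ : s < σ
    s<σ = subst (_< σ) (sym s≡) (small S j<n)
    c<σ : c < σ
    c<σ = subst (_< σ) (sym c≡) (small S k<n)
    c≢s : c ≢ s
    c≢s e = new (trans (sym s≡) (trans (sym e) c≡))
    k≢j : k ≢ j
    k≢j = <⇒≢ k<j
    f′ : ℕ → ℕ
    f′ = swapped f k j
    f′k : f′ k ≡ s
    f′k = trans (swapped-left f k≢j) (sym s≡)
    f′j : f′ j ≡ c
    f′j = trans (swapped-right f k j) (sym c≡)
    ρ₁ : Vars
    ρ₁ = update (update (update (update ρ sᵛ s) bᵛ s) pᵛ j) vᵛ 0
    G₁ : Mem
    G₁ = write (write (write G word k k s) word j j c) used k c 1
    module _ {ρ₂ ρ₃ ρ₄ ρ₅ G₂ G₃ G₄ G₅}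
      (F₁ : TreeFrame s ρ₁ G₁ ρ₂ G₂)
      (F₂ : TreeFrame s (update (update ρ₂ pᵛ (ρ₂ kᵛ)) vᵛ (ρ₂ topᵛ)) G₂ ρ₃ G₃)
      (F₃ : TreeFrame c (update (update ρ₃ bᵛ (ρ₃ cᵛ)) vᵛ 0) G₃ ρ₄ G₄)
      (F₄ : TreeFrame c (update (update ρ₄ pᵛ (ρ₄ jᵛ)) vᵛ (ρ₄ mᵛ)) G₄ ρ₅ G₅) where
      vars₄ : ∀ r → ρ₅ (8 + r) ≡ ρ₁ (8 + r)
      vars₄ r = trans (vars F₄ (4 + r))
        (trans (vars F₃ (4 + r)) (trans (vars F₂ (4 + r)) (vars F₁ (4 + r))))
      others₄ : ∀ t → t ≢ tree → ∀ x y → G₅ t x y ≡ G₁ t x y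
      others₄ t t≢ x y = trans (others F₄ t t≢ x y) (trans (others F₃ t t≢ x y)
        (trans (others F₂ t t≢ x y) (others F₁ t t≢ x y)))
      -- The tree of `s` is affected by the first two updates only, that of `c` by the last two
      -- only, and any other tree by none; `s` and `c` are distinct.
      trees′ : Tree (G₃ tree s) (update (update (mark f s) j 0) k (suc k)) →
               Tree (G₅ tree c) (update (update (mark f c) k 0) j (suc j)) →
               ∀ {b} → b < σ → Dec (b ≡ s) → Dec (b ≡ c) → Tree (G₅ tree b) (mark f′ b)
      trees′ t₂ t₄ b<σ (yes refl) _ =
        tree-cong (λ y → trans (rows F₄ (λ e → c≢s (sym e)) y) (rows F₃ (λ e → c≢s (sym e)) y))
        (λ {p} _ → go p) t₂
        where
        go : ∀ p → update (update (mark f s) j 0) k (suc k) p ≡ mark f′ s p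
        go p with p ≟ k | p ≟ j
        ... | yes refl | _ = trans (update-≡ (update (mark f s) j 0) k (suc k)) (sym (mark-≡ {f′} f′k))
        ... | no p≢k | yes refl = trans (update-≢ (update (mark f s) j 0) (suc k) p≢k)
          (trans (update-≡ (mark f s) j 0)
                                   (sym (mark-≢ {f′} (λ e → c≢s (trans (sym f′j) e)))))
        ... | no p≢k | no p≢j = trans (update-≢ (update (mark f s) j 0) (suc k) p≢k)
          (trans (update-≢ (mark f s) 0 p≢j)
                                   (cong (λ z → if z ≡ᵇ s then suc p else 0)
                                     (sym (swapped-other f p≢k p≢j))))
      trees′ t₂ t₄ b<σ (no _) (yes refl) = tree-cong (λ _ → refl) (λ {p} _ → go p) t₄
        where
        go : ∀ p → update (update (mark f c) k 0) j (suc j) p ≡ mark f′ c p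
        go p with p ≟ j | p ≟ k
        ... | yes refl | _ = trans (update-≡ (update (mark f c) k 0) j (suc j)) (sym (mark-≡ {f′} f′j))
        ... | no p≢j | yes refl = trans (update-≢ (update (mark f c) k 0) (suc j) p≢j)
          (trans (update-≡ (mark f c) k 0)
                                   (sym (mark-≢ {f′} (λ e → c≢s (trans (sym e) f′k)))))
        ... | no p≢j | no p≢k = trans (update-≢ (update (mark f c) k 0) (suc j) p≢j)
          (trans (update-≢ (mark f c) 0 p≢k)
                                   (cong (λ z → if z ≡ᵇ c then suc p else 0)
                                     (sym (swapped-other f p≢k p≢j))))
      trees′ t₂ t₄ {b} b<σ (no b≢s) (no b≢c) = tree-cong
        (λ y → trans (rows F₄ b≢c y) (trans (rows F₃ b≢c y) (trans (rows F₂ b≢s y) (rows F₁ b≢s y))))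
          (λ {p} _ → go p) (trees S b<σ)
        where
        go : ∀ p → mark f b p ≡ mark f′ b p
        go p with p ≟ j | p ≟ k
        ... | yes refl | _ = trans (mark-≢ {f} (λ e → b≢s (sym (trans s≡ e))))
          (sym (mark-≢ {f′} (λ e → b≢c (sym (trans (sym f′j) e)))))
        ... | no _ | yes refl = trans (mark-≢ {f} (λ e → b≢c (sym (trans c≡ e))))
          (sym (mark-≢ {f′} (λ e → b≢s (sym (trans (sym f′k) e)))))
        ... | no p≢j | no p≢k = cong (λ z → if z ≡ᵇ b then suc p else 0) (sym (swapped-other f p≢k p≢j))
    small′ : ∀ {p} → p < n → f′ p < σ
    small′ {p} p<n with p ≟ j | p ≟ k
    ... | yes refl | _        = subst (_< σ) (sym f′j) c<σ
    ... | no _     | yes refl = subst (_< σ) (sym f′k) s<σ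
    ... | no p≢j   | no p≢k   = subst (_< σ) (sym (swapped-other f p≢k p≢j)) (small S p<n)
    letters′ : ∀ {p} → p < n → G₁ word p p ≡ f′ p
    letters′ {p} p<n with p ≟ j | p ≟ k
    ... | yes refl | _        = trans (write-≡ (write G word k k s) word {j} {j} c refl refl) (sym f′j)
    ... | no p≢j   | yes refl = trans (write-≢ˣ (write G word k k s) word c p≢j)
                                  (trans (write-≡ G word {k} {k} s refl refl) (sym f′k))
    ... | no p≢j   | no p≢k   = trans (write-≢ˣ (write G word k k s) word c p≢j)
      (trans (write-≢ˣ G word s p≢k)
                                  (trans (letters S p<n) (sym (swapped-other f p≢k p≢j))))

  record Popped (k : ℕ) (G G′ : Mem) : Set where
    field
      elsewhere : ∀ t → t ≢ used → t ≢ ptr → ∀ x y → G′ t x y ≡ G t x y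
      used≢     : ∀ {x} → x ≢ k → ∀ y → G′ used x y ≡ G used x y
      ptr≢      : ∀ {x} → x ≢ k → ∀ y → G′ ptr x y ≡ G ptr x y
      used₀     : ∀ {b} → b < σ → G′ used k b ≡ 0
      ptr₀      : G′ ptr k k ≡ 0

  stored-cong : ∀ {f g G} → (∀ {p} → p < n → f p ≡ g p) → Stored f G → Stored g G
  stored-cong f≗g S = record
    { small   = λ p<n → subst (_< σ) (f≗g p<n) (small S p<n)
    ; letters = λ p<n → trans (letters S p<n) (f≗g p<n)
    ; trees   = λ {b} b<σ → tree-cong (λ _ → refl)
        (λ {p} p<n → cong (λ z → if z ≡ᵇ b then suc p else 0) (f≗g p<n)) (trees S b<σ) }

  stored-popped : ∀ {f k G G′} → Popped k G G′ → Stored f G → Stored f G′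
  stored-popped p S = record
    { small   = small S
    ; letters = λ p<n → trans (Popped.elsewhere p word (λ ()) (λ ()) _ _) (letters S p<n)
    ; trees   = λ b<σ → tree-cong (λ y → Popped.elsewhere p tree (λ ()) (λ ()) _ y)
      (λ _ → refl) (trees S b<σ) }

  pop-wp : ∀ {Q ρ G} k → ρ kᵛ ≡ k →
    (∀ {ρ′ G′} → ρ′ limᵛ ≡ ρ limᵛ → ρ′ botᵛ ≡ follow (G ptr k k) k → Popped k G G′ → Q ρ′ G′) → wp pop Q ρ G
  pop-wp {Q} {ρ} {G} k refl post = clear-wp k refl finish
    where
    finish : ∀ {ρ′ G′} → (∀ r → ρ′ (5 + r) ≡ ρ (5 + r)) → (∀ t → t ≢ used → ∀ x y → G′ t x y ≡ G t x y) →
      (∀ {x} → x ≢ k → ∀ y → G′ used x y ≡ G used x y) → (∀ {b} → b < σ → G′ used k b ≡ 0) →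
      wp (botᵛ ≔ mov (var kᵛ) ⨾ xᵛ ≔ get ptr (var kᵛ) (var kᵛ) ⨾
          when (var xᵛ) (botᵛ ≔ minus (var xᵛ) #1) ⨾ put ptr (var kᵛ) (var kᵛ) #0) Q ρ′ G′
    finish {ρ′} {G′} same oth rws zeros =
      (λ d≡0 → post (same 9) (trans k′≡ (cong (λ d → follow d k) (sym (trans (sym d≡) d≡0)))) popped) ,
      (λ d≢0 → post (same 9) (trans (pred-follow _ d≢0) (cong (λ d → follow d k) d≡)) popped)
      where
      k′≡ : ρ′ kᵛ ≡ k
      k′≡ = same 3
      d≡ : G′ ptr (ρ′ kᵛ) (ρ′ kᵛ) ≡ G ptr k k
      d≡ = trans (cong (λ x → G′ ptr x x) k′≡) (oth ptr (λ ()) k k)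
      pred-follow : ∀ d → d ≢ 0 → d ∸ 1 ≡ follow d k
      pred-follow zero    d≢0 = ⊥-elim (d≢0 refl)
      pred-follow (suc d) d≢0 = refl
      elsewhere′ : ∀ t → t ≢ used → t ≢ ptr → ∀ x y → write G′ ptr (ρ′ kᵛ) (ρ′ kᵛ) 0 t x y ≡ G t x y
      elsewhere′ inp  u≢ p≢ = oth inp u≢
      elsewhere′ word u≢ p≢ = oth word u≢
      elsewhere′ tree u≢ p≢ = oth tree u≢
      elsewhere′ used u≢ p≢ = ⊥-elim (u≢ refl)
      elsewhere′ ptr  u≢ p≢ = ⊥-elim (p≢ refl)
      popped : Popped k G (write G′ ptr (ρ′ kᵛ) (ρ′ kᵛ) 0)
      popped = record
        { elsewhere = elsewhere′ ; used≢ = rws ; used₀ = zeros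
        ; ptr≢ = λ x≢ y → trans (write-≢ˣ G′ ptr 0 (λ e → x≢ (trans e k′≡))) (oth ptr (λ ()) _ y)
        ; ptr₀ = write-≡ G′ ptr 0 (sym k′≡) (sym k′≡) }

  retire-wp : ∀ {Q ρ G f} k → ρ kᵛ ≡ k → ρ sᵛ ≡ f k → ρ topᵛ ≡ suc k → k < n → Stored f G →
    (∀ {ρ′} → ρ′ limᵛ ≡ suc k → ρ′ botᵛ ≡ suc k → Viable f (G used) k → Q ρ′ G) →
    (∀ {ρ′ G′} → ρ′ limᵛ ≡ suc k → ρ′ botᵛ ≡ follow (G ptr k k) k → ¬ Viable f
      (G used) k → Popped k G G′ → Q ρ′ G′) →
    wp retire Q ρ G
  retire-wp {Q} {ρ} {G} {f} k k≡ s≡ top≡ k<n S stay leave = search-wp k (f k) k≡ s≡ S finish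
    where
    ρ₁ : Vars
    ρ₁ = update ρ cᵛ (ρ sᵛ)
    finish : ∀ {ρ′} → (∀ r → ρ′ (6 + r) ≡ ρ₁ (6 + r)) → Last f (G used k) (f k) (ρ′ mᵛ) →
      wp (botᵛ ≔ mov (var topᵛ) ⨾ limᵛ ≔ mov (var topᵛ) ⨾ yᵛ ≔ less (var topᵛ) (var mᵛ) ⨾
          yᵛ ≔ less (var yᵛ) #1 ⨾ when (var yᵛ) pop) Q ρ′ G
    finish {ρ′} same last =
      (λ e → stay top′ top′ (viable (subst (_< ρ′ mᵛ) top′
        (bit-<-yes {ρ′ topᵛ} (λ z → 1+n≰n (subst (1 ≤_) z (bit-<-no {_} {1} e))))) (found last))) ,
      (λ e → pop-wp {Q} k (trans (same 2) k≡) λ {ρ″} {G″} lim≡ bot≡ popped → leave {ρ″} {G″}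
        (trans lim≡ top′) bot≡
        (λ (q , k<q , q<n , q≢ , free) → <⇒≱ (s≤s k<q) (≤-trans (upper last q<n q≢ free)
          (subst (ρ′ mᵛ ≤_) top′ (bit-<-no {ρ′ topᵛ} (n<1⇒n≡0 (bit-<-yes {_} {1} e)))))) popped)
      where
      top′ : ρ′ topᵛ ≡ suc k
      top′ = trans (same 6) top≡
      viable : suc k < ρ′ mᵛ → _ → Viable f (G used) k
      viable l< (inj₁ m≡0) = ⊥-elim (<⇒≱ l< (subst (_≤ suc k) (sym m≡0) z≤n))
      viable l< (inj₂ (j , m≡ , j<n , j≢ , free)) = j , ≤-pred (subst (suc k <_) m≡ l<) , j<n , j≢ , free

  -- The word as loaded so far. The value σ is no symbol, so unread positions mark no leaf.
  partial : (ℕ → ℕ) → ℕ → ℕ → ℕ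
  partial f zero    = λ _ → σ
  partial f (suc p) = update (partial f p) p (f p)

  partial-≥ : ∀ f {p q} → p ≤ q → partial f p q ≡ σ
  partial-≥ f {zero}  p≤q = refl
  partial-≥ f {suc p} p<q = trans (update-≢ (partial f p) (f p) (λ e → <⇒≢ p<q (sym e)))
    (partial-≥ f (<⇒≤ p<q))

  partial-< : ∀ f {p q} → q < p → partial f p q ≡ f q
  partial-< f {suc p} {q} q<1+p with m≤n⇒m<n∨m≡n (≤-pred q<1+p)
  ... | inj₁ q<p  = trans (update-≢ (partial f p) (f p) (<⇒≢ q<p)) (partial-< f q<p)
  ... | inj₂ refl = update-≡ (partial f p) p (f p)

  -- A row of zeros is already the correct tree of a symbol without occurrences. Zero memory
  -- therefore replaces an initialisation of σ trees, and loading costs n leaf updates.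
  loadWord-wp : ∀ {Q ρ G f} → ρ pᵛ ≡ 0 → (∀ {p} → p < n → f p < σ) →
    (∀ {p} → p < n → G inp 0 (σ + 2 + p) ≡ f p) → (∀ x y → G tree x y ≡ 0) →
    (∀ {ρ′ G′} → (∀ r → ρ′ (8 + r) ≡ ρ (8 + r)) → (∀ x y → G′ used x y ≡ G used x y) →
      (∀ x y → G′ ptr x y ≡ G ptr x y) → Stored f G′ → Q ρ′ G′) →
    wp loadWord Q ρ G
  loadWord-wp {Q} {ρ} {G} {f} p≡0 f<σ input zeros post =
    wpLoop-intro {Q = Q} Inv done (λ {ρ′} {G′} → end {ρ′} {G′}) (λ {k} {ρ′} {G′} → body {k} {ρ′} {G′}) n
      (0 , p≡0 , cong (λ p → bit (p <ᵇ n)) p≡0 , refl , (λ _ → refl) , (λ _ _ _ _ _ → refl) , (λ ()) ,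
        empty)
    where
    Inv : ℕ → Post
    Inv k ρ′ G′ = ∃[ p ] (ρ′ pᵛ ≡ p × ρ′ yᵛ ≡ bit (p <ᵇ n) × p + k ≡ n × (∀ r → ρ′ (8 + r) ≡ ρ (8 + r)) ×
      (∀ t → t ≢ tree → t ≢ word → ∀ x y → G′ t x y ≡ G t x y) ×
      (∀ {q} → q < p → G′ word q q ≡ f q) × (∀ {b} → b < σ → Tree (G′ tree b) (mark (partial f p) b)))
    empty : ∀ {b} → b < σ → Tree (G tree b) (mark (partial f 0) b)
    empty {b} b<σ = record
      { leaf = λ {p} _ → trans (zeros b _) (sym (mark-≢ {partial f 0} {b} {p} (λ e → <⇒≢ b<σ (sym e))))
      ; node = λ _ _ _ → trans (zeros b _) (sym (cong₂ _⊔_ (zeros b _) (zeros b _))) }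
    end : ∀ {ρ′ G′} → Inv 0 ρ′ G′ → ρ′ yᵛ ≡ 0
    end (p , _ , y≡ , e , _) = trans y≡ (bit-range (≤-reflexive (trans (sym e) (+-identityʳ p))))
    done : ∀ {k ρ′ G′} → Inv k ρ′ G′ → ρ′ yᵛ ≡ 0 → Q ρ′ G′
    done {k} {ρ′} {G′} (p , _ , y≡ , e , same , oth , wds , trs) y≡0 =
      post same (oth used (λ ()) (λ ())) (oth ptr (λ ()) (λ ())) record
      { small   = f<σ
      ; letters = λ q<n → wds (<-≤-trans q<n n≤p)
      ; trees   = λ {b} b<σ → tree-cong (λ _ → refl)
          (λ {q} q<n → cong (λ z → if z ≡ᵇ b then suc q else 0) (partial-< f (<-≤-trans q<n n≤p)))
            (trs b<σ) }
      where
      n≤p : n ≤ p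
      n≤p = bit-<-no (trans (sym y≡) y≡0)
    body : ∀ {k ρ′ G′ R} → Inv (suc k) ρ′ G′ → ρ′ yᵛ ≢ 0 → (∀ {ρ″ G″} → Inv k ρ″ G″ → R ρ″ G″) →
           wp loadLetter R ρ′ G′
    body {k} {ρ′} {G′} {R} (p , refl , y≡ , e , same , oth , wds , trs) y≢0 cont =
      ≤-trans (≤-reflexive (+-comm (σ + 2) p)) (+-monoˡ-≤ (σ + 2) (≤-trans (<⇒≤ p<n) (m≤m+n n n))) ,
      p+1≤B (<⇒≤ p<n) ,
      setLeaf-wp {ρ = ρ₁} {G₁} b p (suc p) refl refl (+-comm p 1) p<n (trs b<σ) λ {ρ₂} {G₂} F t →
      subst (λ z → z + 1 ≤ B) (sym (vars F 2)) (p+1≤B (<⇒≤ p<n)) ,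
      cont (suc p , next≡ F , cong (λ z → bit (z <ᵇ n)) (next≡ F) ,
        trans (sym (+-suc p k)) e , (λ r → trans (vars F (4 + r)) (same r)) ,
        (λ t t≢ t≢′ x y → trans (others F t t≢ x y) (oth₁ t t≢ t≢′ x y)) ,
        (λ q<p → trans (others F word (λ ()) _ _) (wds₁ q<p)) , (λ {b′} b′<σ → trees′ F t b′<σ (b′ ≟ b)))
      where
      b : ℕ
      b = G′ inp 0 (σ + 2 + p)
      b≡ : b ≡ f p
      p<n : p < n
      p<n = bit-<-yes (λ z → y≢0 (trans y≡ z))
      b≡ = trans (oth inp (λ ()) (λ ()) _ _) (input p<n)
      b<σ : b < σ
      b<σ = subst (_< σ) (sym b≡) (f<σ p<n)
      ρ₁ : Vars
      ρ₁ = update (update (update ρ′ iᵛ (σ + 2 + p)) bᵛ b) vᵛ (p + 1)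
      G₁ : Mem
      G₁ = write G′ word p p b
      oth₁ : ∀ t → t ≢ tree → t ≢ word → ∀ x y → G₁ t x y ≡ G t x y
      oth₁ inp  t≢ t≢′ = oth inp t≢ t≢′
      oth₁ word t≢ t≢′ = ⊥-elim (t≢′ refl)
      oth₁ tree t≢ t≢′ = ⊥-elim (t≢ refl)
      oth₁ used t≢ t≢′ = oth used t≢ t≢′
      oth₁ ptr  t≢ t≢′ = oth ptr t≢ t≢′
      wds₁ : ∀ {q} → q < suc p → G₁ word q q ≡ f q
      wds₁ {q} q<1+p with m≤n⇒m<n∨m≡n (≤-pred q<1+p)
      ... | inj₁ q<p  = trans (write-≢ˣ G′ word b (<⇒≢ q<p)) (wds q<p)
      ... | inj₂ refl = trans (write-≡ G′ word {p} {p} b refl refl) b≡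
      module _ {ρ₂ G₂} (F : TreeFrame b ρ₁ G₁ ρ₂ G₂) where
        next≡ : ρ₂ pᵛ + 1 ≡ suc p
        next≡ = trans (cong (_+ 1) (vars F 2)) (+-comm p 1)
        trees′ : Tree (G₂ tree b) (update (mark (partial f p) b) p (suc p)) →
                 ∀ {b′} → b′ < σ → Dec (b′ ≡ b) → Tree (G₂ tree b′) (mark (partial f (suc p)) b′)
        trees′ t b′<σ (yes refl) = tree-cong (λ _ → refl) (λ {q} _ → go q) t
          where
          go : ∀ q → update (mark (partial f p) b) p (suc p) q ≡ mark (partial f (suc p)) b q
          go q with q ≟ p
          ... | yes refl = trans (update-≡ (mark (partial f p) b) p (suc p))
                             (sym (mark-≡ {partial f (suc p)}
                               (trans (update-≡ (partial f p) p (f p)) (sym b≡))))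
          ... | no q≢p   = trans (update-≢ (mark (partial f p) b) (suc p) q≢p)
                             (cong (λ z → if z ≡ᵇ b then suc q else 0)
                               (sym (update-≢ (partial f p) (f p) q≢p)))
        trees′ t {b′} b′<σ (no b′≢b) = tree-cong (rows F b′≢b) (λ {q} _ → go q) (trs b′<σ)
          where
          go : ∀ q → mark (partial f p) b′ q ≡ mark (partial f (suc p)) b′ q
          go q with q ≟ p
          ... | yes refl = trans (mark-≢ {partial f p}
            (λ z → <⇒≢ b′<σ (sym (trans (sym (partial-≥ f {p} ≤-refl)) z))))
                             (sym (mark-≢ {partial f (suc p)}
                               (λ z → b′≢b (sym (trans b≡ (trans
                               (sym (update-≡ (partial f p) p (f p))) z))))))
          ... | no q≢p   = cong (λ z → if z ≡ᵇ b′ then suc q else 0)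
            (sym (update-≢ (partial f p) (f p) q≢p))

  -- The set of words still to be visited

  Todo : (ℕ → Set) → Word σ n → (ℕ → ℕ → ℕ) → Word σ n → Set
  Todo V w U u = ∃[ k ] (V k × k < n × AgreeBelow k u w × letter u k ≢ letter w k × U k (letter u k) ≡ 0)

  -- Between a move and the next push the levels from `lim` on are fresh but not yet on the stack.
  -- Those inside the constant suffix are included, although they contribute no word of G(P).
  Pending : List ℕ → ℕ → ℕ → Set
  Pending L lim k = k ∈ L ⊎ lim ≤ k

  todo-≢ : ∀ {V w U u} → Todo V w U u → u ≢ w
  todo-≢ (k , _ , _ , _ , differ , _) refl = differ refl

  module _ (P : Vec ℕ σ) where

    record Config (w : Word σ n) (L : List ℕ) (lim top : ℕ) (G : Mem) : Set where
      field
        parikh   : HasParikh P w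
        stored   : Stored (letter w) G
        stack    : Stack G lim top L
        lim≤n    : lim ≤ n
        viable   : ∀ {k} → k ∈ L → Viable (letter w) (G used) k
        -- This covers k = n, the row of zeros with which `push` searches.
        unused   : ∀ {k} → k ∉ L → ∀ {b} → b < σ → G used k b ≡ 0
        unlinked : ∀ {k} → k ∉ L → G ptr k k ≡ 0

    open Config public

    private
      n-1<n : n ∸ 1 < n
      n-1<n = ∸-monoʳ-< (s≤s z≤n) (≤-trans (s≤s z≤n) 2≤n)

    -- m separates the levels whose suffix is constant from the others.
    module _ {w : Word σ n} {m} {row : ℕ → ℕ} (zero-row : ∀ {b} → b < σ → row b ≡ 0)
             (last : Last (letter w) row (letter w (n ∸ 1)) m) where

      -- If the letter of `w` at `k` is not its last letter, `k` itself lies below `m`. Otherwise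
      -- the letter of `u` at `k` occurs in `w` at some q > k and is not the last letter of `w`, so
      -- k < q < m.
      difference-below : ∀ u → HasParikh P u → HasParikh P w → ∀ {k} → k < n → AgreeBelow k u w →
                         letter u k ≢ letter w k → k < m
      difference-below u pu pw {k} k<n agree differ with parikh-later P u w pu pw k<n agree differ
        | letter w k ≟ letter w (n ∸ 1)
      ... | q , k<q , q<n , e | no k≢  = upper last k<n k≢ (zero-row (letter-< w k<n))
      ... | q , k<q , q<n , e | yes k≡ = <-trans k<q
        (upper last q<n (λ z → differ (trans (sym e) (trans z (sym k≡))))
                                                        (zero-row (letter-< w q<n)))

      -- The witness is position m - 1 if `k` carries the last letter of `w`, and position n - 1 if
      -- it does not.
      viable-below : ∀ {U k} → k < m → (∀ {b} → b < σ → U k b ≡ 0) → Viable (letter w) U k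
      viable-below {U} {k} k<m fresh with found last
      ... | inj₁ m≡0 = ⊥-elim (<⇒≱ k<m (subst (_≤ k) (sym m≡0) z≤n))
      ... | inj₂ (j , refl , j<n , j≢ , _) with letter w k ≟ letter w (n ∸ 1)
      ...   | yes k≡ = j , ≤∧≢⇒< (≤-pred k<m) (λ { refl → j≢ k≡ }) , j<n , (λ z → j≢ (trans z k≡)) ,
        fresh (letter-< w j<n)
      ...   | no k≢  = n ∸ 1 , ≤∧≢⇒<
        (≤-trans (≤-pred k<m) (≤-pred (subst (j <_) (sym (m+[n∸m]≡n (≤-trans (s≤s z≤n) 2≤n))) j<n)))
                                      (λ { refl → k≢ refl }) ,
                       n-1<n , (λ z → k≢ (sym z)) , fresh (letter-< w n-1<n)

      last≤n : m ≤ n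
      last≤n with found last
      ... | inj₁ refl = z≤n
      ... | inj₂ (j , refl , j<n , _) = j<n

    -- Narrowing the levels from `lim` on to those below `m` loses nothing, because by
    -- `difference-below` no word of G(P) first differs from `w` at `m` or later. Read as a pointer,
    -- `m` denotes level m - 1, the deepest one to be pushed.
    push-wp : ∀ {Q ρ G w L lim bot} → ρ limᵛ ≡ lim → ρ botᵛ ≡ bot → Config w L lim bot G →
      (∀ {ρ′ G′ L′} → Config w L′ n (ρ′ topᵛ) G′ →
        (∀ u → HasParikh P u → Todo (Pending L lim) w (G used) u → Todo (_∈ L′) w (G′ used) u) →
        (∀ u → Todo (_∈ L′) w (G′ used) u → Todo (Pending L lim) w (G used) u) → Q ρ′ G′) →
      wp push Q ρ G
    push-wp {Q} {ρ} {G} {w} {L} refl refl C post =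
      search-wp n (letter w (n ∸ 1)) refl (letters (stored C) n-1<n) (stored C) finish
      where
      lim bot : ℕ
      lim = ρ limᵛ
      bot = ρ botᵛ
      n∉L : n ∉ L
      n∉L i = <⇒≱ (stack-∈ (stack C) i) (lim≤n C)
      ρ₁ : Vars
      ρ₁ = update (update (update ρ kᵛ n) pᵛ (n ∸ 1)) cᵛ (G word (n ∸ 1) (n ∸ 1))
      finish : ∀ {ρ′} → (∀ r → ρ′ (6 + r) ≡ ρ₁ (6 + r)) →
        Last (letter w) (G used n) (letter w (n ∸ 1)) (ρ′ mᵛ) →
        wp (topᵛ ≔ mov (var botᵛ) ⨾ yᵛ ≔ less (var limᵛ) (var mᵛ) ⨾
            when (var yᵛ) (vᵛ ≔ plus (var botᵛ) #1 ⨾ put ptr (var limᵛ) (var limᵛ)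
              (var vᵛ) ⨾ topᵛ ≔ mov (var mᵛ))) Q ρ′ G
      finish {ρ′} same last =
        (λ e → post (subst (λ p → Config w L n p G) (sym bot≡) C₀)
          (λ u pu (k , pend , k<n , agree , differ , free) → k ,
            old (bit-<-no {ρ′ limᵛ} e) pend (below u pu k<n agree differ) , k<n , agree , differ , free)
          (λ u (k , i , rest) → k , inj₁ i , rest)) ,
        (λ e → p+1≤B (subst (_≤ n) (sym bot≡) (≤-trans (stack-ptr (stack C)) (lim≤n C))) ,
          grow (subst (_< m) lim≡ (bit-<-yes {ρ′ limᵛ} e)))
        where
        m : ℕ
        m = ρ′ mᵛ
        bot≡ : ρ′ botᵛ ≡ bot
        bot≡ = same 7
        lim≡ : ρ′ limᵛ ≡ lim
        lim≡ = same 8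
        zero-row : ∀ {b} → b < σ → G used n b ≡ 0
        zero-row = unused C n∉L
        below : ∀ u → HasParikh P u → ∀ {k} → k < n → AgreeBelow k u w → letter u k ≢ letter w k → k < m
        below u pu = difference-below {w} zero-row last u pu (parikh C)
        C₀ : Config w L n bot G
        C₀ = record { parikh = parikh C ; stored = stored C ; stack = stack-≤ (lim≤n C) (stack C)
          ; lim≤n = ≤-refl
                    ; viable = viable C ; unused = unused C ; unlinked = unlinked C }
        old : m ≤ ρ′ limᵛ → ∀ {k} → Pending L lim k → k < m → k ∈ L
        old m≤ (inj₁ i)   k<m = i
        old m≤ (inj₂ le)  k<m = ⊥-elim (<⇒≱ (<-≤-trans k<m (subst (m ≤_) lim≡ m≤)) le)
        ρ₂ : Vars
        ρ₂ = update (update (update (update ρ′ topᵛ (ρ′ botᵛ)) yᵛ (bit (ρ′ limᵛ <ᵇ m))) vᵛ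
          (ρ′ botᵛ + 1)) topᵛ m
        G₂ : Mem
        G₂ = write G ptr (ρ′ limᵛ) (ρ′ limᵛ) (ρ′ botᵛ + 1)
        grow : lim < m → Q ρ₂ G₂
        grow lim<m = post {ρ₂} {G₂} {levels (suc d) lim L} (record
            { parikh = parikh C
            ; stored = record { small = small (stored C) ; letters = letters (stored C)
              ; trees = trees (stored C) }
            ; stack = subst (λ p → Stack G₂ n p (levels (suc d) lim L)) d≡
              (stack-≤ (subst (_≤ n) (sym d≡) (last≤n {w} zero-row last))
                (stack-levels d (stack-cong (λ k<lim → write-≢ˣ G ptr _ (λ e → <⇒≢ k<lim (trans e lim≡)))
                  (stack C))
                  (trans (write-≡ G ptr {ρ′ limᵛ} {ρ′ limᵛ} _ (sym lim≡) (sym lim≡))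
                    (trans (cong (_+ 1) bot≡) (+-comm bot 1)))
                  (λ lim<k → trans (write-≢ˣ G ptr _ (λ e → <⇒≢ lim<k (sym (trans e lim≡))))
                               (unlinked C (λ i → <-asym lim<k (stack-∈ (stack C) i))))))
            ; lim≤n = ≤-refl
            ; viable = λ i → viable′ (∈-levels⁻ (suc d) i)
            ; unused = λ k∉ → unused C (λ i → k∉ (∈-levels⁺ (suc d) (inj₁ i)))
            ; unlinked = unlinked′ })
          (λ u pu (k , pend , k<n , agree , differ , free) →
            k , ∈-levels⁺ (suc d) (level pend (subst (k <_) (sym d≡) (below u pu k<n agree differ))) ,
              k<n , agree , differ , free)
          (λ u (k , i , rest) → k , pend (∈-levels⁻ (suc d) i) , rest)
          where
          d : ℕ
          d = m ∸ suc lim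
          d≡ : suc d + lim ≡ m
          d≡ = trans (sym (+-suc d lim)) (m∸n+n≡m lim<m)
          level : ∀ {k} → Pending L lim k → k < suc d + lim → k ∈ L ⊎ (lim ≤ k × k < suc d + lim)
          level (inj₁ i)  k< = inj₁ i
          level (inj₂ le) k< = inj₂ (le , k<)
          pend : ∀ {k} → k ∈ L ⊎ (lim ≤ k × k < suc d + lim) → Pending L lim k
          pend (inj₁ i)        = inj₁ i
          pend (inj₂ (le , _)) = inj₂ le
          viable′ : ∀ {k} → k ∈ L ⊎ (lim ≤ k × k < suc d + lim) → Viable (letter w) (G used) k
          viable′ (inj₁ i)         = viable C i
          viable′ (inj₂ (le , k<)) = viable-below {w} zero-row last {G used} (subst (_ <_) d≡ k<)
            (unused C (λ i → <⇒≱ (stack-∈ (stack C) i) le))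
          unlinked′ : ∀ {k} → k ∉ levels (suc d) lim L → G₂ ptr k k ≡ 0
          unlinked′ {k} k∉ = trans (write-≢ˣ G ptr _
            (λ e → k∉ (subst (_∈ levels (suc d) lim L) (sym (trans e lim≡))
              (∈-levels⁺ (suc d) (inj₂ (≤-refl , s≤s (m≤n+m lim d)))))))
            (unlinked C (λ i → k∉ (∈-levels⁺ (suc d) (inj₁ i))))

    -- The memory after the swap enters through its flags only, so these facts serve both the
    -- verification of `move` and the main loop, which instantiates `G₁` with the bare flag write.
    module Step {w : Word σ n} {k j L G} (C : Config w (k ∷ L) n (suc k) G) (k<n : k < n) (j<n : j < n)
      (k<j : k < j)
                (new : letter w j ≢ letter w k) (free : G used k (letter w j) ≡ 0)
                {G₁ : Mem} (flagged : ∀ x y → G₁ used x y ≡ write G used k (letter w k) 1 used x y) where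

      w′ : Word σ n
      w′ = w ∘ (fromℕ< k<n , fromℕ< j<n)

      tail : Stack G k (follow (G ptr k k) k) L
      tail with stack C
      ... | cons _ s = s

      k≢j : k ≢ j
      k≢j = <⇒≢ k<j

      at-k : letter w′ k ≡ letter w j
      at-k = trans (letter-swap w k<n j<n k) (swapped-left (letter w) k≢j)

      at-j : letter w′ j ≡ letter w k
      at-j = trans (letter-swap w k<n j<n j) (swapped-right (letter w) k j)

      at-other : ∀ {q} → q ≢ k → q ≢ j → letter w′ q ≡ letter w q
      at-other {q} q≢k q≢j = trans (letter-swap w k<n j<n q) (swapped-other (letter w) q≢k q≢j)

      at-below : ∀ {q} → q < k → letter w′ q ≡ letter w q
      at-below q<k = at-other (<⇒≢ q<k) (<⇒≢ (<-trans q<k k<j))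

      isSwap : IsSwap w (fromℕ< k<n , fromℕ< j<n)
      isSwap = (λ e → k≢j (trans (sym (toℕ-fromℕ< k<n)) (trans (cong toℕ e) (toℕ-fromℕ< j<n)))) ,
               (λ e → new (sym (trans (sym (letter-fromℕ< w k<n))
                 (trans (cong toℕ e) (letter-fromℕ< w j<n)))))

      parikh′ : HasParikh P w′
      parikh′ = swap-parikh P w (parikh C) (proj₁ isSwap)

      row≢ : ∀ {x} → x ≢ k → ∀ y → G₁ used x y ≡ G used x y
      row≢ x≢k y = trans (flagged _ y) (write-≢ˣ G used 1 x≢k)

      row-new : ∀ {y} → y ≢ letter w k → G₁ used k y ≡ G used k y
      row-new y≢ = trans (flagged k _) (write-≢ʸ G used 1 y≢)

      row-old : G₁ used k (letter w k) ≡ 1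
      row-old = trans (flagged k _) (write-≡ G used {k} {letter w k} 1 refl refl)

      todo-w′ : Todo (_∈ k ∷ L) w (G used) w′
      todo-w′ = k , here refl , k<n , (λ p → at-below) , (λ e → new (trans (sym at-k) e)) ,
                trans (cong (G used k) at-k) free

      idle-above : ∀ {l} → k < l → ∀ {b} → b < σ → G used l b ≡ 0
      idle-above k<l = unused C λ where
        (here refl) → <-irrefl refl k<l
        (there i)   → <-asym k<l (stack-∈ tail i)

      module _ (V : ℕ → Set) (U′ : ℕ → ℕ → ℕ) (same : ∀ {l} → l ≢ k → ∀ y → U′ l y ≡ G used l y) where

        -- A first difference below `k` persists, since `w` and `w′` agree there. If `u` has the new
        -- letter at `k`, then `u` is `w′` or first differs from it at a fresh level beyond `k`. If
        -- `u` has yet another untried letter at `k`, the outcome depends on whether level `k`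
        -- survives; this case is left to `stay`.
        forward : (∀ {l} → l ∈ L → V l) → (∀ {l} → k < l → V l) → ∀ u →
          (AgreeBelow k u w′ → letter u k ≢ letter w′ k → G₁ used k (letter u k) ≡ 0 → Todo V w′ U′ u) →
          Todo (_∈ k ∷ L) w (G used) u → u ≡ w′ ⊎ Todo V w′ U′ u
        forward low high u stay (l , there i , l<n , agree , differ , fr) = inj₂
          (l , low i , l<n , (λ p p<l → trans (agree p p<l) (sym (at-below (<-trans p<l l<k)))) ,
           (λ e → differ (trans e (at-below l<k))) , trans (same (<⇒≢ l<k) _) fr)
          where
          l<k : l < k
          l<k = stack-∈ tail i
        forward low high u stay (_ , here refl , _ , agree , differ , fr) =
          resolve (letter u k ≟ letter w′ k)
          where
          agree′ : AgreeBelow k u w′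
          agree′ p p<k = trans (agree p p<k) (sym (at-below p<k))
          resolve : Dec (letter u k ≡ letter w′ k) → u ≡ w′ ⊎ Todo V w′ U′ u
          resolve (no differ′) = inj₂ (stay agree′ differ′ (trans (row-new differ) fr))
          resolve (yes eq-k) with firstDifference u w′
          ... | inj₁ u≡w′ = inj₁ u≡w′
          ... | inj₂ (l , l<n , agree″ , differ″) = inj₂ (l , high k<l , l<n , agree″ , differ″ ,
                trans (same (λ e → <⇒≢ k<l (sym e)) _) (idle-above k<l (letter-< u l<n)))
            where
            k<l : k < l
            k<l with <-cmp l k
            ... | tri< l<k _ _  = ⊥-elim (differ″ (agree′ l l<k))
            ... | tri≈ _ refl _ = ⊥-elim (differ″ eq-k)
            ... | tri> _ _ k<l′ = k<l′

        -- No visited word comes back. A word that first differs from `w′` at `k` cannot have the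
        -- old letter there, which is now flagged. One that first differs beyond `k` agrees with
        -- `w′` at `k`, so it differs from `w` there in a letter that was untried.
        backward : (∀ {l} → V l → l ∈ L ⊎ (l ≡ k × (∀ y → U′ k y ≡ G₁ used k y)) ⊎ k < l) →
          ∀ u → Todo V w′ U′ u → Todo (_∈ k ∷ L) w (G used) u
        backward levels u (l , v , l<n , agree , differ , fr) with levels v
        ... | inj₁ i = l , there i , l<n , (λ p p<l → trans (agree p p<l) (at-below (<-trans p<l l<k))) ,
                (λ e → differ (trans e (sym (at-below l<k)))) , trans (sym (same (<⇒≢ l<k) _)) fr
          where
          l<k : l < k
          l<k = stack-∈ tail i
        ... | inj₂ (inj₁ (refl , row)) = k , here refl ,
          k<n , (λ p p<k → trans (agree p p<k) (at-below p<k)) , u≢ ,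
                trans (sym (row-new u≢)) (trans (sym (row _)) fr)
          where
          u≢ : letter u k ≢ letter w k
          u≢ e = 1+n≢0 (trans (sym row-old) (trans (cong (G₁ used k) (sym e)) (trans (sym (row _)) fr)))
        ... | inj₂ (inj₂ k<l) = k , here refl ,
          k<n , (λ p p<k → trans (agree p (<-trans p<k k<l)) (at-below p<k)) ,
                (λ e → new (trans (sym at-k) (trans (sym (agree k k<l)) e))) ,
                trans (cong (G used k) (trans (agree k k<l) at-k)) free

      -- Swapping two positions above l only permutes the letters above l.
      viable-low : ∀ {U′ l} → l < k → (∀ y → U′ l y ≡ G used l y) → Viable (letter w) (G used) l →
        Viable (letter w′) U′ l
      viable-low {U′} {l} l<k same (q , l<q , q<n , q≢ , fr) with q ≟ k | q ≟ j
      ... | yes refl | _        = j , <-trans l<k k<j ,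
        j<n , (λ e → q≢ (trans (sym at-j) (trans e (at-below l<k)))) ,
                                  trans (same _) (trans (cong (G used l) at-j) fr)
      ... | no _     | yes refl = k , l<k , k<n , (λ e → q≢ (trans (sym at-k) (trans e (at-below l<k)))) ,
                                  trans (same _) (trans (cong (G used l) at-k) fr)
      ... | no q≢k   | no q≢j   = q , l<q ,
        q<n , (λ e → q≢ (trans (sym (at-other q≢k q≢j)) (trans e (at-below l<k)))) ,
                                  trans (same _) (trans (cong (G used l) (at-other q≢k q≢j)) fr)

    move-wp : ∀ {Q ρ G w k L j} (C : Config w (k ∷ L) n (suc k) G) (k<n : k < n) (j<n : j < n) →
      Chosen (letter w) k j ρ G →
      let w′ = w ∘ (fromℕ< k<n , fromℕ< j<n) in
      (∀ {ρ′ G′ L′} → Config w′ L′ (ρ′ limᵛ) (ρ′ botᵛ) G′ →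
        (∀ u → HasParikh P u → Todo (_∈ k ∷ L) w (G used) u → u ≡ w′ ⊎
          Todo (Pending L′ (ρ′ limᵛ)) w′ (G′ used) u) →
        (∀ u → Todo (Pending L′ (ρ′ limᵛ)) w′ (G′ used) u → Todo (_∈ k ∷ L) w (G used) u) → Q ρ′ G′) →
      wp move Q ρ G
    move-wp {Q} {ρ} {G} {w} {k} {L} {j} C k<n j<n ch post = exchange-wp (stored C) ch finish
      where
      open Chosen ch using (k<j; new; free)
      finish : ∀ {ρ₁ G₁} → Exchanged (letter w) k j G ρ₁ G₁ → wp retire Q ρ₁ G₁
      finish {ρ₁} {G₁} ex = retire-wp {Q} {f = letter w′} k (Exchanged.k≡ ex)
        (trans (Exchanged.s≡ ex) (sym at-k))
          (Exchanged.top≡ ex) k<n stored′ (λ {ρ′} → stay {ρ′}) (λ {ρ′} {G′} → leave {ρ′} {G′})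
        where
        open Step C k<n j<n k<j new free {G₁} (Exchanged.flagged ex)
        stored′ : Stored (letter w′) G₁
        stored′ = stored-cong (λ {q} _ → sym (letter-swap w k<n j<n q)) (Exchanged.stored ex)
        stay : ∀ {ρ′} → ρ′ limᵛ ≡ suc k → ρ′ botᵛ ≡ suc k → Viable (letter w′) (G₁ used) k → Q ρ′ G₁
        stay {ρ′} lim≡ bot≡ via = post {ρ′} {G₁} {k ∷ L}
          (subst₂ (λ a b → Config w′ (k ∷ L) a b G₁) (sym lim≡) (sym bot≡) record
            { parikh = parikh′ ; stored = stored′ ; lim≤n = k<n
            ; stack = stack-cong (λ _ → Exchanged.ptrs ex _ _) (cons ≤-refl tail)
            ; viable = viable′
            ; unused = λ k∉ b<σ → trans (row≢ (λ e → k∉ (here e)) _) (unused C k∉ b<σ)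
            ; unlinked = λ k∉ → trans (Exchanged.ptrs ex _ _) (unlinked C k∉) })
          (λ u pu → forward (Pending (k ∷ L) (ρ′ limᵛ)) (G₁ used) row≢ (λ i → inj₁ (there i))
            (λ k<l → inj₂ (subst (_≤ _) (sym lim≡) k<l)) u
            (λ agree differ fr → k , inj₁ (here refl) , k<n , agree , differ , fr))
          (backward (Pending (k ∷ L) (ρ′ limᵛ)) (G₁ used) row≢ λ where
            (inj₁ (here e))  → inj₂ (inj₁ (e , λ _ → refl))
            (inj₁ (there i)) → inj₁ i
            (inj₂ le)        → inj₂ (inj₂ (subst (_≤ _) lim≡ le)))
          where
          viable′ : ∀ {l} → l ∈ k ∷ L → Viable (letter w′) (G₁ used) l
          viable′ (here refl) = via
          viable′ (there i)   = viable-low {G₁ used} l<k (row≢ (<⇒≢ l<k)) (viable C (there i))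
            where l<k = stack-∈ tail i
        leave : ∀ {ρ′ G′} → ρ′ limᵛ ≡ suc k → ρ′ botᵛ ≡ follow (G₁ ptr k k) k →
          ¬ Viable (letter w′) (G₁ used) k →
                Popped k G₁ G′ → Q ρ′ G′
        leave {ρ′} {G′} lim≡ bot≡ none popped =
          post {ρ′} {G′} {L} (subst₂ (λ a b → Config w′ L a b G′) (sym lim≡) (sym bot≡′) record
            { parikh = parikh′ ; stored = stored-popped popped stored′ ; lim≤n = k<n
            ; stack = stack-≤ (n≤1+n k) (stack-cong
              (λ l<k → trans (ptr≢ (<⇒≢ l<k) _) (Exchanged.ptrs ex _ _)) tail)
            ; viable = λ i → let l<k = stack-∈ tail i in viable-low {G′ used} l<k (same (<⇒≢ l<k)) (viable C (there i))
            ; unused = unused′ ; unlinked = unlinked′ })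
          (λ u pu → forward (Pending L (ρ′ limᵛ)) (G′ used) same inj₁
            (λ k<l → inj₂ (subst (_≤ _) (sym lim≡) k<l)) u
            (λ agree differ fr → ⊥-elim (stuck u pu agree differ fr)))
          (backward (Pending L (ρ′ limᵛ)) (G′ used) same λ where
            (inj₁ i)  → inj₁ i
            (inj₂ le) → inj₂ (inj₂ (subst (_≤ _) lim≡ le)))
          where
          open Popped popped
          bot≡′ : ρ′ botᵛ ≡ follow (G ptr k k) k
          bot≡′ = trans bot≡ (cong (λ d → follow d k) (Exchanged.ptrs ex k k))
          same : ∀ {l} → l ≢ k → ∀ y → G′ used l y ≡ G used l y
          same l≢k y = trans (used≢ l≢k y) (row≢ l≢k y)
          -- An untried letter of `u` at `k` would occur in `w′` further right and make level `k`
          -- viable, so popping the level gives up no word of G(P).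
          stuck : ∀ u → HasParikh P u → AgreeBelow k u w′ → letter u k ≢ letter w′ k →
            G₁ used k (letter u k) ≡ 0 → ⊥
          stuck u pu agree differ fr with parikh-later P u w′ pu parikh′ k<n agree differ
          ... | q , k<q , q<n , e = none (q , k<q , q<n , (λ z → differ (trans (sym e) z)) ,
            trans (cong (G₁ used k) e) fr)
          unused′ : ∀ {l} → l ∉ L → ∀ {b} → b < σ → G′ used l b ≡ 0
          unused′ {l} l∉ b<σ with l ≟ k
          ... | yes refl = used₀ b<σ
          ... | no l≢k   = trans (same l≢k _) (unused C (λ { (here e) → l≢k e ; (there i) → l∉ i }) b<σ)
          unlinked′ : ∀ {l} → l ∉ L → G′ ptr l l ≡ 0
          unlinked′ {l} l∉ with l ≟ k
          ... | yes refl = ptr₀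
          ... | no l≢k   = trans (ptr≢ l≢k l) (trans (Exchanged.ptrs ex l l) (unlinked C (λ { (here e) → l≢k e ; (there i) → l∉ i })))

-- The program

-- Registers start at 0, so the first load reads cell 0, which is n; register 1 serves both as the
-- constant 1 and as the address of σ. If n < 2, the jump leaves for the final `halt`. The length of
-- this block is the 10 that recurs as a code address and as a number of steps.
setup : ℕ → Program
setup end =
  load 2 0 ∷ const 1 1 ∷ op lt 6 1 2 ∷ jumpZ 6 end ∷
  load 3 1 ∷ op add 4 3 1 ∷ op add 4 4 1 ∷
  op add 5 2 2 ∷ op add 5 5 4 ∷ op add 5 5 1 ∷ []

-- Control flow: `a` once, then a loop of `b`, exit test, `c`, output, `d` and jump back. All later
-- arguments depend on the program only through these facts.
record Layout (a b c d : Cmd) (prog : Program) : Set where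
  field
    pc₂ pc₃ pc₄ pc₅ end : ℕ
    at-setup : At prog 0 (setup end)
    at-a     : At prog 10 (compile a 10)
    a-end    : length (compile a 10) + 10 ≡ pc₂
    at-b     : At prog pc₂ (compile b pc₂)
    b-end    : length (compile b pc₂) + pc₂ ≡ pc₃
    at-test  : fetch prog pc₃ ≡ just (jumpZ (register (var topᵛ)) end)
    at-c     : At prog (suc pc₃) (compile c (suc pc₃))
    c-end    : length (compile c (suc pc₃)) + suc pc₃ ≡ pc₄
    at-emit  : fetch prog pc₄ ≡ just (output (register (var kᵛ)) (register (var jᵛ)))
    at-d     : At prog (suc pc₄) (compile d (suc pc₄))
    d-end    : length (compile d (suc pc₄)) + suc pc₄ ≡ pc₅
    at-jump  : fetch prog pc₅ ≡ just (jump pc₂)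
    at-end   : fetch prog end ≡ just halt

assemble : ∀ a b c d → ∃[ prog ] Layout a b c d prog
assemble a b c d = prog , record
  { pc₂ = pc₂ ; pc₃ = pc₃ ; pc₄ = pc₄ ; pc₅ = pc₅ ; end = suc pc₅
  ; at-setup = proj₁ split₁ ; at-a = proj₁ split₂ ; at-b = proj₁ split₃ ; at-test = proj₁ (proj₂ split₃)
  ; at-c = proj₁ split₄ ; at-emit = proj₁ (proj₂ split₄) ; at-d = proj₁ split₅
  ; at-jump = proj₁ (proj₂ split₅) ; at-end = proj₁ (proj₂ (proj₂ split₅))
  ; a-end = refl ; b-end = refl ; c-end = refl ; d-end = refl }
  where
  pc₂ pc₃ pc₄ pc₅ : ℕ
  pc₂ = length (compile a 10) + 10
  pc₃ = length (compile b pc₂) + pc₂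
  pc₄ = length (compile c (suc pc₃)) + suc pc₃
  pc₅ = length (compile d (suc pc₄)) + suc pc₄
  body₁ body₂ body₃ body₄ prog : Program
  body₄ = compile d (suc pc₄) ++ jump pc₂ ∷ halt ∷ []
  body₃ = compile c (suc pc₃) ++ output (register (var kᵛ)) (register (var jᵛ)) ∷ body₄
  body₂ = compile b pc₂ ++ jumpZ (register (var topᵛ)) (suc pc₅) ∷ body₃
  body₁ = compile a 10 ++ body₂
  prog  = setup (suc pc₅) ++ body₁
  split₁ : At prog 0 (setup (suc pc₅)) × At prog 10 body₁
  split₁ = At-++⁻ 0 (setup (suc pc₅)) (subst (λ p → At p 0 prog) (++-identityʳ prog) (At-++⁺ [] prog))
  split₂ : At prog 10 (compile a 10) × At prog pc₂ body₂
  split₂ = At-++⁻ 10 (compile a 10) (proj₂ split₁)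
  split₃ : At prog pc₂ (compile b pc₂) × At prog pc₃ (jumpZ (register (var topᵛ)) (suc pc₅) ∷ body₃)
  split₃ = At-++⁻ pc₂ (compile b pc₂) (proj₂ split₂)
  split₄ : At prog (suc pc₃) (compile c (suc pc₃)) ×
           At prog pc₄ (output (register (var kᵛ)) (register (var jᵛ)) ∷ body₄)
  split₄ = At-++⁻ (suc pc₃) (compile c (suc pc₃)) (proj₂ (proj₂ split₃))
  split₅ : At prog (suc pc₄) (compile d (suc pc₄)) × At prog pc₅ (jump pc₂ ∷ halt ∷ [])
  split₅ = At-++⁻ (suc pc₄) (compile d (suc pc₄)) (proj₂ (proj₂ split₄))

-- Word size and arithmetic of the bounds

n≤2^⌈log₂n⌉ : ∀ n → n ≤ 2 ^ ⌈log₂ n ⌉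
n≤2^⌈log₂n⌉ = <-rec _ go
  where
  go : ∀ n → (∀ {m} → m < n → m ≤ 2 ^ ⌈log₂ m ⌉) → n ≤ 2 ^ ⌈log₂ n ⌉
  go 0 _ = z≤n
  go 1 _ = s≤s z≤n
  go n@(suc (suc n′)) rec = begin
    n                             ≡⟨ ⌊n/2⌋+⌈n/2⌉≡n n ⟨
    ⌊ n /2⌋ + ⌈ n /2⌉             ≤⟨ +-monoˡ-≤ ⌈ n /2⌉ (⌊n/2⌋≤⌈n/2⌉ n) ⟩
    ⌈ n /2⌉ + ⌈ n /2⌉             ≤⟨ +-mono-≤ half≤ half≤ ⟩
    2 ^ l + 2 ^ l                 ≡⟨ cong (2 ^ l +_) (+-identityʳ (2 ^ l)) ⟨
    2 ^ suc l                     ≡⟨ cong (2 ^_) l≡ ⟩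
    2 ^ ⌈log₂ n ⌉                 ∎
    where
    open ≤-Reasoning
    l : ℕ
    l = ⌈log₂ n ⌉ ∸ 1
    half≤ : ⌈ n /2⌉ ≤ 2 ^ l
    half≤ = subst (λ k → ⌈ n /2⌉ ≤ 2 ^ k) (⌈log₂⌈n/2⌉⌉≡⌈log₂n⌉∸1 n) (rec (⌈n/2⌉<n n′))
    l≡ : suc l ≡ ⌈log₂ n ⌉
    l≡ = m+[n∸m]≡n {1} (⌈log₂⌉-mono-≤ {2} {n} (s≤s (s≤s z≤n)))

-- Origin of the factor 6: addresses are below the cube of the radix, and the radix is at most N²,
-- where N is the length of the input.
^6-≤ : ∀ N {W} → 6 * ⌈log₂ N ⌉ ≤ W → N ^ 6 ≤ 2 ^ W
^6-≤ N {W} bits = begin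
  N ^ 6                    ≤⟨ ^-monoˡ-≤ 6 (n≤2^⌈log₂n⌉ N) ⟩
  (2 ^ ⌈log₂ N ⌉) ^ 6      ≡⟨ ^-*-assoc 2 ⌈log₂ N ⌉ 6 ⟩
  2 ^ (⌈log₂ N ⌉ * 6)      ≡⟨ cong (2 ^_) (*-comm ⌈log₂ N ⌉ 6) ⟩
  2 ^ (6 * ⌈log₂ N ⌉)      ≤⟨ ^-monoʳ-≤ 2 bits ⟩
  2 ^ W                    ∎
  where open ≤-Reasoning

size-≤ : ∀ N {W} .⦃ _ : NonZero N ⦄ → 6 * ⌈log₂ N ⌉ ≤ W → N ≤ 2 ^ W
size-≤ N bits = ≤-trans (m≤m*n N (N ^ 5) ⦃ m^n≢0 N 5 ⦄) (^6-≤ N bits)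

cube-≤ : ∀ N {m W} → 6 * ⌈log₂ N ⌉ ≤ W → m ≤ N * N → m * m * m ≤ 2 ^ W
cube-≤ N bits m≤ = ≤-trans (*-mono-≤ (*-mono-≤ m≤ m≤) m≤) (≤-trans (≤-reflexive power) (^6-≤ N bits))
  where
  power : N * N * (N * N) * (N * N) ≡ N ^ 6
  power = trans (cong (λ x → x * x * x) (cong (N *_) (sym (*-identityʳ N))))
    (trans (cong (_* N ^ 2) (sym (^-distribˡ-+-* N 2 2))) (sym (^-distribˡ-+-* N 4 2)))

affine-≤ : ∀ {a b c t} x → a ≤ c → b ≤ c → t ≤ b * x → a + t ≤ c * (1 + x)
affine-≤ {c = c} x a≤c b≤c t≤ =
  ≤-trans (+-mono-≤ a≤c (≤-trans t≤ (*-monoˡ-≤ x b≤c))) (≤-reflexive (sym (*-suc c x)))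

rounds-≤ : ∀ {s t} n x → 1 ≤ x → t ≤ s * x → n * (2 + t) ≤ (2 + s) * (n * x)
rounds-≤ {s} {t} n x 1≤x t≤ = begin
  n * (2 + t)         ≤⟨ *-monoʳ-≤ n (+-mono-≤ (m≤m*n 2 x ⦃ >-nonZero 1≤x ⦄) t≤) ⟩
  n * (2 * x + s * x) ≡⟨ cong (n *_) (*-distribʳ-+ x 2 s) ⟨
  n * ((2 + s) * x)   ≡⟨ x∙yz≈y∙xz *-commutativeSemigroup n (2 + s) x ⟩
  (2 + s) * (n * x)   ∎
  where open ≤-Reasoning

-- The three extra steps of a round are the jump back, the exit test and the output.
sum-≤ : ∀ {d} a b c → a + (b + c) ≤ d → suc a + (b + suc (c + 1)) ≤ 3 + d
sum-≤ {d} a b c le = subst (_≤ 3 + d) (sym (begin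
  suc a + (b + suc (c + 1)) ≡⟨ cong (λ x → suc a + (b + suc x)) (+-comm c 1) ⟩
  suc a + (b + (2 + c))     ≡⟨ cong (suc a +_) (trans (+-suc b (suc c)) (cong suc (+-suc b c))) ⟩
  suc a + (2 + (b + c))     ≡⟨ cong suc (trans (+-suc a (suc (b + c))) (cong suc (+-suc a (b + c)))) ⟩
  3 + (a + (b + c))         ∎)) (+-monoʳ-≤ 3 le)
  where open ≡-Reasoning

m<m³ : ∀ m → 2 ≤ m → m < m * m * m
m<m³ m 2≤m = <-≤-trans (m<m+n m (≤-trans (s≤s z≤n) 2≤m))
  (≤-trans (≤-reflexive (cong (m +_) (sym (+-identityʳ m))))
    (*-monoˡ-≤ m (≤-trans 2≤m (m≤m*n m m ⦃ >-nonZero (≤-trans (s≤s z≤n) 2≤m) ⦄))))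

-- The input in memory

length-input : ∀ {σ n} (P : Vec ℕ σ) (w : Word σ n) → length (input P w) ≡ 2 + (σ + n)
length-input P w = cong (2 +_) (trans (length-++ (toList P))
  (cong₂ _+_ (length-toList P) (trans (length-map toℕ (toList w)) (length-toList w))))

cells-++ : ∀ xs ys p → cells (xs ++ ys) (length xs + p) ≡ cells ys p
cells-++ []       ys p = refl
cells-++ (x ∷ xs) ys p = cells-++ xs ys p

cells-beyond : ∀ xs {p} → length xs ≤ p → cells xs p ≡ 0
cells-beyond []       le       = refl
cells-beyond (x ∷ xs) (s≤s le) = cells-beyond xs le

cells-≤ : ∀ {m} xs → All (_≤ m) xs → ∀ p → cells xs p ≤ m
cells-≤ []       _          p       = z≤n
cells-≤ (x ∷ xs) (x≤ ∷ _)   zero    = x≤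
cells-≤ (x ∷ xs) (_  ∷ xs≤) (suc p) = cells-≤ xs xs≤ p

input-letter : ∀ {σ n} (P : Vec ℕ σ) (w : Word σ n) p → cells (input P w) (σ + 2 + p) ≡ letter w p
input-letter {σ} P w p = trans (cong (λ q → cells (input P w) (q + p)) (+-comm σ 2))
  (trans (cong (λ q → cells (toList P ++ map toℕ (toList w)) (q + p)) (sym (length-toList P)))
         (cells-++ (toList P) _ p))

parikh-≤ : ∀ {σ n} (P : Vec ℕ σ) (w : Word σ n) → HasParikh P w → ∀ a → lookup P a ≤ n
parikh-≤ P w parikh a = subst (_≤ _) (parikh a) (count≤n (λ x → x Fin.≟ a) w)

input-≤ : ∀ {σ n m} (P : Vec ℕ σ) (w : Word σ n) → HasParikh P w → n ≤ m → σ ≤ m → All (_≤ m) (input P w)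
input-≤ {m = m} P w parikh n≤m σ≤m = n≤m ∷ σ≤m ∷ prefix P (λ a → ≤-trans (parikh-≤ P w parikh a) n≤m) w σ≤m
  where
  prefix : ∀ {k σ n} (P : Vec ℕ k) → (∀ a → lookup P a ≤ m) → (w : Word σ n) → σ ≤ m →
           All (_≤ m) (toList P ++ map toℕ (toList w))
  prefix []      _  []      _   = []
  prefix []      _  (a ∷ w) σ≤m = ≤-trans (<⇒≤ (toℕ<n a)) σ≤m ∷ prefix [] (λ ()) w σ≤m
  prefix (x ∷ P) P≤ w       σ≤m = P≤ fzero ∷ prefix P (λ a → P≤ (fsuc a)) w σ≤m

swaps-linked : ∀ {σ n} {path : List (Word σ n)} {swaps} → SwapsOf path swaps → Linked Edge path
swaps-linked [-]     = [-]
swaps-linked (e ∷ s) = (_ , e) ∷ swaps-linked s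

-- The main loop

module _ (W : ℕ) (program : Program) where

  open WordRAM W
  open Execution W program

  -- The time between two outputs spans the end of one round and the beginning of the next. A
  -- smaller bound on the first event leaves room for `delayed` to prepend the rest of the preceding
  -- round.
  FirstWithin : (first delay : ℕ) → State → List (ℕ × ℕ) → Set
  FirstWithin f d s []       = ∃[ t ] ∃[ s′ ] (s ⟶[ t ] s′ × step program s′ ≡ halted × suc t ≤ f)
  FirstWithin f d s (o ∷ os) = ∃[ t ] ∃[ s′ ] ∃[ s″ ] (s ⟶[ t ] s′ × step program s′ ≡ emits o s″ ×
                                 suc t ≤ f × OutputsWithDelay program d s″ os)

  delayed : ∀ {f d s s′ u} os → s ⟶[ u ] s′ → u + f ≤ d → FirstWithin f d s′ os →
    OutputsWithDelay program d s os
  delayed {f} {u = u} [] r le (t , _ , q , e , t≤) = finish (r ▷ q) e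
    (≤-trans (≤-reflexive (sym (+-suc u t))) (≤-trans (+-monoʳ-≤ u t≤) le))
  delayed {f} {u = u} (o ∷ os) r le (t , _ , _ , q , e , t≤ , rest) = emit (r ▷ q) e
    (≤-trans (≤-reflexive (sym (+-suc u t))) (≤-trans (+-monoʳ-≤ u t≤) le)) rest

module Loop (program : Program) (layout : Layout loadWord push select move program)
            (n σ lg W : ℕ) (2≤n : 2 ≤ n) (n≤2^lg : n ≤ 2 ^ lg)
            (fits : Semantics.M n σ lg * Semantics.M n σ lg * Semantics.M n σ lg ≤ 2 ^ W)
            (P : Vec ℕ σ) where

  open Semantics n σ lg
  open Verification n σ lg 2≤n n≤2^lg
  open Enumeration n σ lg 2≤n n≤2^lg
  open WordRAM W hiding (⟦_⟧)
  open Execution W program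
  open Correctness W 2≤n fits program
  open Layout layout

  first delay : ℕ
  first = time push + suc (time select + 1)
  delay = suc (time move) + first

  record Path (A : Word σ n → Set) (w : Word σ n) (s : State) : Set where
    field
      path     : List (Word σ n)
      swaps    : List (Swap n)
      vertices : All (HasParikh P) path
      within   : All A path
      distinct : Unique path
      complete : ∀ u → HasParikh P u → A u → u ∈ path
      swapsOf  : SwapsOf (w ∷ path) swaps
      outputs  : FirstWithin W program first delay s (map encode swaps)

  Pushed : Word σ n → (Word σ n → Set) → Post
  Pushed w A ρ G = ∃[ L ] ∃[ p ] (ρ topᵛ ≡ p × Config P w L n p G ×
    (∀ u → HasParikh P u → A u → Todo (_∈ L) w (G used) u) × (∀ u → Todo (_∈ L) w (G used) u → A u))

  Selected : Word σ n → ℕ → Mem → Post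
  Selected w k G ρ G′ = G′ ≡ G × ∃[ j ] Chosen (letter w) k j ρ G

  Moved : Word σ n → (Word σ n → Set) → Post
  Moved w A ρ G = ∃[ L ] (Config P w L (ρ limᵛ) (ρ botᵛ) G ×
    (∀ u → HasParikh P u → A u → u ≡ w ⊎ Todo (Pending L (ρ limᵛ)) w (G used) u) ×
    (∀ u → Todo (Pending L (ρ limᵛ)) w (G used) u → A u))

  enumerate : ∀ fuel (R : List (Word σ n)) → length R ≤ fuel → ∀ {w L ρ G reg mem} →
    Represents ρ G reg mem → Config P w L (ρ limᵛ) (ρ botᵛ) G →
    (∀ u → Todo (Pending L (ρ limᵛ)) w (G used) u → u ∈ R) →
    Path (Todo (Pending L (ρ limᵛ)) w (G used)) w (state pc₂ reg mem)
  enumerate fuel R len {w} {L} {ρ} {G} {reg} {mem} rep C R-todo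
    with runTo push {Pushed w (Todo (Pending L (ρ limᵛ)) w (G used))} at-b b-end rep
           (push-wp P {Pushed w (Todo (Pending L (ρ limᵛ)) w (G used))} {ρ} refl refl C
             λ {ρ′} {G′} {L′} C′ to from → L′ , ρ′ topᵛ , refl , C′ , to , from)
  ... | t₁ , reg₁ , mem₁ , ρ₁ , G₁ , t₁≤ , run₁ , rep₁ , [] , p , top≡ , C₁ , to , from = record
    { path = [] ; swaps = [] ; vertices = [] ; within = [] ; distinct = AllPairs.[] ; swapsOf = [-]
    ; complete = λ u pu todo → ⊥-elim (none {u} (to u pu todo))
    ; outputs = t₁ + 1 , _ , (run₁ ▷ next
      (jumpZ-taken at-test (trans (opd rep₁ (var topᵛ)) (trans top≡ (empty (stack C₁))))) stop) ,
        cong (λ i → exec i (state end reg₁ mem₁)) at-end ,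
        ≤-trans (≤-reflexive (sym (+-suc t₁ 1))) (+-mono-≤ t₁≤ (s≤s (m≤n+m 1 (time select)))) }
    where
    none : ∀ {u} → ¬ Todo (_∈ []) w (G₁ used) u
    none (_ , () , _)
    empty : ∀ {p} → Stack G₁ n p [] → p ≡ 0
    empty nil = refl
  ... | t₁ , reg₁ , mem₁ , ρ₁ , G₁ , t₁≤ , run₁ , rep₁ , k ∷ L₁ , p , top≡ , C₁ , to , from
    with stack C₁
  ... | cons k<n s
    with runTo select {Selected w k G₁} at-c c-end rep₁
           (select-wp {Selected w k G₁} {ρ₁} {G₁} {letter w} k top≡ k<n (stored C₁) (viable C₁ (here refl))
             (λ {ρ′} {j} ch → refl , j , ch))
  ... | t₂ , reg₂ , mem₂ , ρ₂ , .G₁ , t₂≤ , run₂ , rep₂ , refl , j , ch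
    with runTo move {Moved (w ∘ (fromℕ< k<n , fromℕ< (Chosen.j<n ch)))
      (Todo (_∈ k ∷ L₁) w (G₁ used))} at-d d-end rep₂
           (move-wp P {Moved (w ∘ (fromℕ< k<n , fromℕ< (Chosen.j<n ch))) (Todo (_∈ k ∷ L₁) w (G₁ used))}
             C₁ k<n (Chosen.j<n ch) ch λ {ρ′} {G′} {L′} C′ to′ from′ → L′ , C′ , to′ , from′)
  ... | t₃ , reg₃ , mem₃ , ρ₃ , G₃ , t₃≤ , run₃ , rep₃ , L₃ , C₃ , to₃ , from₃ = continue fuel len
    where
    j<n : j < n
    j<n = Chosen.j<n ch
    open Step P C₁ k<n j<n (Chosen.k<j ch) (Chosen.new ch) (Chosen.free ch)
      {write G₁ used k (letter w k) 1} (λ _ _ → refl)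
    Before After : Word σ n → Set
    Before = Todo (Pending L (ρ limᵛ)) w (G used)
    After  = Todo (Pending L₃ (ρ₃ limᵛ)) w′ (G₃ used)
    before-w′ : Before w′
    before-w′ = from w′ todo-w′
    after⇒before : ∀ {u} → After u → Before u
    after⇒before {u} a = from u (from₃ u a)
    continue : ∀ fuel → length R ≤ fuel → Path Before w (state pc₂ reg mem)
    continue fuel len with remove (R-todo w′ before-w′)
    continue zero       len | R′ , len≡ , keep = ⊥-elim (<⇒≱ (s≤s z≤n) (subst (_≤ 0) len≡ len))
    continue (suc fuel) len | R′ , len≡ , keep
      with enumerate fuel R′ (≤-pred (subst (_≤ suc fuel) len≡ len)) rep₃ C₃
             (λ u a → keep (R-todo u (after⇒before {u} a)) (todo-≢ {Pending L₃ (ρ₃ limᵛ)} {w′} {G₃ used} a))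
    ... | rest = record
      { path = w′ ∷ Path.path rest ; swaps = (fromℕ< k<n , fromℕ< j<n) ∷ Path.swaps rest
      ; vertices = parikh′ ∷ Path.vertices rest
      ; within = before-w′ ∷ All.map {P = After} {Q = Before} (λ {u} → after⇒before {u}) (Path.within rest)
      ; distinct = All.map {P = After} (λ a e → todo-≢ {Pending L₃ (ρ₃ limᵛ)} {w′} {G₃ used} a (sym e))
        (Path.within rest) AllPairs.∷ Path.distinct rest
      ; complete = λ u pu b → found′ u pu (to₃ u pu (to u pu b))
      ; swapsOf = (isSwap , refl) ∷ Path.swapsOf rest
      ; outputs = t₁ + suc t₂ , _ , _ ,
          (run₁ ▷ next (jumpZ-skipped at-test
            (λ z → 1+n≢0 (trans (sym top≡) (trans (sym (opd rep₁ (var topᵛ))) z)))) run₂) ,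
          trans (step≡ at-emit reg₂ mem₂) (cong (λ o → emits o (state (suc pc₄) reg₂ mem₂)) (cong₂ _,_
            (trans (opd rep₂ (var kᵛ)) (trans (Chosen.k≡ ch) (sym (toℕ-fromℕ< k<n))))
            (trans (opd rep₂ (var jᵛ)) (trans (Chosen.j≡ ch) (sym (toℕ-fromℕ< j<n)))))) ,
          ≤-trans (≤-reflexive (sym (+-suc t₁ (suc t₂))))
            (+-mono-≤ t₁≤ (s≤s (≤-trans (s≤s t₂≤) (≤-reflexive (+-comm 1 (time select)))))) ,
          delayed W program (map encode (Path.swaps rest)) (run₃ ▷ next (step≡ at-jump reg₃ mem₃) stop)
            (+-monoˡ-≤ first (≤-trans (≤-reflexive (+-comm t₃ 1)) (s≤s t₃≤))) (Path.outputs rest) }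
      where
      found′ : ∀ u → HasParikh P u → u ≡ w′ ⊎ After u → u ∈ w′ ∷ Path.path rest
      found′ u pu (inj₁ e) = here e
      found′ u pu (inj₂ a) = there (Path.complete rest u pu a)

-- Setup code and constants

module _ {W : ℕ} {program : Program} where

  open WordRAM W

  outputs-≤ : ∀ {d d′ s os} → d ≤ d′ → OutputsWithDelay program d s os → OutputsWithDelay program d′ s os
  outputs-≤ le (finish r e t≤)      = finish r e (≤-trans t≤ le)
  outputs-≤ le (emit r e t≤ rest) = emit r e (≤-trans t≤ le) (outputs-≤ le rest)

  open Execution W program

  -- Shared by both cases: for n < 2 the run consists of these three instructions, the jump and
  -- `halt`.
  checkSize : ∀ {end} → At program 0 (setup end) → ∀ mem →
    ∃[ reg ] (state 0 (λ _ → 0) mem ⟶[ 3 ] state 3 reg mem × reg 0 ≡ 0 × reg 1 ≡ trunc 1 ×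
    reg 2 ≡ trunc (mem 0) × reg 6 ≡ trunc (bit (trunc 1 <ᵇ trunc (mem 0))) × (∀ r → reg (8 + r) ≡ 0))
  checkSize (e₀ , e₁ , e₂ , _) mem = _ ,
    next (step≡ e₀ _ mem) (next (step≡ e₁ _ mem) (next (step≡ e₂ _ mem) stop)) ,
        refl , refl , refl , refl , λ _ → refl

  readSizes : ∀ {end} → At program 0 (setup end) → ∀ mem reg →
    ∃[ reg′ ] (state 4 reg mem ⟶[ 6 ] state 10 reg′ mem × reg′ 0 ≡ reg 0 × reg′ 1 ≡ reg 1 ×
    reg′ 2 ≡ reg 2 × reg′ 3 ≡ trunc (mem (reg 1)) × reg′ 4 ≡ trunc (trunc (reg′ 3 + reg 1) + reg 1) ×
    reg′ 5 ≡ trunc (trunc (trunc (reg 2 + reg 2) + reg′ 4) + reg 1) × (∀ r → reg′ (8 + r) ≡ reg (8 + r)))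
  readSizes (_ , _ , _ , _ , e₄ , e₅ , e₆ , e₇ , e₈ , e₉ , _) mem reg = _ ,
        next (step≡ e₄ _ mem) (next (step≡ e₅ _ mem) (next (step≡ e₆ _ mem)
          (next (step≡ e₇ _ mem) (next (step≡ e₈ _ mem) (next (step≡ e₉ _ mem) stop))))) ,
        refl , refl , refl , refl , refl , refl , λ _ → refl

  setup-long : ∀ {end} → At program 0 (setup end) → ∀ {mem} n σ → mem 0 ≡ n → mem 1 ≡ σ → 2 ≤ n →
    (∀ {x} → x ≤ suc (n + n + (σ + 2)) → trunc x ≡ x) →
    ∃[ reg ] (state 0 (λ _ → 0) mem ⟶[ 10 ] state 10 reg mem × reg 0 ≡ 0 × reg 1 ≡ 1 × reg 2 ≡ n ×
      reg 3 ≡ σ ×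
      reg 4 ≡ σ + 2 × reg 5 ≡ suc (n + n + (σ + 2)) × (∀ r → reg (8 + r) ≡ 0))
  setup-long at@(_ , _ , _ , e₃ , _) {mem} n σ n≡ σ≡ 2≤n fits = combine (checkSize at mem)
    where
    trunc-1 : trunc 1 ≡ 1
    trunc-1 = fits (s≤s z≤n)
    trunc-n : trunc n ≡ n
    trunc-n = fits (m≤n⇒m≤1+n (≤-trans (m≤m+n n n) (m≤m+n _ _)))
    trunc-σ : trunc σ ≡ σ
    trunc-σ = fits (m≤n⇒m≤1+n (≤-trans (m≤m+n σ 2) (m≤n+m _ (n + n))))
    is-one : ∀ {b} → T b → bit b ≡ 1
    is-one {true} _ = refl
    one-flag : trunc (bit (trunc 1 <ᵇ trunc (mem 0))) ≡ 1
    one-flag = trans (cong₂ (λ a b → trunc (bit (a <ᵇ b))) trunc-1 (trans (cong trunc n≡) trunc-n))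
      (trans (cong trunc (is-one (<⇒<ᵇ 2≤n))) trunc-1)
    combine : ∃[ reg ] (state 0 (λ _ → 0) mem ⟶[ 3 ] state 3 reg mem × reg 0 ≡ 0 × reg 1 ≡ trunc 1 ×
      reg 2 ≡ trunc (mem 0) × reg 6 ≡ trunc (bit (trunc 1 <ᵇ trunc (mem 0))) × (∀ r → reg (8 + r) ≡ 0)) → _
    combine (reg , run₀ , r0 , r1 , r2 , r6 , rv) with readSizes at mem reg
    ... | reg′ , run₁ , s0 , s1 , s2 , s3 , s4 , s5 , sv =
      reg′ , (run₀ ▷ next (jumpZ-skipped e₃ (λ z → 1+n≢0 (trans (sym one-flag) (trans (sym r6) z)))) run₁) ,
      trans s0 r0 , trans s1 v1 , trans s2 v2 , v3 , v4 , v5 , λ r → trans (sv r) (rv r)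
      where
      v1 : reg 1 ≡ 1
      v1 = trans r1 trunc-1
      v2 : reg 2 ≡ n
      v2 = trans r2 (trans (cong trunc n≡) trunc-n)
      v3 : reg′ 3 ≡ σ
      v3 = trans s3 (trans (cong (λ a → trunc (mem a)) v1) (trans (cong trunc σ≡) trunc-σ))
      v4 : reg′ 4 ≡ σ + 2
      v4 = trans s4 (trans (cong₂ (λ a b → trunc (trunc (a + b) + b)) v3 v1)
        (trans (cong (λ a → trunc (a + 1))
          (fits (m≤n⇒m≤1+n (≤-trans (+-monoʳ-≤ σ (s≤s z≤n)) (m≤n+m _ (n + n))))))
          (trans (cong trunc (+-assoc σ 1 1)) (fits (m≤n⇒m≤1+n (m≤n+m _ (n + n)))))))
      v5 : reg′ 5 ≡ suc (n + n + (σ + 2))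
      v5 = trans s5 (trans (cong₂ (λ a b → trunc (trunc (trunc (a + a) + b) + reg 1)) v2 v4)
        (trans (cong (λ a → trunc (trunc (trunc (n + n) + (σ + 2)) + a)) v1)
        (trans (cong (λ a → trunc (trunc (a + (σ + 2)) + 1)) (fits (m≤n⇒m≤1+n (m≤m+n _ _))))
        (trans (cong (λ a → trunc (a + 1)) (fits (n≤1+n _)))
        (trans (cong trunc (+-comm _ 1)) (fits ≤-refl))))))

IsLog IsNotN : Range → Set
IsLog ⟨log⟩ = ⊤
IsLog _     = ⊥
IsNotN ⟨n⟩ = ⊥
IsNotN _   = ⊤

record Sufficient (c : ℕ) : Set where
  field
    -- The ten instructions of `setup`, the initial comparison in `loadWord` and the final test of
    -- its loop.
    12≤c     : 12 ≤ c
    letter≤c : 2 + steps loadLetter ≤ c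
    round≤c  : steps (move ⨾ push ⨾ select) ≤ c

open Sufficient

module Times {c} (suff : Sufficient c) (n σ lg : ℕ) (1≤σ : 1 ≤ σ) (1≤lg : 1 ≤ lg) where

  open Semantics n σ lg

  preprocessing-time : 10 + time loadWord ≤ c * (1 + n * lg)
  preprocessing-time = affine-≤ {12} {2 + steps loadLetter} {c} {n * (2 + time loadLetter)} (n * lg)
    (12≤c suff) (letter≤c suff)
    (rounds-≤ {steps loadLetter} {time loadLetter} n lg 1≤lg
      (time-flat {IsLog} {lg} 1≤lg log≤ loadLetter _))
    where
    log≤ : ∀ l → IsLog l → range l ≤ lg
    log≤ ⟨log⟩ _ = ≤-refl

  -- A round has no nested loops, and each loop runs over the alphabet or along a tree path. Since σ
  -- and lg are at least 1, their product bounds both ranges.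
  delay-time : suc (time move) + (time push + suc (time select + 1)) ≤ c * (1 + σ * lg)
  delay-time = ≤-trans
    (sum-≤ {steps (move ⨾ push ⨾ select) * (σ * lg)} (time move) (time push) (time select)
      (time-flat {IsNotN} {σ * lg} (*-mono-≤ 1≤σ 1≤lg) ranges (move ⨾ push ⨾ select) _))
    (affine-≤ {3} {steps (move ⨾ push ⨾ select)} {c} {steps (move ⨾ push ⨾ select) * (σ * lg)} (σ * lg)
      (≤-trans (m≤m+n 3 9) (12≤c suff)) (round≤c suff) ≤-refl)
    where
    ranges : ∀ l → IsNotN l → range l ≤ σ * lg
    ranges ⟨σ⟩   _ = m≤m*n σ lg ⦃ >-nonZero 1≤lg ⦄
    ranges ⟨log⟩ _ = m≤n*m lg σ ⦃ >-nonZero 1≤σ ⦄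

Solution : ∀ {σ n} (program : Program) (c lg W : ℕ) → Vec ℕ σ → Word σ n → Set
Solution {σ} {n} program c lg W P w = ∃[ path ] ∃[ swaps ]
  ( IsHamiltonianPath P (w ∷ path) × SwapsOf (w ∷ path) swaps
  × WordRAM.Enumerates W program (c * (1 + n * lg)) (c * (1 + σ * lg)) (initial (input P w))
    (map encode swaps))

-- The Hamiltonian path for words of length at least 2

module Long {program c} (layout : Layout loadWord push select move program) (suff : Sufficient c)
            (n σ lg W : ℕ) (2≤n : 2 ≤ n) (n≤2^lg : n ≤ 2 ^ lg) (1≤lg : 1 ≤ lg)
            (fits : Semantics.M n σ lg * Semantics.M n σ lg * Semantics.M n σ lg ≤ 2 ^ W)
            (P : Vec ℕ σ) (w : Word σ n) (pw : HasParikh P w) where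

  open Semantics n σ lg
  open Verification n σ lg 2≤n n≤2^lg
  open Enumeration n σ lg 2≤n n≤2^lg
  open Loop program layout n σ lg W 2≤n n≤2^lg fits P
  open Correctness W 2≤n fits program
  open WordRAM W hiding (⟦_⟧)
  open Execution W program
  open Layout layout

  mem : ℕ → ℕ
  mem = cells (input P w)

  1≤σ : 1 ≤ σ
  1≤σ = ≤-trans (s≤s z≤n) (letter-< w {0} (≤-trans (s≤s z≤n) 2≤n))

  G₀ : Mem
  G₀ t x y = mem (locate t x y)

  -- A tag other than `inp` contributes a positive leading digit, which puts its cells beyond the
  -- end of the input.
  blank : ∀ t → t ≢ inp → ∀ x y → G₀ t x y ≡ 0
  blank t t≢ x y = cells-beyond (input P w) (≤-trans (≤-reflexive (length-input P w))
    (≤-trans N≤M (≤-trans (≤-trans (≤-trans (m≤n*m M (code t) ⦃ >-nonZero (positive t t≢) ⦄) (m≤m+n _ x))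
      (m≤m*n _ M)) (m≤m+n _ y))))
    where
    N≤M : 2 + (σ + n) ≤ M
    N≤M = s≤s (≤-trans (≤-reflexive (trans (cong suc (+-comm σ n)) (sym (+-suc n σ))))
      (+-mono-≤ (m≤m+n n n) (≤-trans (n≤1+n _) (≤-reflexive (+-comm 2 σ)))))
    positive : ∀ t → t ≢ inp → 0 < code t
    positive inp  t≢ = ⊥-elim (t≢ refl)
    positive word t≢ = s≤s z≤n
    positive tree t≢ = s≤s z≤n
    positive used t≢ = s≤s z≤n
    positive ptr  t≢ = s≤s z≤n

  Constants : (ℕ → ℕ) → Set
  Constants reg = reg 0 ≡ 0 × reg 1 ≡ 1 × reg 2 ≡ n × reg 3 ≡ σ × reg 4 ≡ σ + 2 ×
    reg 5 ≡ M × (∀ r → reg (8 + r) ≡ 0)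

  represents : ∀ {reg} → Constants reg → Represents (λ _ → 0) G₀ reg mem
  represents {reg} (r0 , r1 , r2 , r3 , r4 , r5 , rv) = record
    { opd = opd′ ; radix = r5 ; cell = λ _ _ _ → refl ; var≤ = λ _ → z≤n
    ; cell≤ = λ t x y → cells-≤ (input P w) entries (locate t x y) }
    where
    entries : All (_≤ B) (input P w)
    entries = input-≤ P w pw (≤-trans (m≤m+n n n) (m≤m+n _ _)) (≤-trans (m≤m+n σ 2) (m≤n+m _ (n + n)))
    opd′ : ∀ a → reg (register a) ≡ ⟦ a ⟧ᵒ (λ _ → 0)
    opd′ #0      = r0
    opd′ #1      = r1
    opd′ #n      = r2
    opd′ #σ      = r3
    opd′ #h      = r4
    opd′ (var r) = rv r

  setup-run : ∃[ reg ] (state 0 (λ _ → 0) mem ⟶[ 10 ] state 10 reg mem × Constants reg)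
  setup-run = setup-long {W} {program} at-setup {mem} n σ refl refl 2≤n small-M
    where
    small-M : ∀ {x} → x ≤ M → trunc x ≡ x
    small-M x≤ = trunc-< (≤-<-trans x≤ (m<m³ M (≤-trans (s≤s (s≤s z≤n)) 6≤M)))

  Loaded : Post
  Loaded ρ G = Config P w [] (ρ limᵛ) (ρ botᵛ) G × ρ limᵛ ≡ 0 × (∀ k {b} → b < σ → G used k b ≡ 0)

  -- The zeros of the initial registers already describe the start: `limᵛ` = 0 makes every level
  -- fresh, and `botᵛ` = 0 is the empty stack.
  loaded : wp loadWord Loaded (λ _ → 0) G₀
  loaded = loadWord-wp {Loaded} {λ _ → 0} {G₀} {letter w} refl (letter-< w) (λ {p} _ → input-letter P w p)
    (blank tree (λ ())) λ {ρ′} {G′} vars≡ used≡ ptr≡ stored′ →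
    record { parikh = pw ; stored = stored′
      ; stack = subst (λ b → Stack G′ (ρ′ limᵛ) b []) (sym (vars≡ 5)) nil
           ; lim≤n = subst (_≤ n) (sym (vars≡ 6)) z≤n ; viable = λ () ; unused = λ {k} _ {b} _ → trans (used≡ k b) (blank used (λ ()) k b)
           ; unlinked = λ {k} _ → trans (ptr≡ k k) (blank ptr (λ ()) k k) } ,
    vars≡ 6 , λ k {b} _ → trans (used≡ k b) (blank used (λ ()) k b)

  finishLoop : ∀ {t₀ t₁ s ρ G reg mem′} → initial (input P w) ⟶[ t₀ ] s → s ⟶[ t₁ ] state pc₂ reg mem′ →
    t₀ + t₁ ≤ c * (1 + n * lg) → Represents ρ G reg mem′ → Loaded ρ G → Solution program c lg W P w
  finishLoop {t₀} {t₁} {ρ = ρ} {G} {reg} {mem′} run₀ run₁ t≤ rep (C , lim≡0 , unflagged) =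
    conclude (enumerate (length (words σ n)) (words σ n) ≤-refl rep C (λ u _ → ∈-words u))
    where
    conclude : Path (Todo (Pending [] (ρ limᵛ)) w (G used)) w (state pc₂ reg mem′) →
      Solution program c lg W P w
    conclude rest = Path.path rest , Path.swaps rest , record
      { vertices = pw ∷ Path.vertices rest
      ; edges = swaps-linked (Path.swapsOf rest)
      ; noRepeats = All.map (λ a e → todo-≢ {Pending [] (ρ limᵛ)} {w} {G used} a (sym e)) (Path.within rest)
                    AllPairs.∷ Path.distinct rest
      ; exhaustive = all } , Path.swapsOf rest ,
      t₀ + t₁ , state pc₂ reg mem′ , t≤ , (run₀ ▷ run₁) ,
      outputs-≤ (Times.delay-time suff n σ lg 1≤σ 1≤lg)
        (delayed W program (map encode (Path.swaps rest)) stop (m≤n+m first (suc (time move)))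
          (Path.outputs rest))
      where
      all : ∀ u → HasParikh P u → u ∈ w ∷ Path.path rest
      all u pu with firstDifference u w
      ... | inj₁ e = here e
      ... | inj₂ (k , k<n , agree , differ) = there (Path.complete rest u pu
              (k , inj₂ (subst (_≤ k) (sym lim≡0) z≤n) , k<n , agree , differ ,
                unflagged k (letter-< u k<n)))

  solve : Solution program c lg W P w
  solve = afterSetup setup-run
    where
    afterLoad : ∀ {reg₀} → state 0 (λ _ → 0) mem ⟶[ 10 ] state 10 reg₀ mem →
      Reaches (time loadWord) 10 pc₂ Loaded reg₀ mem → Solution program c lg W P w
    afterLoad run₀ (t₁ , _ , _ , _ , _ , t₁≤ , run₁ , rep₁ , q) = finishLoop run₀ run₁
      (≤-trans (+-monoʳ-≤ 10 t₁≤) (Times.preprocessing-time suff n σ lg 1≤σ 1≤lg)) rep₁ q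
    afterSetup : ∃[ reg ] (state 0 (λ _ → 0) mem ⟶[ 10 ] state 10 reg mem × Constants reg) →
      Solution program c lg W P w
    afterSetup (_ , run₀ , cs) = afterLoad run₀ (runTo loadWord at-a a-end (represents cs) loaded)

solution : ∀ {program c} → Layout loadWord push select move program → Sufficient c →
  ∀ σ n (P : Vec ℕ σ) (w : Word σ n) → HasParikh P w → ∀ W → 6 * ⌈log₂ (length (input P w)) ⌉ ≤ W →
  Solution program c ⌈log₂ n ⌉ W P w
solution {program} {c} layout suff σ n P w pw W bits = by-size (2 ≤? n)
  where
  open Layout layout
  open WordRAM W hiding (⟦_⟧)
  open Execution W program

  N lg M : ℕ
  N = 2 + (σ + n)
  lg = ⌈log₂ n ⌉
  M = suc (n + n + (σ + 2))

  mem : ℕ → ℕ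
  mem = cells (input P w)

  bits′ : 6 * ⌈log₂ N ⌉ ≤ W
  bits′ = subst (λ l → 6 * ⌈log₂ l ⌉ ≤ W) (length-input P w) bits

  trunc-N : ∀ {x} → x < N → trunc x ≡ x
  trunc-N x< = m<n⇒m%n≡m {n = 2 ^ W} ⦃ m^n≢0 2 W ⦄ (<-≤-trans x< (size-≤ N bits′))

  trunc-1 : trunc 1 ≡ 1
  trunc-1 = trunc-N (s≤s (s≤s z≤n))

  trunc-n : trunc n ≡ n
  trunc-n = trunc-N (s≤s (≤-trans (m≤n+m n σ) (n≤1+n _)))

  short : ¬ 2 ≤ n → Solution program c ⌈log₂ n ⌉ W P w
  short n<2 with checkSize {W} {program} at-setup mem | at-setup
  ... | reg , run₀ , _ , _ , _ , reg6 , _ | _ , _ , _ , e₃ , _ = [] , [] ,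
    record { vertices = pw ∷ [] ; edges = [-] ; noRepeats = [] AllPairs.∷ AllPairs.[]
      ; exhaustive = only } , [-] ,
    0 , initial (input P w) , z≤n , stop ,
    finish (run₀ ▷ next (jumpZ-taken e₃ (trans reg6 zero-flag)) stop)
      (cong (λ i → exec i (state end reg mem)) at-end)
      (≤-trans (≤-trans (m≤m+n 5 7) (12≤c suff)) (m≤m*n c _))
    where
    zero-flag : trunc (bit (trunc 1 <ᵇ trunc n)) ≡ 0
    zero-flag = trans (cong₂ (λ a b → trunc (bit (a <ᵇ b))) trunc-1 trunc-n)
      (trans (cong trunc (bit-range {1} {n} (≤-pred (≰⇒> n<2)))) (trunc-N (s≤s z≤n)))
    only : ∀ u → HasParikh P u → u ∈ w ∷ []
    only u pu with firstDifference u w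
    ... | inj₁ e = here e
    ... | inj₂ (k , k<n , agree , differ) with parikh-later P u w pu pw k<n agree differ
    -- A second word would require two distinct positions k < q < n.
    ...   | q , k<q , q<n , _ = ⊥-elim (n<2 (≤-trans (s≤s (≤-trans (s≤s z≤n) k<q)) q<n))

  long : 2 ≤ n → Solution program c ⌈log₂ n ⌉ W P w
  long 2≤n = Long.solve layout suff n σ ⌈log₂ n ⌉ W 2≤n (n≤2^⌈log₂n⌉ n) (⌈log₂⌉-mono-≤ {2} {n} 2≤n)
    (cube-≤ N bits′ M≤N²) P w pw
    where
    M≤N² : M ≤ N * N
    -- The radix is at most 2N, and N is at least 2.
    M≤N² = ≤-trans (≤-trans (s≤s (≤-trans (≤-reflexive (+-assoc n n (σ + 2)))
        (≤-trans (+-monoʳ-≤ n (≤-reflexive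
          (trans (sym (+-assoc n σ 2)) (trans (+-comm (n + σ) 2) (cong (2 +_) (+-comm n σ))))))
          (m≤n⇒m≤1+n (+-monoˡ-≤ N (m≤n+m n σ))))))
        (≤-reflexive (cong (N +_) (sym (+-identityʳ N)))))
      (*-monoˡ-≤ N {2} {N} (m≤m+n 2 _))

  by-size : Dec (2 ≤ n) → _
  by-size (yes 2≤n) = long 2≤n
  by-size (no n<2)  = short n<2

theorem5 : ∃[ prog ] ∃[ κ ] ∃[ c ]
  (∀ (σ n : ℕ) (P : Vec ℕ σ) → sum P ≡ n →
   (w : Word σ n) → HasParikh P w →
   (W : ℕ) → κ * ⌈log₂ (length (input P w)) ⌉ ≤ W →
   ∃[ path ] ∃[ swaps ]
     ( IsHamiltonianPath P (w ∷ path)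
     × SwapsOf (w ∷ path) swaps
     × WordRAM.Enumerates W prog
         (c * (1 + n * ⌈log₂ n ⌉))
         (c * (1 + σ * ⌈log₂ n ⌉))
         (initial (input P w))
         (map encode swaps)))
theorem5 = proj₁ assembled , 6 , constant , λ σ n P _ w parikh W →
  solution (proj₂ assembled) enough σ n P w parikh W
  where
  assembled : ∃[ prog ] Layout loadWord push select move prog
  assembled = assemble loadWord push select move
  constant : ℕ
  constant = 12 + ((2 + steps loadLetter) + steps (move ⨾ push ⨾ select))
  enough : Sufficient constant
  enough = record
    { 12≤c     = m≤m+n 12 _
    ; letter≤c = ≤-trans (m≤m+n (2 + steps loadLetter) _) (m≤n+m _ 12)
    ; round≤c  = ≤-trans (m≤n+m _ (2 + steps loadLetter)) (m≤n+m _ 12) }
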